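{- Let $q$ be an odd prime power and let $A,B\in\widehat{\mathbb{F}_q^*}$ with $A^2\neq\varepsilon$ and $B^4 \neq \varepsilon$. Then $${}_{4}F_{4}\left( \begin{array}{cccc} A, & \varphi A, & B, & \varphi B\\ \varepsilon, & \varphi, & A\overline{B}, & \varphi A\overline{B} \end{array} \Big| \; 1 \right)_{q} = \frac{g(B^2)\,g(\overline{A}^2 B^4)}{g(\overline{A}^2 B^2)\,g(B^4)} + \sum_{R^2=A^2} \frac{g(\overline{A}^2)\,g(\overline{R} B^2)}{g(\overline{R})\,g(\overline{A}^2 B^2)},$$ where the sum is over all $R\in\widehat{\mathbb{F}_q^*}$ with $R^2=A^2$.
   Context: $\mathbb{F}_q$ is the finite field with $q$ elements and $\widehat{\mathbb{F}_q^*}$ the group of (complex) multiplicative characters of $\mathbb{F}_q^*$; every $\chi\in\widehat{\mathbb{F}_q^*}$, including the trivial character $\varepsilon$, is extended to $\mathbb{F}_q$ by $\chi(0):=0$; $\overline{\chi}$ is the inverse of $\chi$; $\varphi$ is the character of order two. Fix a non-trivial additive character $\theta$ of $\mathbb{F}_q$ and define the Gauss sum $g(\chi):=\sum_{x\in\mathbb{F}_q}\chi(x)\theta(x)$. For $A_i,B_i\in\widehat{\mathbb{F}_q^*}$ and $\lambda\in\mathbb{F}_q$, $${}_{m}F_{m}\left( \begin{array}{ccc} A_1, & \dots, & A_m \\ B_1, & \dots, & B_m \end{array} \Big| \; \lambda \right)_{q} := \frac{ -1}{q-1} \sum_{\chi \in \widehat{\mathbb{F}_q^{*}}} \prod_{i=1}^{m}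 \frac{g(A_i \chi)}{g(A_i)} \frac{g(\overline{B_i \chi})}{g(\overline{B_i})}\, \chi(-1)^{m} \chi(\lambda).$$ -}

module Defs where

open import Level using (Level; _⊔_; suc)
open import Algebra.Apartness.Bundles using (HeytingField; HeytingCommutativeRing)
open import Algebra.Bundles using (CommutativeRing; AbelianGroup)
import Algebra.Definitions.RawMonoid as RawMonoidDefinitions
open import Algebra.Morphism.Structures using (module MonoidMorphisms)
import Algebra.Properties.CommutativeMonoid.Sum as CommutativeMonoidSum
import Algebra.Properties.CommutativeSemiring.Exp as CommSemiringExp
import Algebra.Properties.Monoid.Mult as MonoidMult
import Algebra.Properties.Ring as RingProperties
import Algebra.Properties.Semiring.Exp as SemiringExp
import Algebra.Properties.Semiring.Sum as SemiringSum
import Algebra.Solver.Ring.NaturalCoefficients.Default as SemiringSolver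
open import Data.Fin.Base using (Fin)
import Data.Fin as Fin
import Data.Fin.Permutation as Fin
import Data.Fin.Properties as Fin
open import Data.List.Base as List using (List; []; _∷_)
import Data.List.Membership.Setoid as Membership
open import Data.List.Membership.Propositional using (lose)
open import Data.List.Membership.Propositional.Properties using (∈-allFin; ∈-lookup)
open import Data.List.Relation.Unary.All as All using (All; []; _∷_)
import Data.List.Relation.Unary.All.Properties as All
open import Data.List.Relation.Unary.Any as Any using (Any; here; there)
import Data.List.Relation.Unary.Any.Properties as Any
open import Data.List.Relation.Unary.Enumerates.Setoid using (IsEnumeration)
import Data.List.Relation.Unary.Enumerates.Setoid.Properties as Enumerates
import Data.List.Relation.Unary.Unique.Setoid as Uniqueness
open import Data.List.Relation.Unary.Unique.DecSetoid.Properties using (deduplicate-!)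
open import Data.Maybe.Base using (Maybe; just; nothing)
import Data.Maybe.Relation.Unary.Any as Maybe
open import Data.Nat.Base using (ℕ; zero; _!)
import Data.Nat as ℕ
import Data.Nat.Properties as ℕ
open import Data.Nat.Divisibility using (_∣_; _∤_; divides; ∣-trans; m≤n⇒m!∣n!)
open import Data.Product.Base using (Σ-syntax; ∃-syntax; _×_; _,_; proj₁; proj₂)
open import Data.Nat.Primality using (Prime)
open import Data.Sum.Base using (_⊎_; inj₁; inj₂)
open import Data.Vec.Functional using (Vector)
open import Data.Vec.Base using (Vec; []; _∷_; replicate)
open import Function.Bundles using (Inverse)
open import Relation.Binary.Bundles using (Setoid; DecSetoid)
open import Relation.Binary.Core using (Rel)
open import Relation.Binary.PropositionalEquality as ≡ using (_≡_)
import Relation.Binary.Reasoning.Setoid as SetoidReasoning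
open import Relation.Nullary using (¬_; Dec; yes; no)
open import Relation.Nullary.Decidable using (map′; _×-dec_)
open import Relation.Nullary.Negation using (contradiction)

open MonoidMorphisms using (IsMonoidHomomorphism)

private variable c ℓ₁ ℓ₂ k κ₁ κ₂ : Level

module Ring (𝓡 : CommutativeRing c ℓ₁) where

  open CommutativeRing 𝓡 public
  open RingProperties ring public
  open SemiringExp semiring public using (_^_; ^-congˡ; ^-congʳ; ^-homo-*; ^-assocʳ)
  open CommSemiringExp commutativeSemiring public using (^-distrib-*)
  open MonoidMult +-monoid public using () renaming (_×_ to _·_)
  open SemiringSum semiring public
  open CommutativeMonoidSum *-commutativeMonoid public using () renaming (sum to product)
  open SetoidReasoning setoid
  open SemiringSolver commutativeSemiring using (solve; con; _:=_; _:+_; _:*_)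

  -- The monic polynomial a₀ + a₁X + … + aₙ₋₁Xⁿ⁻¹ + Xⁿ with coefficient vector
  -- (a₀ , … , aₙ₋₁), evaluated at x by Horner's rule.
  monic : ∀ {n} → Vec Carrier n → Carrier → Carrier
  monic []       x = 1#
  monic (a ∷ as) x = a + x * monic as x

  product-of-differences : Carrier → List Carrier → Carrier
  product-of-differences x []       = 1#
  product-of-differences x (r ∷ rs) = (x - r) * product-of-differences x rs

  abstract

    -≈0⇒≈ : ∀ {x y} → x - y ≈ 0# → x ≈ y
    -≈0⇒≈ {x} {y} e = begin
      x             ≈⟨ +-identityʳ x ⟨
      x + 0#        ≈⟨ +-congˡ (-‿inverseˡ y) ⟨
      x + (- y + y) ≈⟨ +-assoc _ _ _ ⟨
      (x - y) + y   ≈⟨ +-congʳ e ⟩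
      0# + y        ≈⟨ +-identityˡ y ⟩
      y             ∎

    ≈⇒-≈0 : ∀ {x y} → x ≈ y → x - y ≈ 0#
    ≈⇒-≈0 {x} {y} e = trans (+-congʳ e) (-‿inverseʳ y)

    1^n≈1 : ∀ n → 1# ^ n ≈ 1#
    1^n≈1 zero      = refl
    1^n≈1 (ℕ.suc n) = trans (*-identityˡ _) (1^n≈1 n)

    [ab][cd]≈[ac][bd] : ∀ a b c d → (a * b) * (c * d) ≈ (a * c) * (b * d)
    [ab][cd]≈[ac][bd] = solve 4 (λ a b c d → (a :* b) :* (c :* d) := (a :* c) :* (b :* d)) refl

    +≈+⇒-≈- : ∀ {a b z w} → a + z ≈ b + w → a - b ≈ w - z
    +≈+⇒-≈- {a} {b} {z} {w} e = begin
      a - b               ≈⟨ +-identityʳ (a - b) ⟨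
      (a - b) + 0#        ≈⟨ +-congˡ (-‿inverseʳ z) ⟨
      (a - b) + (z - z)   ≈⟨ shuffle a (- b) z (- z) ⟩
      (a + z) + (- b - z) ≈⟨ +-congʳ e ⟩
      (b + w) + (- b - z) ≈⟨ shuffle b w (- b) (- z) ⟩
      (b - b) + (w - z)   ≈⟨ +-congʳ (-‿inverseʳ b) ⟩
      0# + (w - z)        ≈⟨ +-identityˡ (w - z) ⟩
      w - z               ∎
      where
      shuffle : ∀ p q r s → (p + q) + (r + s) ≈ (p + r) + (q + s)
      shuffle = solve 4 (λ p q r s → (p :+ q) :+ (r :+ s) := (p :+ r) :+ (q :+ s)) refl

    +≈+⇒-≈-* : ∀ {a b x y h} → a + y * h ≈ b + x * h → a - b ≈ (x - y) * h
    +≈+⇒-≈-* {x = x} {y} {h} e = trans (+≈+⇒-≈- e) (sym ([y-z]x≈yx-zx h x y))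

    geometric : Carrier → ℕ → Carrier
    geometric x zero      = 0#
    geometric x (ℕ.suc n) = 1# + x * geometric x n

    geometric-^ : ∀ x n → x ^ n + geometric x n ≈ 1# + x * geometric x n
    geometric-^ x zero      = +-congˡ (sym (zeroʳ x))
    geometric-^ x (ℕ.suc n) = begin
      x * p + (1# + x * g)  ≈⟨ solve 3 (λ x p g → x :* p :+ (con 1 :+ x :* g) := con 1 :+ x :* (p :+ g)) refl x p g ⟩
      1# + x * (p + g)      ≈⟨ +-congˡ (*-congˡ (geometric-^ x n)) ⟩
      1# + x * (1# + x * g) ∎
      where
      p : Carrier
      p = x ^ n
      g : Carrier
      g = geometric x n

    [x-1]*geometric : ∀ x n → x ^ n ≈ 1# → (x - 1#) * geometric x n ≈ 0#
    [x-1]*geometric x n e = trans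
      (sym (+≈+⇒-≈-* (trans (+-congˡ (*-identityˡ _)) (trans (+-congʳ (sym e)) (geometric-^ x n)))))
      (-‿inverseʳ 1#)

    geometric-n : ∀ x n → ∃[ h ] geometric x n + 1# * h ≈ n · 1# + x * h
    geometric-n x zero      = 0# , +-congˡ (trans (zeroʳ 1#) (sym (zeroʳ x)))
    geometric-n x (ℕ.suc n) with h , e ← geometric-n x n = g + h , (begin
      (1# + x * g) + 1# * (g + h)       ≈⟨ solve 3 (λ x g h → (con 1 :+ x :* g) :+ con 1 :* (g :+ h) := (con 1 :+ x :* g) :+ (g :+ con 1 :* h)) refl x g h ⟩
      (1# + x * g) + (g + 1# * h)       ≈⟨ +-congˡ e ⟩
      (1# + x * g) + (n · 1# + x * h)   ≈⟨ solve 4 (λ x g m h → (con 1 :+ x :* g) :+ (m :+ x :* h) := (con 1 :+ m) :+ x :* (g :+ h)) refl x g (n · 1#) h ⟩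
      (1# + n · 1#) + x * (g + h)       ∎)
      where
      g : Carrier
      g = geometric x n

    quotient : ∀ {n} → Carrier → Vec Carrier (ℕ.suc n) → Vec Carrier n
    quotient r (a ∷ [])         = []
    quotient r (a ∷ as@(_ ∷ _)) = monic as r ∷ quotient r as

    monic-quotient : ∀ {n} r (as : Vec Carrier (ℕ.suc n)) x →
                     monic as x + r * monic (quotient r as) x ≈ monic as r + x * monic (quotient r as) x
    monic-quotient r (a ∷ []) x =
      solve 3 (λ a r x → (a :+ x :* con 1) :+ r :* con 1 := (a :+ r :* con 1) :+ x :* con 1) refl a r x
    monic-quotient r (a ∷ as@(_ ∷ _)) x = begin
      (a + x * P) + r * (R + x * Q) ≈⟨ solve 6 (λ a x P r R Q → (a :+ x :* P) :+ r :* (R :+ x :* Q) := (a :+ r :* R) :+ x :* (P :+ r :* Q)) refl a x P r R Q ⟩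
      (a + r * R) + x * (P + r * Q) ≈⟨ +-congˡ (*-congˡ (monic-quotient r as x)) ⟩
      (a + r * R) + x * (R + x * Q) ∎
      where
      P : Carrier
      P = monic as x
      R : Carrier
      R = monic as r
      Q : Carrier
      Q = monic (quotient r as) x

    monic-replicate : ∀ n x → monic (replicate n 0#) x ≈ x ^ n
    monic-replicate zero      x = refl
    monic-replicate (ℕ.suc n) x = trans (+-identityˡ _) (*-congˡ (monic-replicate n x))

    product-of-differences≈0 : ∀ x rs → Any (x ≈_) rs → product-of-differences x rs ≈ 0#
    product-of-differences≈0 x (r ∷ rs) (here e) = begin
      (x - r) * product-of-differences x rs ≈⟨ *-congʳ (≈⇒-≈0 e) ⟩
      0# * product-of-differences x rs      ≈⟨ zeroˡ _ ⟩
      0#                                    ∎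
    product-of-differences≈0 x (r ∷ rs) (there p) = begin
      (x - r) * product-of-differences x rs ≈⟨ *-congˡ (product-of-differences≈0 x rs p) ⟩
      (x - r) * 0#                          ≈⟨ zeroʳ _ ⟩
      0#                                    ∎

module FieldTheory (𝓚 : HeytingField c ℓ₁ ℓ₂) where

  open HeytingField 𝓚 public
    using (heytingCommutativeRing; _#_; #-sym; #-irrefl; #-cotrans; tight; #⇒invertible; invertible⇒#)
  open HeytingCommutativeRing heytingCommutativeRing public using (commutativeRing)
  open Ring commutativeRing public
  open SetoidReasoning setoid

  recip : ∀ x → x # 0# → Carrier
  recip x x#0 = proj₁ (#⇒invertible x#0)

  CharacteristicZero : Set ℓ₂
  CharacteristicZero = ∀ n → ℕ.suc n · 1# # 0#

  AlgebraicallyClosed : Set (c ⊔ ℓ₁)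
  AlgebraicallyClosed = ∀ {n} (as : Vec Carrier (ℕ.suc n)) → ∃[ x ] monic as x ≈ 0#

  abstract

    x-0≈x : ∀ x → x - 0# ≈ x
    x-0≈x x = trans (+-congˡ -0#≈0#) (+-identityʳ x)

    recip-inverseʳ : ∀ {x} (x#0 : x # 0#) → x * recip x x#0 ≈ 1#
    recip-inverseʳ {x} x#0 =
      trans (*-congʳ (sym (x-0≈x x))) (proj₂ (proj₂ (#⇒invertible x#0)))

    recip-inverseˡ : ∀ {x} (x#0 : x # 0#) → recip x x#0 * x ≈ 1#
    recip-inverseˡ x#0 = trans (*-comm _ _) (recip-inverseʳ x#0)

    inverse⇒#0 : ∀ {x y} → y * x ≈ 1# → x # 0#
    inverse⇒#0 {x} {y} e = invertible⇒# (y , f , trans (*-comm (x - 0#) y) f)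
      where
      f : y * (x - 0#) ≈ 1#
      f = trans (*-congˡ (x-0≈x x)) e

    1#0 : 1# # 0#
    1#0 = inverse⇒#0 (*-identityˡ 1#)

    #⇒-#0 : ∀ {x y} → x # y → x - y # 0#
    #⇒-#0 x#y = inverse⇒#0 (proj₁ (proj₂ (#⇒invertible x#y)))

    -#0⇒# : ∀ {x y} → x - y # 0# → x # y
    -#0⇒# p = invertible⇒# (recip _ p , recip-inverseˡ p , recip-inverseʳ p)

    #0-resp : ∀ {x y} → x ≈ y → x # 0# → y # 0#
    #0-resp {x} {y} e p = inverse⇒#0 (trans (*-congˡ (sym e)) (recip-inverseˡ p))

    #-congʳ : ∀ {x y z} → x ≈ y → x # z → y # z
    #-congʳ e p = -#0⇒# (#0-resp (+-congʳ e) (#⇒-#0 p))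

    #-congˡ : ∀ {x y z} → y ≈ z → x # y → x # z
    #-congˡ e p = #-sym (#-congʳ e (#-sym p))

    x#0y#0→xy#0 : ∀ {x y} → x # 0# → y # 0# → x * y # 0#
    x#0y#0→xy#0 {x} {y} p q = inverse⇒#0 {y = recip y q * recip x p} (begin
      recip y q * recip x p * (x * y)   ≈⟨ *-assoc _ _ _ ⟩
      recip y q * (recip x p * (x * y)) ≈⟨ *-congˡ (*-assoc _ _ _) ⟨
      recip y q * (recip x p * x * y)   ≈⟨ *-congˡ (*-congʳ (recip-inverseˡ p)) ⟩
      recip y q * (1# * y)              ≈⟨ *-congˡ (*-identityˡ y) ⟩
      recip y q * y                     ≈⟨ recip-inverseˡ q ⟩
      1#                                ∎)

    *#0⇒#0ˡ : ∀ {x y} → x * y # 0# → x # 0#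
    *#0⇒#0ˡ {x} {y} p = inverse⇒#0 {y = recip _ p * y} (begin
      recip _ p * y * x   ≈⟨ *-assoc _ _ _ ⟩
      recip _ p * (y * x) ≈⟨ *-congˡ (*-comm y x) ⟩
      recip _ p * (x * y) ≈⟨ recip-inverseˡ p ⟩
      1#                  ∎)

    #⇒≉ : ∀ {x y} → x # y → ¬ (x ≈ y)
    #⇒≉ {x} {y} x#y x≈y = proj₂ (tight x y) x≈y x#y

    *-cancelˡ-#0 : ∀ {x y z} → x # 0# → x * y ≈ x * z → y ≈ z
    *-cancelˡ-#0 {x} {y} {z} x#0 e = begin
      y                 ≈⟨ lemma y ⟨
      recip x x#0 * (x * y) ≈⟨ *-congˡ e ⟩
      recip x x#0 * (x * z) ≈⟨ lemma z ⟩
      z                 ∎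
      where
      lemma : ∀ w → recip x x#0 * (x * w) ≈ w
      lemma w = trans (sym (*-assoc _ _ _)) (trans (*-congʳ (recip-inverseˡ x#0)) (*-identityˡ w))

    *≈0⇒≈0 : ∀ {x y} → x # 0# → x * y ≈ 0# → y ≈ 0#
    *≈0⇒≈0 {x} x#0 e = *-cancelˡ-#0 x#0 (trans e (sym (zeroʳ x)))

    ^#0 : ∀ {x} n → x # 0# → x ^ n # 0#
    ^#0 zero    x#0 = 1#0
    ^#0 (ℕ.suc n) x#0 = x#0y#0→xy#0 x#0 (^#0 n x#0)

    ^-periodic : ∀ {x} i j → i ℕ.< j → x # 0# → x ^ i ≈ x ^ j → x ^ (j ℕ.∸ i) ≈ 1#
    ^-periodic {x} zero    j         _   _   e = sym e
    ^-periodic {x} (ℕ.suc i) (ℕ.suc j) i<j x#0 e = ^-periodic i j (ℕ.s≤s⁻¹ i<j) x#0 (*-cancelˡ-#0 x#0 e)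

  module ValueDecidability (char0 : CharacteristicZero) (N : ℕ) .{{_ : ℕ.NonZero N}} where

    Value : Carrier → Set ℓ₁
    Value x = x ≈ 0# ⊎ x ^ N ≈ 1#

    abstract

      ·1#0 : ∀ m .{{_ : ℕ.NonZero m}} → m · 1# # 0#
      ·1#0 (ℕ.suc m) = char0 m

      -- A solution x of xᴺ = 1 is equal to or apart from 1, since
      -- S = 1 + x + … + xᴺ⁻¹ satisfies (x - 1) S = 0 and S ≡ N mod (x - 1).
      root≈1⊎#1 : ∀ {x} → x ^ N ≈ 1# → x ≈ 1# ⊎ x # 1#
      root≈1⊎#1 {x} e with (h , eh) ← geometric-n x N
        with #-cotrans (·1#0 N) (geometric x N)
      ... | inj₁ N#S = inj₂ (-#0⇒# (*#0⇒#0ˡ (#0-resp (+≈+⇒-≈-* eh) (#⇒-#0 (#-sym N#S)))))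
      ... | inj₂ S#0 = inj₁ (-≈0⇒≈ (*≈0⇒≈0 S#0 (trans (*-comm _ _) ([x-1]*geometric x N e))))

      root-inverse : ∀ {x} → x ^ N ≈ 1# → x ^ ℕ.pred N * x ≈ 1#
      root-inverse {x} e = trans (*-comm _ _) (go N e)
        where
        go : ∀ m .{{_ : ℕ.NonZero m}} → x ^ m ≈ 1# → x * x ^ ℕ.pred m ≈ 1#
        go (ℕ.suc m) e = e

      root#0 : ∀ {x} → x ^ N ≈ 1# → x # 0#
      root#0 e = inverse⇒#0 (root-inverse e)

      root-* : ∀ {x y} → x ^ N ≈ 1# → y ^ N ≈ 1# → (x * y) ^ N ≈ 1#
      root-* {x} {y} e f = trans (^-distrib-* x y N) (trans (*-cong e f) (*-identityˡ 1#))

      root-^ : ∀ {x} m → x ^ N ≈ 1# → (x ^ m) ^ N ≈ 1#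
      root-^ {x} zero      e = 1^n≈1 N
      root-^ {x} (ℕ.suc m) e = root-* e (root-^ m e)

      value-0 : Value 0#
      value-0 = inj₁ refl

      value-1 : Value 1#
      value-1 = inj₂ (1^n≈1 N)

      value-resp : ∀ {x y} → x ≈ y → Value x → Value y
      value-resp x≈y (inj₁ e) = inj₁ (trans (sym x≈y) e)
      value-resp x≈y (inj₂ e) = inj₂ (trans (^-congˡ N (sym x≈y)) e)

      value-* : ∀ {x y} → Value x → Value y → Value (x * y)
      value-* {x} {y} (inj₁ e) _        = inj₁ (trans (*-congʳ e) (zeroˡ y))
      value-* {x} {y} (inj₂ e) (inj₁ f) = inj₁ (trans (*-congˡ f) (zeroʳ x))
      value-* {x} {y} (inj₂ e) (inj₂ f) = inj₂ (root-* e f)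

      value-≈⊎# : ∀ {x y} → Value x → Value y → x ≈ y ⊎ x # y
      value-≈⊎# (inj₁ e) (inj₁ f) = inj₁ (trans e (sym f))
      value-≈⊎# (inj₁ e) (inj₂ f) = inj₂ (#-congʳ (sym e) (#-sym (root#0 f)))
      value-≈⊎# (inj₂ e) (inj₁ f) = inj₂ (#-congˡ (sym f) (root#0 e))
      value-≈⊎# {x} {y} (inj₂ e) (inj₂ f)
        with root≈1⊎#1 (root-* e (root-^ (ℕ.pred N) f))
      ... | inj₁ xy⁻¹≈1 = inj₁ (begin
            x                         ≈⟨ *-identityʳ x ⟨
            x * 1#                    ≈⟨ *-congˡ (root-inverse f) ⟨
            x * (y ^ ℕ.pred N * y)    ≈⟨ *-assoc _ _ _ ⟨
            (x * y ^ ℕ.pred N) * y    ≈⟨ *-congʳ xy⁻¹≈1 ⟩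
            1# * y                    ≈⟨ *-identityˡ y ⟩
            y                         ∎)
      ... | inj₂ xy⁻¹#1 = inj₂ (-#0⇒# (*#0⇒#0ˡ {y = y ^ ℕ.pred N} (#-congʳ (begin
            x * y ^ ℕ.pred N - 1#                   ≈⟨ +-congˡ (-‿cong (trans (*-comm _ _) (root-inverse f))) ⟨
            x * y ^ ℕ.pred N - y * y ^ ℕ.pred N     ≈⟨ [y-z]x≈yx-zx _ _ _ ⟨
            (x - y) * y ^ ℕ.pred N                  ∎) (#⇒-#0 xy⁻¹#1))))

      value-≈? : ∀ {x y} → Value x → Value y → Dec (x ≈ y)
      value-≈? vx vy with value-≈⊎# vx vy
      ... | inj₁ e = yes e
      ... | inj₂ d = no (#⇒≉ d)

  module Roots (closed : AlgebraicallyClosed) where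

    abstract

      factorisation : ∀ {n} (as : Vec Carrier n) →
                      ∃[ rs ] (∀ x → monic as x ≈ product-of-differences x rs)
      factorisation [] = [] , λ x → refl
      factorisation as@(_ ∷ _) =
        let (r , er)  = closed as
            (rs , es) = factorisation (quotient r as)
        in r ∷ rs , λ x → begin
          monic as x                          ≈⟨ +-identityʳ _ ⟨
          monic as x + 0#                     ≈⟨ +-congˡ (trans (-‿cong er) -0#≈0#) ⟨
          monic as x - monic as r             ≈⟨ +≈+⇒-≈-* (monic-quotient r as x) ⟩
          (x - r) * monic (quotient r as) x   ≈⟨ *-congˡ (es x) ⟩
          (x - r) * product-of-differences x rs ∎

      roots-factorisation : ∀ n .{{_ : ℕ.NonZero n}} →
                            ∃[ rs ] (∀ x → x ^ n - 1# ≈ product-of-differences x rs)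
      roots-factorisation (ℕ.suc n) =
        let (rs , es) = factorisation (- 1# ∷ replicate n 0#)
        in rs , λ x → trans (+-comm _ _) (trans (+-congˡ (*-congˡ (sym (monic-replicate n x)))) (es x))

OddPrimePower : ℕ → Set
OddPrimePower q = ∃[ p ] ∃[ r ] (Prime p × 1 ℕ.≤ r × q ≡ p ℕ.^ r × 2 ∤ q)

record FiniteField c ℓ₁ ℓ₂ : Set (suc (c ⊔ ℓ₁ ⊔ ℓ₂)) where
  field
    heytingField : HeytingField c ℓ₁ ℓ₂
    q            : ℕ
    enumeration  : Inverse (≡.setoid (Fin q)) (CommutativeRing.setoid (FieldTheory.commutativeRing heytingField))

module FiniteFieldTheory (𝔽 : FiniteField c ℓ₁ ℓ₂) where

  open FiniteField 𝔽 public using (heytingField; q; enumeration)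
  open FieldTheory heytingField public
  open Inverse enumeration public using () renaming
    ( to to element; from to index; from-cong to index-cong
    ; strictlyInverseˡ to element-index; strictlyInverseʳ to index-element )

  infix 4 _≈?_
  _≈?_ : ∀ x y → Dec (x ≈ y)
  x ≈? y = map′
    (λ e → trans (sym (element-index x)) (trans (reflexive (≡.cong element e)) (element-index y)))
    index-cong (index x Fin.≟ index y)

  #0? : ∀ x → Dec (x # 0#)
  #0? x = map′
    (λ (i , e) → inverse⇒#0 e)
    (λ x#0 → index (recip x x#0) , trans (*-congʳ (element-index _)) (recip-inverseˡ x#0))
    (Fin.any? λ i → element i * x ≈? 1#)

  invert : ∀ {x} → Dec (x # 0#) → Carrier
  invert (yes x#0) = recip _ x#0
  invert (no  _)   = 0#

  -- The inverse function, with value 0 at 0.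
  inv : Carrier → Carrier
  inv x = invert (#0? x)

  abstract

    ≈0⊎#0 : ∀ x → x ≈ 0# ⊎ x # 0#
    ≈0⊎#0 x with #0? x
    ... | yes x#0 = inj₂ x#0
    ... | no ¬x#0 = inj₁ (proj₁ (tight x 0#) ¬x#0)

    inv-≈0 : ∀ {x} → x ≈ 0# → inv x ≈ 0#
    inv-≈0 {x} e with #0? x
    ... | yes x#0 = contradiction e (#⇒≉ x#0)
    ... | no  _   = refl

    inv-inverseʳ : ∀ {x} → x # 0# → x * inv x ≈ 1#
    inv-inverseʳ {x} x#0 with #0? x
    ... | yes p = recip-inverseʳ p
    ... | no ¬p = contradiction x#0 ¬p

    inv-unique : ∀ {x y} → x # 0# → x * y ≈ 1# → y ≈ inv x
    inv-unique x#0 e = *-cancelˡ-#0 x#0 (trans e (sym (inv-inverseʳ x#0)))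

    inv-cong : ∀ {x y} → x ≈ y → inv x ≈ inv y
    inv-cong {x} {y} e with ≈0⊎#0 x
    ... | inj₁ x≈0 = trans (inv-≈0 x≈0) (sym (inv-≈0 (trans (sym e) x≈0)))
    ... | inj₂ x#0 = inv-unique (#0-resp e x#0) (trans (*-congʳ (sym e)) (inv-inverseʳ x#0))

    inv-1 : inv 1# ≈ 1#
    inv-1 = sym (inv-unique 1#0 (*-identityˡ 1#))

    inv-* : ∀ x y → inv (x * y) ≈ inv x * inv y
    inv-* x y with ≈0⊎#0 x | ≈0⊎#0 y
    ... | inj₁ x≈0 | _        = trans (inv-≈0 (trans (*-congʳ x≈0) (zeroˡ y))) (sym (trans (*-congʳ (inv-≈0 x≈0)) (zeroˡ _)))
    ... | inj₂ _   | inj₁ y≈0 = trans (inv-≈0 (trans (*-congˡ y≈0) (zeroʳ x))) (sym (trans (*-congˡ (inv-≈0 y≈0)) (zeroʳ _)))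
    ... | inj₂ x#0 | inj₂ y#0 = sym (inv-unique (x#0y#0→xy#0 x#0 y#0) (begin
      (x * y) * (inv x * inv y)  ≈⟨ [ab][cd]≈[ac][bd] x y (inv x) (inv y) ⟩
      (x * inv x) * (y * inv y)  ≈⟨ *-cong (inv-inverseʳ x#0) (inv-inverseʳ y#0) ⟩
      1# * 1#                    ≈⟨ *-identityˡ 1# ⟩
      1#                         ∎))
      where open SetoidReasoning setoid

    inv-#0 : ∀ {x} → x # 0# → inv x # 0#
    inv-#0 {x} x#0 = inverse⇒#0 {y = x} (inv-inverseʳ x#0)

    q≢0 : ℕ.NonZero q
    q≢0 = go q (index 0#)
      where
      go : ∀ n → Fin n → ℕ.NonZero n
      go (ℕ.suc n) _ = _

    1<q : 1 ℕ.< q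
    1<q = ℕ.≰⇒> λ q≤1 → #⇒≉ 1#0 (trans (sym (element-index 1#)) (trans (reflexive (≡.cong element (all-equal q q≤1 _ _))) (element-index 0#)))
      where
      all-equal : ∀ n → n ℕ.≤ 1 → (i j : Fin n) → i ≡ j
      all-equal 1 _ Fin.zero Fin.zero = ≡.refl
      all-equal (ℕ.suc (ℕ.suc _)) (ℕ.s≤s ())

-- The field of values of the characters. ℂ enters the theory of Gauss and
-- hypergeometric sums only as an algebraically closed field of characteristic 0;
-- as equality in it is not assumed decidable, the Cauchy complex numbers qualify.
record AlgebraicallyClosedField₀ c ℓ₁ ℓ₂ : Set (suc (c ⊔ ℓ₁ ⊔ ℓ₂)) where
  field
    heytingField        : HeytingField c ℓ₁ ℓ₂
    characteristicZero  : FieldTheory.CharacteristicZero heytingField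
    algebraicallyClosed : FieldTheory.AlgebraicallyClosed heytingField

module Characters (𝔽 : FiniteField c ℓ₁ ℓ₂) (ℂ : AlgebraicallyClosedField₀ k κ₁ κ₂) where

  module F = FiniteFieldTheory 𝔽
  open AlgebraicallyClosedField₀ ℂ
  module K = FieldTheory heytingField
  open K
  open K public using (_≈_; _+_; _*_)
  open F using (q; element; index)
  open SetoidReasoning setoid

  -- A homomorphism 𝔽* → ℂ* together with its extension by χ(0) = 0 is the same as a
  -- monoid homomorphism 𝔽 → ℂ vanishing at 0.
  record MulChar : Set (c ⊔ ℓ₁ ⊔ k ⊔ κ₁) where
    field
      ⟦_⟧                  : F.Carrier → Carrier
      isMonoidHomomorphism : IsMonoidHomomorphism F.*-rawMonoid *-rawMonoid ⟦_⟧
      0-homo               : ⟦ F.0# ⟧ ≈ 0#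
    open IsMonoidHomomorphism isMonoidHomomorphism public
      using (⟦⟧-cong) renaming (homo to *-homo; ε-homo to 1-homo)

  open MulChar public using (⟦_⟧)

  record NontrivialAddChar : Set (c ⊔ ℓ₁ ⊔ k ⊔ κ₁) where
    field
      ⟨_⟩                  : F.Carrier → Carrier
      isMonoidHomomorphism : IsMonoidHomomorphism F.+-rawMonoid *-rawMonoid ⟨_⟩
      nontrivial           : ¬ (∀ x → ⟨ x ⟩ ≈ 1#)
    open IsMonoidHomomorphism isMonoidHomomorphism public
      using (⟦⟧-cong) renaming (homo to +-homo; ε-homo to 0-homo)

  open NontrivialAddChar public using (⟨_⟩)

  infix 4 _≈ᶜ_
  _≈ᶜ_ : Rel MulChar (c ⊔ κ₁)
  χ ≈ᶜ ψ = ∀ x → ⟦ χ ⟧ x ≈ ⟦ ψ ⟧ x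

  infixl 7 _∙_
  _∙_ : MulChar → MulChar → MulChar
  χ ∙ ψ = record
    { ⟦_⟧ = λ x → ⟦ χ ⟧ x * ⟦ ψ ⟧ x
    ; isMonoidHomomorphism = record
      { isMagmaHomomorphism = record
        { isRelHomomorphism = record { cong = λ e → *-cong (χ.⟦⟧-cong e) (ψ.⟦⟧-cong e) }
        ; homo = λ x y → trans (*-cong (χ.*-homo x y) (ψ.*-homo x y)) ([ab][cd]≈[ac][bd] _ _ _ _)
        }
      ; ε-homo = trans (*-cong χ.1-homo ψ.1-homo) (*-identityˡ 1#)
      }
    ; 0-homo = trans (*-congʳ χ.0-homo) (zeroˡ _)
    }
    where
    module χ = MulChar χ
    module ψ = MulChar ψ

  indicator : ∀ {x} → Dec (x F.# F.0#) → Carrier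
  indicator (yes _) = 1#
  indicator (no  _) = 0#

  ε⟦_⟧ : F.Carrier → Carrier
  ε⟦ x ⟧ = indicator (F.#0? x)

  abstract

    ε-#0 : ∀ {x} → x F.# F.0# → ε⟦ x ⟧ ≈ 1#
    ε-#0 {x} x#0 with F.#0? x
    ... | yes _ = refl
    ... | no ¬p = contradiction x#0 ¬p

    ε-≈0 : ∀ {x} → x F.≈ F.0# → ε⟦ x ⟧ ≈ 0#
    ε-≈0 {x} e with F.#0? x
    ... | yes p = contradiction e (F.#⇒≉ p)
    ... | no  _ = refl

    ε-cong : ∀ {x y} → x F.≈ y → ε⟦ x ⟧ ≈ ε⟦ y ⟧
    ε-cong {x} {y} e with F.≈0⊎#0 x
    ... | inj₁ x≈0 = trans (ε-≈0 x≈0) (sym (ε-≈0 (F.trans (F.sym e) x≈0)))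
    ... | inj₂ x#0 = trans (ε-#0 x#0) (sym (ε-#0 (F.#0-resp e x#0)))

    ε-* : ∀ x y → ε⟦ x F.* y ⟧ ≈ ε⟦ x ⟧ * ε⟦ y ⟧
    ε-* x y with F.≈0⊎#0 x | F.≈0⊎#0 y
    ... | inj₁ x≈0 | _        = trans (ε-≈0 (F.trans (F.*-congʳ x≈0) (F.zeroˡ y))) (sym (trans (*-congʳ (ε-≈0 x≈0)) (zeroˡ _)))
    ... | inj₂ _   | inj₁ y≈0 = trans (ε-≈0 (F.trans (F.*-congˡ y≈0) (F.zeroʳ x))) (sym (trans (*-congˡ (ε-≈0 y≈0)) (zeroʳ _)))
    ... | inj₂ x#0 | inj₂ y#0 = trans (ε-#0 (F.x#0y#0→xy#0 x#0 y#0)) (sym (trans (*-cong (ε-#0 x#0) (ε-#0 y#0)) (*-identityˡ 1#)))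

  ε : MulChar
  ε = record
    { ⟦_⟧ = ε⟦_⟧
    ; isMonoidHomomorphism = record
      { isMagmaHomomorphism = record { isRelHomomorphism = record { cong = ε-cong } ; homo = ε-* }
      ; ε-homo = ε-#0 F.1#0
      }
    ; 0-homo = ε-≈0 F.refl
    }

  infix 9 _⁻¹
  _⁻¹ : MulChar → MulChar
  χ ⁻¹ = record
    { ⟦_⟧ = λ x → ⟦ χ ⟧ (F.inv x)
    ; isMonoidHomomorphism = record
      { isMagmaHomomorphism = record
        { isRelHomomorphism = record { cong = λ e → χ.⟦⟧-cong (F.inv-cong e) }
        ; homo = λ x y → trans (χ.⟦⟧-cong (F.inv-* x y)) (χ.*-homo _ _)
        }
      ; ε-homo = trans (χ.⟦⟧-cong F.inv-1) χ.1-homo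
      }
    ; 0-homo = trans (χ.⟦⟧-cong (F.inv-≈0 F.refl)) χ.0-homo
    }
    where module χ = MulChar χ

  abstract

    character-≈0 : ∀ χ {x} → x F.≈ F.0# → ⟦ χ ⟧ x ≈ 0#
    character-≈0 χ e = trans (MulChar.⟦⟧-cong χ e) (MulChar.0-homo χ)

    character-inv : ∀ χ {x} → x F.# F.0# → ⟦ χ ⟧ x * ⟦ χ ⟧ (F.inv x) ≈ 1#
    character-inv χ {x} x#0 = trans (sym (χ.*-homo _ _)) (trans (χ.⟦⟧-cong (F.inv-inverseʳ x#0)) χ.1-homo)
      where module χ = MulChar χ

    character-#0 : ∀ χ {x} → x F.# F.0# → ⟦ χ ⟧ x # 0#
    character-#0 χ x#0 = inverse⇒#0 (trans (*-comm _ _) (character-inv χ x#0))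

    ∙-inverseʳ : ∀ χ → χ ∙ χ ⁻¹ ≈ᶜ ε
    ∙-inverseʳ χ x with F.≈0⊎#0 x
    ... | inj₁ x≈0 = trans (trans (*-congʳ (character-≈0 χ x≈0)) (zeroˡ _)) (sym (ε-≈0 x≈0))
    ... | inj₂ x#0 = trans (character-inv χ x#0) (sym (ε-#0 x#0))

    ∙-identityˡ : ∀ χ → ε ∙ χ ≈ᶜ χ
    ∙-identityˡ χ x with F.≈0⊎#0 x
    ... | inj₁ x≈0 = trans (trans (*-congˡ (character-≈0 χ x≈0)) (zeroʳ _)) (sym (character-≈0 χ x≈0))
    ... | inj₂ x#0 = trans (*-congʳ (ε-#0 x#0)) (*-identityˡ _)

  characterGroup : AbelianGroup (c ⊔ ℓ₁ ⊔ k ⊔ κ₁) (c ⊔ κ₁)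
  characterGroup = record
    { Carrier = MulChar
    ; _≈_ = _≈ᶜ_
    ; _∙_ = _∙_
    ; ε = ε
    ; _⁻¹ = _⁻¹
    ; isAbelianGroup = record
      { isGroup = record
        { isMonoid = record
          { isSemigroup = record
            { isMagma = record
              { isEquivalence = record
                { refl = λ x → refl
                ; sym = λ e x → sym (e x)
                ; trans = λ e f x → trans (e x) (f x)
                }
              ; ∙-cong = λ e f x → *-cong (e x) (f x)
              }
            ; assoc = λ χ ψ ω x → *-assoc _ _ _
            }
          ; identity = ∙-identityˡ , λ χ x → trans (*-comm _ _) (∙-identityˡ χ x)
          }
        ; inverse = (λ χ x → trans (*-comm _ _) (∙-inverseʳ χ x)) , ∙-inverseʳ
        ; ⁻¹-cong = λ e x → e (F.inv x)
        }
      ; comm = λ χ ψ x → *-comm _ _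
      }
    }

  infixr 8 _^ᶜ_
  _^ᶜ_ : MulChar → ℕ → MulChar
  χ ^ᶜ n = AbelianGroupMult._×_ n χ
    where module AbelianGroupMult = RawMonoidDefinitions (AbelianGroup.rawMonoid characterGroup)

  open ValueDecidability characteristicZero (q !) {{ℕ._!≢0 q}}
  open Roots algebraicallyClosed

  abstract

    recurrence : (s : ℕ → F.Carrier) → ∃[ i ] ∃[ j ] (i ℕ.< j × j ℕ.≤ q × s i F.≈ s j)
    recurrence s with i , j , i<j , e ← Fin.pigeonhole (ℕ.n<1+n q) (λ i → index (s (Fin.toℕ i))) =
      Fin.toℕ i , Fin.toℕ j , i<j , ℕ.s≤s⁻¹ (Fin.toℕ<n j) ,
      F.trans (F.sym (F.element-index _)) (F.trans (F.reflexive (≡.cong element e)) (F.element-index _))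

    root-of-recurrence : ∀ {u} (h : F.Carrier → Carrier) (s : ℕ → F.Carrier) →
                         (∀ {x y} → x F.≈ y → h x ≈ h y) → (∀ i → h (s i) ≈ u ^ i) →
                         u # 0# → u ^ (q !) ≈ 1#
    root-of-recurrence {u} h s h-cong hs u#0
      with i , j , i<j , j≤q , e ← recurrence s
      with j ℕ.∸ i in eq
         | ^-periodic {u} i j i<j u#0 (trans (sym (hs i)) (trans (h-cong e) (hs j)))
         | ℕ.≤-trans (ℕ.m∸n≤m j i) j≤q
    ... | zero    | _ | _   = contradiction (ℕ.m∸n≡0⇒m≤n eq) (ℕ.<⇒≱ i<j)
    ... | ℕ.suc d | p | d<q = lemma (∣-trans (divides (d !) (ℕ.*-comm (ℕ.suc d) (d !))) (m≤n⇒m!∣n! d<q))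
      where
      lemma : ℕ.suc d ∣ q ! → u ^ (q !) ≈ 1#
      lemma (divides m q!≡) = begin
        u ^ (q !)              ≈⟨ ^-congʳ u (≡.trans q!≡ (ℕ.*-comm m (ℕ.suc d))) ⟩
        u ^ (ℕ.suc d ℕ.* m)    ≈⟨ ^-assocʳ u (ℕ.suc d) m ⟨
        (u ^ ℕ.suc d) ^ m      ≈⟨ ^-congˡ m p ⟩
        1# ^ m                 ≈⟨ 1^n≈1 m ⟩
        1#                     ∎

    character-value : ∀ χ x → Value (⟦ χ ⟧ x)
    character-value χ x with F.≈0⊎#0 x
    ... | inj₁ x≈0 = inj₁ (character-≈0 χ x≈0)
    ... | inj₂ x#0 = inj₂ (root-of-recurrence ⟦ χ ⟧ (x F.^_) χ.⟦⟧-cong power (character-#0 χ x#0))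
      where
      module χ = MulChar χ
      power : ∀ i → ⟦ χ ⟧ (x F.^ i) ≈ ⟦ χ ⟧ x ^ i
      power zero      = χ.1-homo
      power (ℕ.suc i) = trans (χ.*-homo _ _) (*-congˡ (power i))

    infix 4 _≟_
    _≟_ : ∀ χ ψ → Dec (χ ≈ᶜ ψ)
    χ ≟ ψ = map′
      (λ h x → trans (MulChar.⟦⟧-cong χ (F.sym (F.element-index x))) (trans (h (index x)) (MulChar.⟦⟧-cong ψ (F.element-index x))))
      (λ e i → e (element i))
      (Fin.all? λ i → value-≈? (character-value χ (element i)) (character-value ψ (element i)))

  characterDecSetoid : DecSetoid (c ⊔ ℓ₁ ⊔ k ⊔ κ₁) (c ⊔ κ₁)
  characterDecSetoid = record
    { isDecEquivalence = record
      { isEquivalence = AbelianGroup.isEquivalence characterGroup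
      ; _≟_ = _≟_
      }
    }

  characterSetoid : Setoid (c ⊔ ℓ₁ ⊔ k ⊔ κ₁) (c ⊔ κ₁)
  characterSetoid = DecSetoid.setoid characterDecSetoid
  open Membership characterSetoid using (_∈_)
  open Uniqueness characterSetoid using (Unique)

  abstract

    roots : ∃[ rs ] (All Value rs × (∀ x → Value x → Any (x ≈_) rs))
    roots with rs , factor ← roots-factorisation (q !) {{ℕ._!≢0 q}} =
      0# ∷ rs , value-0 ∷ all-values , complete
      where
      all-values : All Value rs
      all-values = All.tabulateₛ setoid λ {r} r∈rs →
        inj₂ (-≈0⇒≈ (trans (factor r) (product-of-differences≈0 r rs r∈rs)))

      search : ∀ {x} → Value x → ∀ {rs} → All Value rs → product-of-differences x rs ≈ 0# → Any (x ≈_) rs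
      search v [] e = contradiction e (#⇒≉ 1#0)
      search v (w ∷ ws) e with value-≈⊎# v w
      ... | inj₁ x≈r = here x≈r
      ... | inj₂ x#r = there (search v ws (*≈0⇒≈0 (#⇒-#0 x#r) e))

      complete : ∀ x → Value x → Any (x ≈_) (0# ∷ rs)
      complete x (inj₁ e) = here e
      complete x (inj₂ e) = there (search (inj₂ e) all-values (trans (sym (factor x)) (≈⇒-≈0 e)))

    values : List Carrier
    values = proj₁ roots

    value : (Fin q → Fin (List.length values)) → F.Carrier → Carrier
    value f x = List.lookup values (f (index x))

    value-Value : ∀ f x → Value (value f x)
    value-Value f x = All.lookup (proj₁ (proj₂ roots)) (∈-lookup (f (index x)))

    IsCharacter : (F.Carrier → Carrier) → Set κ₁
    IsCharacter h = (h F.1# ≈ 1# × h F.0# ≈ 0#) ×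
                    (∀ i j → h (element i F.* element j) ≈ h (element i) * h (element j))

    isCharacter? : ∀ f → Dec (IsCharacter (value f))
    isCharacter? f =
      (value-≈? (v F.1#) value-1 ×-dec value-≈? (v F.0#) value-0) ×-dec
      Fin.all? λ i → Fin.all? λ j → value-≈? (v _) (value-* (v _) (v _))
      where
      v : ∀ x → Value (value f x)
      v = value-Value f

    value-cong : ∀ f {x y} → x F.≈ y → value f x ≈ value f y
    value-cong f e = reflexive (≡.cong (λ i → List.lookup values (f i)) (F.index-cong e))

    toCharacter : ∀ f → IsCharacter (value f) → MulChar
    toCharacter f ((one , zero′) , mult) = record
      { ⟦_⟧ = value f
      ; isMonoidHomomorphism = record
        { isMagmaHomomorphism = record
          { isRelHomomorphism = record { cong = value-cong f }
          ; homo = λ x y → begin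
              value f (x F.* y)                                       ≈⟨ value-cong f (F.*-cong (F.element-index x) (F.element-index y)) ⟨
              value f (element (index x) F.* element (index y))       ≈⟨ mult (index x) (index y) ⟩
              value f (element (index x)) * value f (element (index y)) ≈⟨ *-cong (value-cong f (F.element-index x)) (value-cong f (F.element-index y)) ⟩
              value f x * value f y                                   ∎
          }
        ; ε-homo = one
        }
      ; 0-homo = zero′
      }

    toCharacter? : ∀ f → Dec (IsCharacter (value f)) → Maybe MulChar
    toCharacter? f (yes p) = just (toCharacter f p)
    toCharacter? f (no  _) = nothing

    candidate : Fin (List.length values ℕ.^ q) → Maybe MulChar
    candidate n = toCharacter? (Fin.finToFun n) (isCharacter? (Fin.finToFun n))

    candidates : List MulChar
    candidates = List.mapMaybe candidate (List.allFin _)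

    candidates-complete : ∀ χ → χ ∈ candidates
    candidates-complete χ = Any.mapMaybe⁺ candidate _ (Any.map⁺ (lose (∈-allFin n) found))
      where
      module χ = MulChar χ

      f : Fin q → Fin (List.length values)
      f i = Any.index (proj₂ (proj₂ roots) _ (character-value χ (element i)))

      n : Fin (List.length values ℕ.^ q)
      n = Fin.funToFin f

      agrees : ∀ x → ⟦ χ ⟧ x ≈ value (Fin.finToFun n) x
      agrees x = begin
        ⟦ χ ⟧ x                     ≈⟨ χ.⟦⟧-cong (F.element-index x) ⟨
        ⟦ χ ⟧ (element (index x))   ≈⟨ Any.lookup-index (proj₂ (proj₂ roots) _ (character-value χ (element (index x)))) ⟩
        List.lookup values (f (index x)) ≡⟨ ≡.cong (List.lookup values) (Fin.finToFun-funToFin f (index x)) ⟨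
        value (Fin.finToFun n) x    ∎

      isCharacter : IsCharacter (value (Fin.finToFun n))
      isCharacter =
        (trans (sym (agrees _)) χ.1-homo , trans (sym (agrees _)) χ.0-homo) ,
        λ i j → trans (sym (agrees _)) (trans (χ.*-homo _ _) (*-cong (agrees _) (agrees _)))

      found : Maybe.Any (χ ≈ᶜ_) (candidate n)
      found with isCharacter? (Fin.finToFun n)
      ... | yes p = Maybe.just agrees
      ... | no ¬p = contradiction isCharacter ¬p

    characters : Σ[ χs ∈ List MulChar ] (IsEnumeration characterSetoid χs × Unique χs)
    characters =
      List.deduplicate _≟_ candidates ,
      Enumerates.deduplicate⁺ characterDecSetoid candidates-complete ,
      deduplicate-! characterDecSetoid candidates

  -- Opaque, with ∑ᶠ-def as its equation, so that the summand f can be inferred.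
  opaque
    ∑ᶠ : (F.Carrier → Carrier) → Carrier
    ∑ᶠ f = sum (λ i → f (element i))

  Congruent : (F.Carrier → Carrier) → Set (c ⊔ ℓ₁ ⊔ κ₁)
  Congruent f = ∀ {x y} → x F.≈ y → f x ≈ f y

  record Bijection : Set (c ⊔ ℓ₁) where
    field
      σ τ    : F.Carrier → F.Carrier
      σ-cong : ∀ {x y} → x F.≈ y → σ x F.≈ σ y
      τ-cong : ∀ {x y} → x F.≈ y → τ x F.≈ τ y
      σ∘τ    : ∀ x → σ (τ x) F.≈ x
      τ∘σ    : ∀ x → τ (σ x) F.≈ x

  opaque
    unfolding ∑ᶠ

    ∑ᶠ-def : ∀ f → ∑ᶠ f ≡ sum (λ i → f (element i))
    ∑ᶠ-def f = ≡.refl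

    ∑ᶠ-cong : ∀ {f g} → (∀ x → f x ≈ g x) → ∑ᶠ f ≈ ∑ᶠ g
    ∑ᶠ-cong e = sum-cong-≋ (λ i → e (element i))

    ∑ᶠ-*ˡ : ∀ a f → a * ∑ᶠ f ≈ ∑ᶠ (λ x → a * f x)
    ∑ᶠ-*ˡ a f = *-distribˡ-sum a (λ i → f (element i))

    ∑ᶠ-*ʳ : ∀ a f → ∑ᶠ f * a ≈ ∑ᶠ (λ x → f x * a)
    ∑ᶠ-*ʳ a f = *-distribʳ-sum a (λ i → f (element i))

    ∑ᶠ-+ : ∀ f g → ∑ᶠ (λ x → f x + g x) ≈ ∑ᶠ f + ∑ᶠ g
    ∑ᶠ-+ f g = ∑-distrib-+ (λ i → f (element i)) (λ i → g (element i))

    ∑ᶠ-comm : ∀ (f : F.Carrier → F.Carrier → Carrier) →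
              ∑ᶠ (λ x → ∑ᶠ (λ y → f x y)) ≈ ∑ᶠ (λ y → ∑ᶠ (λ x → f x y))
    ∑ᶠ-comm f = ∑-comm (λ i j → f (element i) (element j))

    ∑ᶠ-zero : ∀ {f} → (∀ x → f x ≈ 0#) → ∑ᶠ f ≈ 0#
    ∑ᶠ-zero e = trans (∑ᶠ-cong e) (sum-replicate-zero q)

    ∑ᶠ-one : ∀ {f} → (∀ x → f x ≈ 1#) → ∑ᶠ f ≈ q · 1#
    ∑ᶠ-one e = trans (∑ᶠ-cong e) (sum-replicate q)

    ∑ᶠ-bijection : ∀ {f} → Congruent f → (β : Bijection) → ∑ᶠ f ≈ ∑ᶠ (λ x → f (Bijection.σ β x))
    ∑ᶠ-bijection {f} f-cong β =
      trans (sum-permute (λ i → f (element i)) π) (∑ᶠ-cong λ x → f-cong (F.element-index (σ x)))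
      where
      open Bijection β
      π : Fin.Permutation q q
      π = Fin.permutation (λ i → index (σ (element i))) (λ i → index (τ (element i)))
        (λ i → ≡.trans (F.index-cong (F.trans (σ-cong (F.element-index _)) (σ∘τ _))) (F.index-element i))
        (λ i → ≡.trans (F.index-cong (F.trans (τ-cong (F.element-index _)) (τ∘σ _))) (F.index-element i))

    sum-single : ∀ {n} (t : Fin n → Carrier) i → (∀ j → ¬ (j ≡ i) → t j ≈ 0#) → sum t ≈ t i
    sum-single {ℕ.suc n} t Fin.zero    e =
      trans (+-congˡ (trans (sum-cong-≋ (λ j → e (Fin.suc j) λ ())) (sum-replicate-zero n))) (+-identityʳ _)
    sum-single {ℕ.suc n} t (Fin.suc i) e =
      trans (+-cong (e Fin.zero λ ()) (sum-single (λ j → t (Fin.suc j)) i λ j j≢i → e (Fin.suc j) λ { ≡.refl → j≢i ≡.refl }))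
            (+-identityˡ _)

    ∑ᶠ-single : ∀ {f} → Congruent f → ∀ a → (∀ x → x F.# a → f x ≈ 0#) → ∑ᶠ f ≈ f a
    ∑ᶠ-single {f} f-cong a e = trans
      (sum-single (λ i → f (element i)) (index a) λ j j≢ → e (element j) (apart j j≢))
      (f-cong (F.element-index a))
      where
      apart : ∀ j → ¬ (j ≡ index a) → element j F.# a
      apart j j≢ with F.≈0⊎#0 (element j F.- a)
      ... | inj₁ e = contradiction (≡.trans (≡.sym (F.index-element j)) (F.index-cong (F.-≈0⇒≈ e))) j≢
      ... | inj₂ p = F.-#0⇒# p

  abstract

    ∑ᶠ-quasi-invariant : ∀ {f} → Congruent f → (β : Bijection) → ∀ {a} → a # 1# →
                         (∀ x → f (Bijection.σ β x) ≈ a * f x) → ∑ᶠ f ≈ 0#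
    ∑ᶠ-quasi-invariant {f} f-cong β {a} a#1 e = *≈0⇒≈0 (#⇒-#0 a#1) (begin
      (a - 1#) * ∑ᶠ f        ≈⟨ [y-z]x≈yx-zx _ _ _ ⟩
      a * ∑ᶠ f - 1# * ∑ᶠ f   ≈⟨ ≈⇒-≈0 (begin
        a * ∑ᶠ f                          ≈⟨ ∑ᶠ-*ˡ a f ⟩
        ∑ᶠ (λ x → a * f x)                ≈⟨ ∑ᶠ-cong e ⟨
        ∑ᶠ (λ x → f (Bijection.σ β x))    ≈⟨ ∑ᶠ-bijection f-cong β ⟨
        ∑ᶠ f                              ≈⟨ *-identityˡ _ ⟨
        1# * ∑ᶠ f                         ∎) ⟩
      0#                     ∎)

    ∑ᶠ-ε : ∀ {f} → Congruent f → ∑ᶠ (λ x → ε⟦ x ⟧ * f x) + f F.0# ≈ ∑ᶠ f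
    ∑ᶠ-ε {f} f-cong = begin
      ∑ᶠ (λ x → ε⟦ x ⟧ * f x) + f F.0#                                      ≈⟨ +-congˡ at-0 ⟨
      ∑ᶠ (λ x → ε⟦ x ⟧ * f x) + ∑ᶠ (λ x → f x - ε⟦ x ⟧ * f x)               ≈⟨ ∑ᶠ-+ _ _ ⟨
      ∑ᶠ (λ x → ε⟦ x ⟧ * f x + (f x - ε⟦ x ⟧ * f x))                        ≈⟨ ∑ᶠ-cong (λ x → cancel (ε⟦ x ⟧ * f x) (f x)) ⟩
      ∑ᶠ f                                                                  ∎
      where
      cancel : ∀ a b → a + (b - a) ≈ b
      cancel a b = trans (trans (+-congˡ (+-comm b (- a))) (sym (+-assoc a (- a) b))) (trans (+-congʳ (-‿inverseʳ a)) (+-identityˡ b))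
      at-0 : ∑ᶠ (λ x → f x - ε⟦ x ⟧ * f x) ≈ f F.0#
      at-0 = trans
        (∑ᶠ-single (λ e → +-cong (f-cong e) (-‿cong (*-cong (ε-cong e) (f-cong e)))) F.0#
          (λ x x#0 → ≈⇒-≈0 (sym (trans (*-congʳ (ε-#0 x#0)) (*-identityˡ _)))))
        (trans (+-congˡ (-‿cong (trans (*-congʳ (ε-≈0 F.refl)) (zeroˡ _)))) (x-0≈x _))

  scaling : ∀ {a} → a F.# F.0# → Bijection
  scaling {a} a#0 = record
    { σ = a F.*_
    ; τ = F.inv a F.*_
    ; σ-cong = F.*-congˡ
    ; τ-cong = F.*-congˡ
    ; σ∘τ = λ x → F.trans (F.sym (F.*-assoc _ _ _)) (F.trans (F.*-congʳ (F.inv-inverseʳ a#0)) (F.*-identityˡ x))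
    ; τ∘σ = λ x → F.trans (F.sym (F.*-assoc _ _ _)) (F.trans (F.*-congʳ (F.trans (F.*-comm _ _) (F.inv-inverseʳ a#0))) (F.*-identityˡ x))
    }

  translation : F.Carrier → Bijection
  translation a = record
    { σ = a F.+_
    ; τ = (F.- a) F.+_
    ; σ-cong = F.+-congˡ
    ; τ-cong = F.+-congˡ
    ; σ∘τ = λ x → F.trans (F.sym (F.+-assoc _ _ _)) (F.trans (F.+-congʳ (F.-‿inverseʳ a)) (F.+-identityˡ x))
    ; τ∘σ = λ x → F.trans (F.sym (F.+-assoc _ _ _)) (F.trans (F.+-congʳ (F.-‿inverseˡ a)) (F.+-identityˡ x))
    }

  gauss : NontrivialAddChar → MulChar → Carrier
  gauss θ χ = ∑ᶠ (λ x → ⟦ χ ⟧ x * ⟨ θ ⟩ x)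

  abstract

    gauss-cong : ∀ θ {χ ψ} → χ ≈ᶜ ψ → gauss θ χ ≈ gauss θ ψ
    gauss-cong θ e = ∑ᶠ-cong λ x → *-congʳ (e x)

    θ-inverse : ∀ θ x → ⟨ θ ⟩ (F.- x) * ⟨ θ ⟩ x ≈ 1#
    θ-inverse θ x = trans (sym (θ.+-homo _ _)) (trans (θ.⟦⟧-cong (F.-‿inverseˡ x)) θ.0-homo)
      where module θ = NontrivialAddChar θ

    θ-value : ∀ θ x → ⟨ θ ⟩ x ^ (q !) ≈ 1#
    θ-value θ x = root-of-recurrence ⟨ θ ⟩ (F._· x) θ.⟦⟧-cong multiple (inverse⇒#0 (θ-inverse θ x))
      where
      module θ = NontrivialAddChar θ
      multiple : ∀ i → ⟨ θ ⟩ (i F.· x) ≈ ⟨ θ ⟩ x ^ i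
      multiple zero      = θ.0-homo
      multiple (ℕ.suc i) = trans (θ.+-homo _ _) (*-congˡ (multiple i))

    root#1? : ∀ {u} → u ^ (q !) ≈ 1# → Dec (u # 1#)
    root#1? e with root≈1⊎#1 e
    ... | inj₁ u≈1 = no λ u#1 → #⇒≉ u#1 u≈1
    ... | inj₂ u#1 = yes u#1

    root-¬#1 : ∀ {u} → ¬ (u # 1#) → u ≈ 1#
    root-¬#1 = proj₁ (tight _ _)

    θ-witness : ∀ θ → ∃[ a ] ⟨ θ ⟩ a # 1#
    θ-witness θ with Fin.any? (λ i → root#1? (θ-value θ (element i)))
    ... | yes (i , p) = element i , p
    ... | no ¬p = contradiction
      (λ x → trans (θ.⟦⟧-cong (F.sym (F.element-index x))) (root-¬#1 (λ p → ¬p (index x , p))))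
      θ.nontrivial
      where module θ = NontrivialAddChar θ

    ∑θ≈0 : ∀ θ {y} → y F.# F.0# → ∑ᶠ (λ x → ⟨ θ ⟩ (y F.* x)) ≈ 0#
    ∑θ≈0 θ {y} y#0 with a , θa#1 ← θ-witness θ =
      ∑ᶠ-quasi-invariant (λ e → θ.⟦⟧-cong (F.*-congˡ e)) (translation (F.inv y F.* a)) θa#1 λ x → begin
        ⟨ θ ⟩ (y F.* (F.inv y F.* a F.+ x))                  ≈⟨ θ.⟦⟧-cong (F.distribˡ _ _ _) ⟩
        ⟨ θ ⟩ (y F.* (F.inv y F.* a) F.+ y F.* x)            ≈⟨ θ.+-homo _ _ ⟩
        ⟨ θ ⟩ (y F.* (F.inv y F.* a)) * ⟨ θ ⟩ (y F.* x)      ≈⟨ *-congʳ (θ.⟦⟧-cong (Bijection.σ∘τ (scaling y#0) a)) ⟩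
        ⟨ θ ⟩ a * ⟨ θ ⟩ (y F.* x)                            ∎
      where module θ = NontrivialAddChar θ

    ∑χ≈0 : ∀ χ {a} → a F.# F.0# → ⟦ χ ⟧ a # 1# → ∑ᶠ ⟦ χ ⟧ ≈ 0#
    ∑χ≈0 χ {a} a#0 χa#1 =
      ∑ᶠ-quasi-invariant (MulChar.⟦⟧-cong χ) (scaling a#0) χa#1 (MulChar.*-homo χ a)

    gauss-ε : ∀ θ → gauss θ ε + 1# ≈ 0#
    gauss-ε θ = begin
      gauss θ ε + 1#                  ≈⟨ +-congˡ θ.0-homo ⟨
      gauss θ ε + ⟨ θ ⟩ F.0#          ≈⟨ ∑ᶠ-ε θ.⟦⟧-cong ⟩
      ∑ᶠ ⟨ θ ⟩                        ≈⟨ ∑ᶠ-cong (λ x → θ.⟦⟧-cong (F.*-identityˡ x)) ⟨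
      ∑ᶠ (λ x → ⟨ θ ⟩ (F.1# F.* x))   ≈⟨ ∑θ≈0 θ F.1#0 ⟩
      0#                              ∎
      where module θ = NontrivialAddChar θ

    ∑εθ : ∀ θ s → ∑ᶠ (λ y → ε⟦ y ⟧ * ⟨ θ ⟩ (y F.* s)) ≈ ∑ᶠ (λ y → ⟨ θ ⟩ (y F.* s)) - 1#
    ∑εθ θ s = begin
      S                       ≈⟨ x-0≈x S ⟨
      S - 0#                  ≈⟨ +-congˡ (-‿cong (-‿inverseʳ 1#)) ⟨
      S - (1# - 1#)           ≈⟨ +-congˡ (sym (-‿+-comm 1# (- 1#))) ⟩
      S + (- 1# + - - 1#)     ≈⟨ +-congˡ (trans (+-comm _ _) (+-congʳ (-‿involutive 1#))) ⟩
      S + (1# - 1#)           ≈⟨ +-assoc _ _ _ ⟨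
      (S + 1#) - 1#           ≈⟨ +-congʳ (+-congˡ (trans (θ.⟦⟧-cong (F.zeroˡ s)) θ.0-homo)) ⟨
      (S + ⟨ θ ⟩ (F.0# F.* s)) - 1# ≈⟨ +-congʳ (∑ᶠ-ε (λ e → θ.⟦⟧-cong (F.*-congʳ e))) ⟩
      ∑ᶠ (λ y → ⟨ θ ⟩ (y F.* s)) - 1# ∎
      where
      module θ = NontrivialAddChar θ
      S : Carrier
      S = ∑ᶠ (λ y → ε⟦ y ⟧ * ⟨ θ ⟩ (y F.* s))

    gauss-product : ∀ θ χ {a} → a F.# F.0# → ⟦ χ ⟧ a # 1# →
                    gauss θ χ * gauss θ (χ ⁻¹) ≈ ⟦ χ ⟧ (F.- F.1#) * (q · 1#)
    gauss-product θ χ a#0 χa#1 = begin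
      gauss θ χ * gauss θ (χ ⁻¹)                                             ≈⟨ ∑ᶠ-*ˡ _ _ ⟩
      ∑ᶠ (λ y → gauss θ χ * (⟦ χ ⁻¹ ⟧ y * ⟨ θ ⟩ y))                          ≈⟨ ∑ᶠ-cong summand ⟩
      ∑ᶠ (λ y → ∑ᶠ (λ t → ⟦ χ ⟧ t * (ε⟦ y ⟧ * ⟨ θ ⟩ (y F.* (t F.+ F.1#)))))  ≈⟨ ∑ᶠ-comm _ ⟩
      ∑ᶠ (λ t → ∑ᶠ (λ y → ⟦ χ ⟧ t * (ε⟦ y ⟧ * ⟨ θ ⟩ (y F.* (t F.+ F.1#)))))  ≈⟨ ∑ᶠ-cong (λ t → trans (sym (∑ᶠ-*ˡ _ _)) (*-congˡ (∑εθ θ _))) ⟩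
      ∑ᶠ (λ t → ⟦ χ ⟧ t * (E (t F.+ F.1#) - 1#))                             ≈⟨ ∑ᶠ-cong (λ t → trans (distribˡ _ _ _) (+-congˡ (*-comm _ _))) ⟩
      ∑ᶠ (λ t → ⟦ χ ⟧ t * E (t F.+ F.1#) + - 1# * ⟦ χ ⟧ t)                   ≈⟨ ∑ᶠ-+ _ _ ⟩
      ∑ᶠ (λ t → ⟦ χ ⟧ t * E (t F.+ F.1#)) + ∑ᶠ (λ t → - 1# * ⟦ χ ⟧ t)        ≈⟨ +-congˡ (trans (sym (∑ᶠ-*ˡ _ _)) (trans (*-congˡ (∑χ≈0 χ a#0 χa#1)) (zeroʳ _))) ⟩
      ∑ᶠ (λ t → ⟦ χ ⟧ t * E (t F.+ F.1#)) + 0#                               ≈⟨ +-identityʳ _ ⟩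
      ∑ᶠ (λ t → ⟦ χ ⟧ t * E (t F.+ F.1#))                                    ≈⟨ ∑ᶠ-single (λ e → *-cong (χ.⟦⟧-cong e) (E-cong (F.+-congʳ e))) (F.- F.1#) off ⟩
      ⟦ χ ⟧ (F.- F.1#) * E (F.- F.1# F.+ F.1#)                               ≈⟨ *-congˡ (∑ᶠ-one λ y → trans (θ.⟦⟧-cong (F.trans (F.*-congˡ (F.-‿inverseˡ F.1#)) (F.zeroʳ y))) θ.0-homo) ⟩
      ⟦ χ ⟧ (F.- F.1#) * (q · 1#)                                            ∎
      where
      module θ = NontrivialAddChar θ
      module χ = MulChar χ

      E : F.Carrier → Carrier
      E s = ∑ᶠ (λ y → ⟨ θ ⟩ (y F.* s))

      E-cong : Congruent E
      E-cong e = ∑ᶠ-cong λ y → θ.⟦⟧-cong (F.*-congˡ e)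

      off : ∀ t → t F.# (F.- F.1#) → ⟦ χ ⟧ t * E (t F.+ F.1#) ≈ 0#
      off t t#-1 = trans (*-congˡ (trans (∑ᶠ-cong λ y → θ.⟦⟧-cong (F.*-comm _ _)) (∑θ≈0 θ t+1#0))) (zeroʳ _)
        where
        t+1#0 : t F.+ F.1# F.# F.0#
        t+1#0 = F.#0-resp (F.+-congˡ (F.-‿involutive F.1#)) (F.#⇒-#0 t#-1)

      summand : ∀ y → gauss θ χ * (⟦ χ ⁻¹ ⟧ y * ⟨ θ ⟩ y) ≈
                      ∑ᶠ (λ t → ⟦ χ ⟧ t * (ε⟦ y ⟧ * ⟨ θ ⟩ (y F.* (t F.+ F.1#))))
      summand y with F.≈0⊎#0 y
      ... | inj₁ y≈0 = trans
        (trans (*-congˡ (trans (*-congʳ (character-≈0 (χ ⁻¹) y≈0)) (zeroˡ _))) (zeroʳ _))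
        (sym (∑ᶠ-zero λ t → trans (*-congˡ (trans (*-congʳ (ε-≈0 y≈0)) (zeroˡ _))) (zeroʳ _)))
      ... | inj₂ y#0 = begin
        gauss θ χ * (⟦ χ ⁻¹ ⟧ y * ⟨ θ ⟩ y)
          ≈⟨ *-congʳ (∑ᶠ-bijection (λ e → *-cong (χ.⟦⟧-cong e) (θ.⟦⟧-cong e)) (scaling y#0)) ⟩
        ∑ᶠ (λ t → ⟦ χ ⟧ (y F.* t) * ⟨ θ ⟩ (y F.* t)) * (⟦ χ ⁻¹ ⟧ y * ⟨ θ ⟩ y)
          ≈⟨ ∑ᶠ-*ʳ _ _ ⟩
        ∑ᶠ (λ t → ⟦ χ ⟧ (y F.* t) * ⟨ θ ⟩ (y F.* t) * (⟦ χ ⁻¹ ⟧ y * ⟨ θ ⟩ y))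
          ≈⟨ ∑ᶠ-cong term ⟩
        ∑ᶠ (λ t → ⟦ χ ⟧ t * (ε⟦ y ⟧ * ⟨ θ ⟩ (y F.* (t F.+ F.1#)))) ∎
        where
        term : ∀ t → ⟦ χ ⟧ (y F.* t) * ⟨ θ ⟩ (y F.* t) * (⟦ χ ⁻¹ ⟧ y * ⟨ θ ⟩ y) ≈
                     ⟦ χ ⟧ t * (ε⟦ y ⟧ * ⟨ θ ⟩ (y F.* (t F.+ F.1#)))
        term t = begin
          ⟦ χ ⟧ (y F.* t) * ⟨ θ ⟩ (y F.* t) * (⟦ χ ⁻¹ ⟧ y * ⟨ θ ⟩ y)
            ≈⟨ [ab][cd]≈[ac][bd] _ _ _ _ ⟩
          (⟦ χ ⟧ (y F.* t) * ⟦ χ ⁻¹ ⟧ y) * (⟨ θ ⟩ (y F.* t) * ⟨ θ ⟩ y)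
            ≈⟨ *-cong (trans (*-congʳ (trans (χ.*-homo y t) (*-comm _ _))) (*-assoc _ _ _)) (sym (θ.+-homo _ _)) ⟩
          (⟦ χ ⟧ t * (⟦ χ ⟧ y * ⟦ χ ⁻¹ ⟧ y)) * ⟨ θ ⟩ (y F.* t F.+ y)
            ≈⟨ *-cong (*-congˡ (∙-inverseʳ χ y)) (θ.⟦⟧-cong (F.trans (F.+-congˡ (F.sym (F.*-identityʳ y))) (F.sym (F.distribˡ y t F.1#)))) ⟩
          (⟦ χ ⟧ t * ε⟦ y ⟧) * ⟨ θ ⟩ (y F.* (t F.+ F.1#))
            ≈⟨ *-assoc _ _ _ ⟩
          ⟦ χ ⟧ t * (ε⟦ y ⟧ * ⟨ θ ⟩ (y F.* (t F.+ F.1#))) ∎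

    character#1? : ∀ χ x → Dec (⟦ χ ⟧ x # 1#)
    character#1? χ x with value-≈⊎# (character-value χ x) value-1
    ... | inj₁ e = no λ p → #⇒≉ p e
    ... | inj₂ p = yes p

    trivial-or-witness : ∀ χ → χ ≈ᶜ ε ⊎ (∃[ a ] (a F.# F.0# × ⟦ χ ⟧ a # 1#))
    trivial-or-witness χ with Fin.any? (λ i → F.#0? (element i) ×-dec character#1? χ (element i))
    ... | yes (i , p) = inj₂ (element i , p)
    ... | no ¬p = inj₁ λ x → agree x (F.≈0⊎#0 x)
      where
      agree : ∀ x → x F.≈ F.0# ⊎ x F.# F.0# → ⟦ χ ⟧ x ≈ ε⟦ x ⟧
      agree x (inj₁ x≈0) = trans (character-≈0 χ x≈0) (sym (ε-≈0 x≈0))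
      agree x (inj₂ x#0) = trans
        (trans (MulChar.⟦⟧-cong χ (F.sym (F.element-index x)))
               (root-¬#1 (λ p → ¬p (index x , F.#0-resp (F.sym (F.element-index x)) x#0 , p))))
        (sym (ε-#0 x#0))

    gauss#0 : ∀ θ χ → gauss θ χ # 0#
    gauss#0 θ χ with trivial-or-witness χ
    ... | inj₁ χ≈ε = inverse⇒#0 {y = - 1#} (trans (-1*x≈-x _)
          (sym (+-inverseʳ-unique _ _ (trans (+-congʳ (gauss-cong θ {χ} {ε} χ≈ε)) (gauss-ε θ)))))
    ... | inj₂ (a , a#0 , χa#1) = *#0⇒#0ˡ (#0-resp (sym (gauss-product θ χ a#0 χa#1))
          (x#0y#0→xy#0 (character-#0 χ -1#0) (·1#0 q {{F.q≢0}})))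
      where
      -1#0 : (F.- F.1#) F.# F.0#
      -1#0 = F.inverse⇒#0 {y = F.- F.1#} (F.trans (F.-1*x≈-x (F.- F.1#)) (F.-‿involutive F.1#))

    q-1#0 : q · 1# - 1# # 0#
    q-1#0 = go q F.1<q
      where
      go : ∀ n → 1 ℕ.< n → n · 1# - 1# # 0#
      go (ℕ.suc (ℕ.suc n)) _ = #0-resp
        (sym (trans (+-congʳ (+-comm _ _)) (trans (+-assoc _ _ _) (trans (+-congˡ (-‿inverseʳ 1#)) (+-identityʳ _)))))
        (characteristicZero n)
      go 1 (ℕ.s≤s ())

  Nonzero : Set (k ⊔ κ₂)
  Nonzero = Σ[ x ∈ Carrier ] x # 0#

  infixl 7 _/_
  _/_ : Carrier → Nonzero → Carrier
  x / (y , y#0) = x * recip y y#0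

  -- Every Gauss sum is invertible, so the quotients below are total.
  gaussˣ : NontrivialAddChar → MulChar → Nonzero
  gaussˣ θ χ = gauss θ χ , gauss#0 θ χ

  sumOver : List MulChar → (MulChar → Carrier) → Carrier
  sumOver χs f = List.foldr (λ χ s → f χ + s) 0# χs

  allCharacters : List MulChar
  allCharacters = proj₁ characters

  hypergeometric : NontrivialAddChar → ∀ {m} → Vector MulChar m → Vector MulChar m → F.Carrier → Carrier
  hypergeometric θ {m} A B z =
    (- 1# / (q · 1# - 1# , q-1#0)) *
    sumOver allCharacters λ χ →
      product (λ i → (gauss θ (A i ∙ χ) / gaussˣ θ (A i)) *
                     (gauss θ ((B i ∙ χ) ⁻¹) / gaussˣ θ (B i ⁻¹))) *
      ⟦ χ ⟧ (F.- F.1#) ^ m * ⟦ χ ⟧ z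

  squareRoots : MulChar → List MulChar
  squareRoots χ = List.filter (λ R → R ^ᶜ 2 ≟ χ) allCharacters

  HasOrderTwo : MulChar → Set (c ⊔ κ₁)
  HasOrderTwo χ = χ ^ᶜ 2 ≈ᶜ ε × ¬ (χ ≈ᶜ ε)

{-# OPTIONS --safe #-}

-- By Hasse–Davenport, g(χ) g(φχ) = χ̄(4) g(φ) g(χ²), the χ-summand of the ₄F₄ depends only on
-- χ²; with a = A², b = B² and c = ā b it is proportional to g(aχ²) g(χ̄²) g(bχ²) g(cχ̄²).
-- Writing g(χ) g(ψ) = Σ_t χ(t) T(χψ, t + 1) with T(χ, s) = Σ_x χ(x) θ(xs), orthogonality of
-- characters, applied to Σ_χ χ(u²), collapses the sum over χ to
--
--   Σ_t b(t) T(bc, t + 1) T(a, t + 1)  +  a(-1) Σ_t b(t) T(bc, t + 1) T(a, t - 1).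
--
-- Since T(χ, s) = χ̄(s) g(χ) for χ ≠ ε, the first sum (the analogue of Gauss's theorem) is
-- g(a) g(bc) Σ_t b(t) b̄²(t + 1), a Jacobi sum. In the second one (Kummer's theorem) the
-- substitution u = (t - 1)/(t + 1) leads to b̄(4) Σ_u ā(u) b(1 - u²), which is the sum of the
-- Jacobi sums J(R̄, b) over R² = a. Orthogonality rests on the existence of a generator of 𝔽*.
module Submission where

open import Defs
open import Level using (Level; _⊔_)
open import Algebra.Bundles using (AbelianGroup; CommutativeRing)
import Algebra.Properties.Group as GroupProperties
import Algebra.Solver.Ring.NaturalCoefficients.Default as SemiringSolver
open import Data.Fin.Base as Fin using (Fin)
import Data.Fin.Permutation as Perm
import Data.Fin.Properties as Fin
import Data.List.Base as List
open import Data.List.Membership.Propositional.Properties using (∈-lookup)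
import Data.List.Relation.Unary.All as All
import Data.List.Relation.Unary.AllPairs as AllPairs
import Data.List.Relation.Unary.Any as Any
import Data.List.Relation.Unary.Any.Properties as Any
import Data.List.Relation.Unary.Unique.Setoid as Uniqueness
open import Data.Nat.Base as ℕ using (ℕ; zero; suc; nonTrivial⇒n>1)
open import Data.Nat.Coprimality as Coprimality using (Coprime; coprime-divisor; coprime-Bézout)
open import Data.Nat.Divisibility as Divisibility hiding (quotient)
open import Data.Nat.GCD using (module Bézout; module GCD; mkGCD)
import Data.Nat.ListAction as ListAction
import Data.Nat.Properties as ℕ
open import Data.Nat.Primality using (Prime; prime⇒irreducible; prime⇒nonZero; prime⇒nonTrivial)
open import Data.Nat.Primality.Factorisation using (factorise; PrimeFactorisation)
open import Data.Nat.Tactic.RingSolver using (solve-∀)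
open import Data.Product.Base using (∃-syntax; _×_; _,_; proj₁; proj₂)
open import Data.Sum.Base using (_⊎_; inj₁; inj₂)
open import Data.Vec.Base as Vec using (Vec; replicate)
open import Relation.Binary.Bundles using (Setoid)
open import Relation.Binary.Definitions using (Decidable; tri<; tri≈; tri>)
open import Relation.Binary.PropositionalEquality as ≡ using (_≡_)
import Relation.Binary.Reasoning.Setoid as SetoidReasoning
open import Relation.Nullary using (¬_; Dec; yes; no; contradiction)
open import Relation.Nullary.Decidable using (¬?; _×-dec_; decidable-stable)
open import Relation.Unary as Unary using (Pred)

-- The hypotheses still allow ω = bc = Ā²B⁴ to be trivial, and then one of Y = ĀB² and φY is trivial
-- as well, because ω = Y². In that case T(ω, 0) is q - 1 instead of 0, and one of the two Jacobi
-- sums is no longer a plain quotient of Gauss sums. Instead of splitting cases, the formulas for T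
-- and for g(χ) g(ψ) carry a correction with the factor `total` χ = Σ_x χ(x), which is 0 for χ ≠ ε.
-- In the sum with T(a, t + 1) it is removed by T(a, 0) = 0. In Kummer's sum it survives at t = -1;
-- there `total` ω = `total` Y + `total` (φY), and the two parts are absorbed by the corrections of
-- J(Ā, b) and J(φĀ, b). Equality in ℂ is not assumed decidable. Quotients are therefore handled by
-- multiplying with Gauss sums, which are all apart from 0, and cancelling them at the end. For
-- values of characters apartness from 1 can be decided, as they are 0 or roots of unity.

private variable c ℓ ℓ₁ ℓ₂ k κ₁ κ₂ : Level

-- Coprimality and splitting off prime powers.

coprime-*ˡ : ∀ {a b n} → Coprime a n → Coprime b n → Coprime (a ℕ.* b) n
coprime-*ˡ ca cb (d∣ab , d∣n) =
  cb (coprime-divisor (λ (e∣d , e∣a) → ca (e∣a , ∣-trans e∣d d∣n)) d∣ab , d∣n)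

coprime-^ˡ : ∀ {a n} k → Coprime a n → Coprime (a ℕ.^ k) n
coprime-^ˡ zero    _  = Coprimality.1-coprimeTo _
coprime-^ˡ (suc k) ca = coprime-*ˡ ca (coprime-^ˡ k ca)

prime-∣⊎coprime : ∀ {p} → Prime p → ∀ n → p ∣ n ⊎ Coprime p n
prime-∣⊎coprime {p} pp n with p ∣? n
... | yes p∣n = inj₁ p∣n
... | no  p∤n = inj₂ λ (d∣p , d∣n) → case-irreducible d∣n (prime⇒irreducible pp d∣p)
  where
  case-irreducible : ∀ {d} → d ∣ n → d ≡ 1 ⊎ d ≡ p → d ≡ 1
  case-irreducible _   (inj₁ d≡1)    = d≡1
  case-irreducible d∣n (inj₂ ≡.refl) = contradiction d∣n p∤n

-- Writing n = kb, the divisor a of kb is coprime to b and hence divides k.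
coprime-*-∣ : ∀ {a b n} → Coprime a b → a ∣ n → b ∣ n → a ℕ.* b ∣ n
coprime-*-∣ {a} {b} ab a∣n (divides-refl k) =
  *-monoˡ-∣ b (coprime-divisor ab (≡.subst (a ∣_) (ℕ.*-comm k b) a∣n))

-- One factor p is removed at a time. Each quotient is strictly smaller than its predecessor, so the
-- bound `fuel` makes the recursion structural.
prime-power-split : ∀ {p} → Prime p → ∀ m .{{_ : ℕ.NonZero m}} →
                    ∃[ j ] ∃[ n ] (m ≡ p ℕ.^ j ℕ.* n × Coprime p n)
prime-power-split {p} pp m = go m m ℕ.≤-refl
  where
  go : ∀ fuel m .{{_ : ℕ.NonZero m}} → m ℕ.≤ fuel → ∃[ j ] ∃[ n ] (m ≡ p ℕ.^ j ℕ.* n × Coprime p n)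
  go zero       (suc m) ()
  go (suc fuel) m       m≤fuel with prime-∣⊎coprime pp m
  ... | inj₂ p⊥m = 0 , m , ≡.sym (ℕ.*-identityˡ m) , p⊥m
  ... | inj₁ p∣m
    with j , n , eq , p⊥n ← go fuel (Divisibility.quotient p∣m) {{quotient≢0 p∣m}}
           (ℕ.s≤s⁻¹ (ℕ.≤-trans (quotient-< p∣m {{prime⇒nonTrivial pp}}) m≤fuel)) =
    suc j , n , ≡.trans (m∣n⇒n≡m*quotient p∣m) (≡.trans (≡.cong (p ℕ.*_) eq) (≡.sym (ℕ.*-assoc p (p ℕ.^ j) n))) , p⊥n

-- Orders of elements in a commutative ring.

module RingOrder (𝓡 : CommutativeRing c ℓ₁) where

  open List.List using ([]; _∷_)
  open All.All using ([]; _∷_)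
  open Ring 𝓡
  open SetoidReasoning setoid

  HasOrder : Carrier → ℕ → Set ℓ₁
  HasOrder x m = x ^ m ≈ 1# × (∀ i → x ^ i ≈ 1# → m ∣ i)

  ^-∣ : ∀ {x a b} → a ∣ b → x ^ a ≈ 1# → x ^ b ≈ 1#
  ^-∣ {x} {a} (divides-refl k) e = begin
    x ^ (k ℕ.* a) ≈⟨ ^-congʳ x (ℕ.*-comm k a) ⟩
    x ^ (a ℕ.* k) ≈⟨ ^-assocʳ x a k ⟨
    (x ^ a) ^ k   ≈⟨ ^-congˡ k e ⟩
    1# ^ k        ≈⟨ 1^n≈1 k ⟩
    1#            ∎

  -- Bézout's identity in ℕ has the form 1 + m = n with m and n multiples of the two exponents, so x
  -- = x · xᵐ = xⁿ = 1 without any inverse.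
  ^-coprime : ∀ {x a b} → Coprime a b → x ^ a ≈ 1# → x ^ b ≈ 1# → x ≈ 1#
  ^-coprime {x} {a} {b} ab ea eb = go (coprime-Bézout ab)
    where
    step : ∀ {m n} → 1 ℕ.+ m ≡ n → x ^ m ≈ 1# → x ^ n ≈ 1# → x ≈ 1#
    step {m} {n} eq em en = begin
      x         ≈⟨ *-identityʳ x ⟨
      x * 1#    ≈⟨ *-congˡ em ⟨
      x * x ^ m ≈⟨ ^-congʳ x eq ⟩
      x ^ n     ≈⟨ en ⟩
      1#        ∎
    go : Bézout.Identity 1 a b → x ≈ 1#
    go (Bézout.+- s t eq) = step eq (^-∣ (n∣m*n t) eb) (^-∣ (n∣m*n s) ea)
    go (Bézout.-+ s t eq) = step eq (^-∣ (n∣m*n s) ea) (^-∣ (n∣m*n t) eb)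

  -- Induction on j, applied to zᵖ, gives i = kpʲ. If p did not divide k, the pʲ-th power of z would
  -- be killed by the coprime exponents p and k and so be 1.
  prime-power-order : ∀ {p} → Prime p → ∀ j {z i} → ¬ (z ^ (p ℕ.^ j) ≈ 1#) →
                      z ^ (p ℕ.^ suc j) ≈ 1# → z ^ i ≈ 1# → p ℕ.^ suc j ∣ i
  prime-power-order {p} pp zero {z} {i} z≉1 e ei with prime-∣⊎coprime pp i
  ... | inj₁ p∣i = ≡.subst (_∣ i) (≡.sym (ℕ.*-identityʳ p)) p∣i
  ... | inj₂ p⊥i = contradiction
    (trans (*-identityʳ z) (^-coprime p⊥i (trans (^-congʳ z (≡.sym (ℕ.*-identityʳ p))) e) ei)) z≉1
  prime-power-order {p} pp (suc j) {z} {i} z≉1 e ei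
    with prime-power-order pp j {z ^ p} {i}
           (λ e′ → z≉1 (trans (sym (^-assocʳ z p (p ℕ.^ j))) e′))
           (trans (^-assocʳ z p (p ℕ.^ suc j)) e)
           (trans (^-assocʳ z p i) (^-∣ (n∣m*n p) ei))
  ... | divides-refl k with prime-∣⊎coprime pp k
  ...   | inj₁ p∣k = *-monoˡ-∣ (p ℕ.^ suc j) p∣k
  ...   | inj₂ p⊥k = contradiction
    (^-coprime {z ^ (p ℕ.^ suc j)} p⊥k
      (trans (^-assocʳ z (p ℕ.^ suc j) p) (trans (^-congʳ z (ℕ.*-comm (p ℕ.^ suc j) p)) e))
      (trans (^-assocʳ z (p ℕ.^ suc j) k) (trans (^-congʳ z (ℕ.*-comm (p ℕ.^ suc j) k)) ei)))
    z≉1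

  -- Write m = pʲn with p ∤ n: the pʲ-th power of x has order n, the n-th power of y has
  -- order pʲ⁺¹, and the product of elements of coprime orders has the product order.
  order-*-prime : ∀ {p} → Prime p → ∀ {m} .{{_ : ℕ.NonZero m}} {x y} → HasOrder x m →
                  ¬ (y ^ m ≈ 1#) → y ^ (m ℕ.* p) ≈ 1# → ∃[ w ] HasOrder w (m ℕ.* p)
  order-*-prime {p} pp {m} {x} {y} (xᵐ , x-order) yᵐ yᵐᵖ
    with j , n , ≡.refl , p⊥n ← prime-power-split pp m = w , w^mp , divisible
    where
    P Q : ℕ
    P = p ℕ.^ suc j
    Q = p ℕ.^ j
    w z : Carrier
    z = y ^ n
    w = x ^ Q * z

    w^ : ∀ i → w ^ i ≈ x ^ (Q ℕ.* i) * z ^ i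
    w^ i = trans (^-distrib-* _ _ i) (*-congʳ (^-assocʳ x Q i))

    zᴾ : z ^ P ≈ 1#
    zᴾ = trans (^-assocʳ y n P) (trans (^-congʳ y (lemma p Q n)) yᵐᵖ)
      where
      lemma : ∀ p Q n → n ℕ.* (p ℕ.* Q) ≡ Q ℕ.* n ℕ.* p
      lemma = solve-∀

    z^Q : ¬ (z ^ Q ≈ 1#)
    z^Q e = yᵐ (trans (^-congʳ y (ℕ.*-comm Q n)) (trans (sym (^-assocʳ y n Q)) e))

    w^mp : w ^ (m ℕ.* p) ≈ 1#
    w^mp = begin
      w ^ (m ℕ.* p)                            ≈⟨ w^ _ ⟩
      x ^ (Q ℕ.* (m ℕ.* p)) * z ^ (m ℕ.* p)    ≈⟨ *-cong (^-∣ {a = m} (∣n⇒∣m*n Q (m∣m*n p)) xᵐ) (^-∣ {a = P} (divides n (lemma p Q n)) zᴾ) ⟩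
      1# * 1#                                  ≈⟨ *-identityˡ 1# ⟩
      1#                                       ∎
      where
      lemma : ∀ p Q n → Q ℕ.* n ℕ.* p ≡ n ℕ.* (p ℕ.* Q)
      lemma = solve-∀

    P⊥n : Coprime P n
    P⊥n = coprime-^ˡ (suc j) p⊥n

    n∣_ : ∀ i → w ^ i ≈ 1# → n ∣ i
    -- The exponent iP annihilates the z-part of w, as zᴾ = 1. What remains says that Qn divides
    -- Q(iP), where Q is cancelled.
    (n∣ i) wⁱ = coprime-divisor (Coprimality.sym P⊥n) (≡.subst (n ∣_) (ℕ.*-comm i P)
      (*-cancelˡ-∣ Q {{ℕ.m^n≢0 p j {{prime⇒nonZero pp}}}} (x-order (Q ℕ.* (i ℕ.* P)) (begin
        x ^ (Q ℕ.* (i ℕ.* P))                      ≈⟨ *-identityʳ _ ⟨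
        x ^ (Q ℕ.* (i ℕ.* P)) * 1#                 ≈⟨ *-congˡ (^-∣ (n∣m*n i) zᴾ) ⟨
        x ^ (Q ℕ.* (i ℕ.* P)) * z ^ (i ℕ.* P)      ≈⟨ w^ _ ⟨
        w ^ (i ℕ.* P)                              ≈⟨ ^-∣ {w} {i} (m∣m*n P) wⁱ ⟩
        1#                                         ∎))))

    P∣_ : ∀ i → w ^ i ≈ 1# → P ∣ i
    (P∣ i) wⁱ = coprime-divisor P⊥n (prime-power-order pp j z^Q zᴾ (begin
      z ^ (n ℕ.* i)                               ≈⟨ *-identityˡ _ ⟨
      1# * z ^ (n ℕ.* i)                          ≈⟨ *-congʳ (^-∣ (divides i (lemma Q n i)) xᵐ) ⟨
      x ^ (Q ℕ.* (n ℕ.* i)) * z ^ (n ℕ.* i)       ≈⟨ w^ _ ⟨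
      w ^ (n ℕ.* i)                               ≈⟨ ^-∣ (n∣m*n n) wⁱ ⟩
      1#                                          ∎))
      where
      lemma : ∀ Q n i → Q ℕ.* (n ℕ.* i) ≡ i ℕ.* (Q ℕ.* n)
      lemma = solve-∀

    divisible : ∀ i → w ^ i ≈ 1# → m ℕ.* p ∣ i
    divisible i wⁱ = ≡.subst (_∣ i) (lemma p Q n) (coprime-*-∣ P⊥n ((P∣ i) wⁱ) ((n∣ i) wⁱ))
      where
      lemma : ∀ p Q n → p ℕ.* Q ℕ.* n ≡ Q ℕ.* n ℕ.* p
      lemma = solve-∀

  -- Prime factors of N are removed one by one as long as the power of u stays 1. This must fail
  -- before all are gone, since u itself is not 1; the prime removed at that moment is p and the
  -- remaining product is e.
  prime-exponent : Decidable _≈_ → ∀ {u} N .{{_ : ℕ.NonZero N}} → ¬ (u ≈ 1#) → u ^ N ≈ 1# →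
                   ∃[ p ] ∃[ e ] (Prime p × ¬ (u ^ e ≈ 1#) × u ^ (e ℕ.* p) ≈ 1#)
  prime-exponent _≈?_ {u} N u≉1 uᴺ =
    go (PrimeFactorisation.factors f) (PrimeFactorisation.factorsPrime f)
      (trans (^-congʳ u (≡.sym (PrimeFactorisation.isFactorisation f))) uᴺ)
    where
    f : PrimeFactorisation N
    f = factorise N
    go : ∀ ps → All.All Prime ps → u ^ ListAction.product ps ≈ 1# →
         ∃[ p ] ∃[ e ] (Prime p × ¬ (u ^ e ≈ 1#) × u ^ (e ℕ.* p) ≈ 1#)
    go []       []         e = contradiction (trans (sym (*-identityʳ u)) e) u≉1
    go (p ∷ ps) (pp ∷ pps) e with (u ^ ListAction.product ps) ≈? 1#
    ... | yes e′ = go ps pps e′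
    ... | no ¬e′ = p , ListAction.product ps , pp , ¬e′ , trans (^-congʳ u (ℕ.*-comm _ p)) e

-- The multiplicative group of a finite field is cyclic.

module FiniteFieldGenerator (𝔽 : FiniteField c ℓ₁ ℓ₂) where

  open Vec.Vec using ([]; _∷_)
  open FiniteFieldTheory 𝔽
  open RingOrder commutativeRing
  open SetoidReasoning setoid

  monic-root : ∀ {n} (as : Vec Carrier (suc n)) {r} → monic as r ≈ 0# →
               ∀ x → monic as x ≈ (x - r) * monic (quotient r as) x
  monic-root as {r} er x = begin
    monic as x                     ≈⟨ x-0≈x _ ⟨
    monic as x - 0#                ≈⟨ +-congˡ (-‿cong er) ⟨
    monic as x - monic as r        ≈⟨ +≈+⇒-≈-* (monic-quotient r as x) ⟩
    (x - r) * monic (quotient r as) x   ∎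

  -- Deflation by the first root: the other listed roots, and x if it is apart from the first, are
  -- roots of the quotient. In degree 0 the polynomial is 1 and has no root.
  monic-roots-exhaustive : ∀ {n} (as : Vec Carrier n) (r : Fin n → Carrier) →
                           (∀ i → monic as (r i) ≈ 0#) → (∀ i j → r i ≈ r j → i ≡ j) →
                           ∀ x → monic as x ≈ 0# → ∃[ i ] x ≈ r i
  monic-roots-exhaustive []         r roots injective x e = contradiction e (#⇒≉ 1#0)
  monic-roots-exhaustive as@(_ ∷ _) r roots injective x e with ≈0⊎#0 (x - r Fin.zero)
  ... | inj₁ x≈r = Fin.zero , -≈0⇒≈ x≈r
  ... | inj₂ x#r =
    let (i , ei) = monic-roots-exhaustive (quotient (r Fin.zero) as) (λ i → r (Fin.suc i))
           (λ i → root (r (Fin.suc i)) (distinct i) (roots (Fin.suc i)))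
           (λ i j eq → Fin.suc-injective (injective (Fin.suc i) (Fin.suc j) eq))
           x (root x x#r e)
    in Fin.suc i , ei
    where
    root : ∀ y → y - r Fin.zero # 0# → monic as y ≈ 0# →
           monic (quotient (r Fin.zero) as) y ≈ 0#
    root y y#r ey = *≈0⇒≈0 y#r (trans (sym (monic-root as (roots Fin.zero) y)) ey)
    distinct : ∀ i → r (Fin.suc i) - r Fin.zero # 0#
    distinct i with ≈0⊎#0 (r (Fin.suc i) - r Fin.zero)
    ... | inj₁ e = contradiction (injective (Fin.suc i) Fin.zero (-≈0⇒≈ e)) λ ()
    ... | inj₂ d = d

  root-of-unity#0 : ∀ {x} n .{{_ : ℕ.NonZero n}} → x ^ n ≈ 1# → x # 0#
  root-of-unity#0 (suc n) e = inverse⇒#0 (trans (*-comm _ _) e)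

  -- Among the q + 1 powers of x with exponents 0 to q two agree.
  finite-order : ∀ {x} → x # 0# → ∃[ n ] (ℕ.NonZero n × n ℕ.≤ q × x ^ n ≈ 1#)
  finite-order {x} x#0
    with i , j , i<j , e ← Fin.pigeonhole (ℕ.n<1+n q) (λ i → index (x ^ Fin.toℕ i)) =
    Fin.toℕ j ℕ.∸ Fin.toℕ i , ℕ.>-nonZero (ℕ.m<n⇒0<n∸m i<j) ,
    ℕ.≤-trans (ℕ.m∸n≤m (Fin.toℕ j) (Fin.toℕ i)) (ℕ.s≤s⁻¹ (Fin.toℕ<n j)) ,
    ^-periodic (Fin.toℕ i) (Fin.toℕ j) i<j x#0
      (trans (sym (element-index _)) (trans (reflexive (≡.cong element e)) (element-index _)))

  order-distinct : ∀ {x m} → HasOrder x m → .{{_ : ℕ.NonZero m}} → ∀ {i j} →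
                   i ℕ.< j → j ℕ.< m → ¬ (x ^ i ≈ x ^ j)
  order-distinct {x} {m} (xᵐ , x-order) {i} {j} i<j j<m e = ℕ.<⇒≱ (ℕ.≤-<-trans (ℕ.m∸n≤m j i) j<m)
    (∣⇒≤ {{ℕ.>-nonZero (ℕ.m<n⇒0<n∸m i<j)}} (x-order _ (^-periodic i j i<j (root-of-unity#0 m xᵐ) e)))

  order-injective : ∀ {x m} → HasOrder x m → .{{_ : ℕ.NonZero m}} → ∀ (i j : Fin m) →
                    x ^ Fin.toℕ i ≈ x ^ Fin.toℕ j → i ≡ j
  order-injective ord i j e with ℕ.<-cmp (Fin.toℕ i) (Fin.toℕ j)
  ... | tri< i<j _ _ = contradiction e (order-distinct ord i<j (Fin.toℕ<n j))
  ... | tri≈ _ i≡j _ = Fin.toℕ-injective i≡j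
  ... | tri> _ _ j<i = contradiction (sym e) (order-distinct ord j<i (Fin.toℕ<n i))

  record Generator : Set (c ⊔ ℓ₁ ⊔ ℓ₂) where
    field
      γ         : Carrier
      order     : ℕ
      order≢0   : ℕ.NonZero order
      γ-order   : HasOrder γ order
      logarithm : ∀ x → x # 0# → ∃[ i ] x ≈ γ ^ Fin.toℕ {order} i

  -- The powers of x already exhaust the m roots of Xᵐ - 1.
  exponent⇒generator : ∀ {x m} → HasOrder x m → .{{_ : ℕ.NonZero m}} →
                       (∀ y → y # 0# → y ^ m ≈ 1#) → Generator
  exponent⇒generator {x} {suc m} ord exponent = record
    { γ         = x
    ; order     = suc m
    ; order≢0   = _
    ; γ-order   = ord
    ; logarithm = λ y y#0 → monic-roots-exhaustive (- 1# ∷ replicate m 0#) (λ i → x ^ Fin.toℕ i)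
        (λ i → root (^#0 (Fin.toℕ i) (root-of-unity#0 (suc m) (proj₁ ord))))
        (order-injective ord) y (root y#0)
    }
    where
    root : ∀ {y} → y # 0# → monic (- 1# ∷ replicate m 0#) y ≈ 0#
    root {y} y#0 = begin
      - 1# + y * monic (replicate m 0#) y ≈⟨ +-congˡ (*-congˡ (monic-replicate m y)) ⟩
      - 1# + y ^ suc m                    ≈⟨ +-congˡ (exponent y y#0) ⟩
      - 1# + 1#                           ≈⟨ -‿inverseˡ 1# ⟩
      0#                                  ∎

  order≤q : ∀ {x m} .{{_ : ℕ.NonZero m}} → HasOrder x m → m ℕ.≤ q
  order≤q {x} {m} (xᵐ , x-order) with n , n≢0 , n≤q , xⁿ ← finite-order (root-of-unity#0 m xᵐ) =
    ℕ.≤-trans (∣⇒≤ {{n≢0}} (x-order n xⁿ)) n≤q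

  -- Put u = yᵐ ≠ 1. If uᵉ ≠ 1 but the ep-th power of u is 1, then yᵉ is killed by mp and not by m,
  -- which is what `order-*-prime` asks for.
  larger-order : ∀ {x y m} .{{_ : ℕ.NonZero m}} → HasOrder x m → y # 0# → ¬ (y ^ m ≈ 1#) →
                 ∃[ w ] ∃[ n ] (m ℕ.< n × HasOrder w n)
  larger-order {x} {y} {m} ord y#0 yᵐ
    with N , N≢0 , _ , yᴺ ← finite-order y#0
    with p , e , pp , uᵉ , uᵉᵖ ← prime-exponent _≈?_ {y ^ m} N {{N≢0}} yᵐ
           (trans (^-assocʳ y m N) (^-∣ (n∣m*n m) yᴺ))
    with w , w-order ← order-*-prime pp {m} {x} {y ^ e} ord
           (λ e′ → uᵉ (trans (^-assocʳ y m e) (trans (^-congʳ y (ℕ.*-comm m e)) (trans (sym (^-assocʳ y e m)) e′))))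
           (trans (^-assocʳ y e (m ℕ.* p)) (trans (^-congʳ y (≡.trans (≡.sym (ℕ.*-assoc e m p)) (≡.trans (≡.cong (ℕ._* p) (ℕ.*-comm e m)) (ℕ.*-assoc m e p)))) (trans (sym (^-assocʳ y m (e ℕ.* p))) uᵉᵖ))) =
    w , m ℕ.* p , ℕ.m<m*n m p (nonTrivial⇒n>1 p {{prime⇒nonTrivial pp}}) , w-order

  abstract

    -- The search starts from x = 1 of order 1. While some nonzero y violates yᵐ = 1, the order can
    -- be increased. Orders are at most q, so the invariant q < m + `fuel` excludes running out of
    -- fuel.
    generator : Generator
    generator = go q 1 (ℕ.n<1+n q) (*-identityʳ 1# , λ i _ → 1∣ i)
      where
      go : ∀ fuel m {x} .{{_ : ℕ.NonZero m}} → q ℕ.< m ℕ.+ fuel → HasOrder x m → Generator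
      go zero       m q<m ord = contradiction (order≤q ord) (ℕ.<⇒≱ (≡.subst (q ℕ.<_) (ℕ.+-identityʳ m) q<m))
      go (suc fuel) m q<m ord with Fin.any? (λ i → #0? (element i) ×-dec ¬? (element i ^ m ≈? 1#))
      ... | yes (i , y#0 , yᵐ) =
        let (w , n , m<n , w-order) = larger-order ord y#0 yᵐ in
        go fuel n {{ℕ.>-nonZero (ℕ.≤-<-trans ℕ.z≤n m<n)}}
          (ℕ.≤-trans q<m (ℕ.≤-trans (ℕ.≤-reflexive (ℕ.+-suc m fuel)) (ℕ.+-monoˡ-≤ fuel m<n))) w-order
      ... | no ¬p = exponent⇒generator ord λ y y#0 → trans (^-congˡ m (sym (element-index y)))
        (decidable-stable (_ ≈? _) λ ¬e → ¬p (index y , #0-resp (sym (element-index y)) y#0 , ¬e))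

-- Characters of 𝔽* that separate points.

coprime-quotients : ∀ m n .{{_ : ℕ.NonZero m}} →
  ∃[ d ] ∃[ m′ ] ∃[ n′ ] (m ≡ m′ ℕ.* suc d × n ≡ n′ ℕ.* suc d × Coprime m′ n′)
coprime-quotients m n {{m≢0}} with mkGCD m n
... | zero , gcd = contradiction (0∣⇒≡0 (proj₁ (GCD.commonDivisor gcd))) (ℕ.≢-nonZero⁻¹ m)
-- A common divisor e of the two quotients makes e · gcd a common divisor of m and n, hence a
-- divisor of the gcd, which forces e = 1.
... | suc d , gcd with divides m′ em , divides n′ en ← GCD.commonDivisor gcd =
  d , m′ , n′ , em , en , λ {e} (e∣m′ , e∣n′) → ℕ.*-cancelʳ-≡ e 1 (suc d)
    (≡.trans (∣-antisym
      (GCD.greatest gcd (≡.subst (e ℕ.* suc d ∣_) (≡.sym em) (*-monoˡ-∣ (suc d) e∣m′) , ≡.subst (e ℕ.* suc d ∣_) (≡.sym en) (*-monoˡ-∣ (suc d) e∣n′)))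
      (n∣m*n e)) (≡.sym (ℕ.*-identityˡ (suc d))))

module PowerCharacters (𝔽 : FiniteField c ℓ₁ ℓ₂) (ℂ : AlgebraicallyClosedField₀ k κ₁ κ₂) where

  open Vec.Vec using (_∷_)
  open Characters 𝔽 ℂ
  open AlgebraicallyClosedField₀ ℂ
  open K hiding (_≈_; _+_; _*_)
  open SetoidReasoning setoid
  open RingOrder commutativeRing using (^-∣; ^-coprime)
  private module FO = RingOrder F.commutativeRing
  open FiniteFieldGenerator 𝔽 using (module Generator; generator; root-of-unity#0)
  open Generator generator public

  γ#0 : γ F.# F.0#
  γ#0 = root-of-unity#0 order {{order≢0}} (proj₁ γ-order)

  ^-transfer-< : ∀ {ζ} → ζ ^ order ≈ 1# → ∀ i j → i ℕ.< j → γ F.^ i F.≈ γ F.^ j → ζ ^ i ≈ ζ ^ j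
  ^-transfer-< {ζ} e i j i<j γ≈ = begin
    ζ ^ i                       ≈⟨ *-identityˡ _ ⟨
    1# * ζ ^ i                  ≈⟨ *-congʳ (^-∣ {ζ} {order} (proj₂ γ-order (j ℕ.∸ i) (F.^-periodic i j i<j γ#0 γ≈)) e) ⟨
    ζ ^ (j ℕ.∸ i) * ζ ^ i       ≈⟨ ^-homo-* ζ (j ℕ.∸ i) i ⟨
    ζ ^ (j ℕ.∸ i ℕ.+ i)         ≈⟨ ^-congʳ ζ (ℕ.m∸n+n≡m (ℕ.<⇒≤ i<j)) ⟩
    ζ ^ j                       ∎

  -- Well-definedness of γⁱ ↦ ζⁱ: equal powers of γ have exponents that differ by a multiple of its
  -- order, and ζ is killed by that order.
  ^-transfer : ∀ {ζ} → ζ ^ order ≈ 1# → ∀ i j → γ F.^ i F.≈ γ F.^ j → ζ ^ i ≈ ζ ^ j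
  ^-transfer {ζ} e i j γ≈ with ℕ.<-cmp i j
  ... | tri< i<j _ _    = ^-transfer-< e i j i<j γ≈
  ... | tri≈ _ ≡.refl _ = refl
  ... | tri> _ _ j<i    = sym (^-transfer-< e j i j<i (F.sym γ≈))

  power : Carrier → ∀ {x} → Dec (x F.# F.0#) → Carrier
  power ζ (yes x#0) = ζ ^ Fin.toℕ (proj₁ (logarithm _ x#0))
  power ζ (no  _)   = 0#

  module _ (ζ : Carrier) (ζⁿ : ζ ^ order ≈ 1#) where

    power-0 : ∀ {x} → x F.≈ F.0# → power ζ (F.#0? x) ≈ 0#
    power-0 {x} e with F.#0? x
    ... | yes x#0 = contradiction e (F.#⇒≉ x#0)
    ... | no  _   = refl

    power-γ : ∀ {x} i → x F.≈ γ F.^ i → power ζ (F.#0? x) ≈ ζ ^ i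
    power-γ {x} i e with F.#0? x
    ... | yes x#0 = ^-transfer ζⁿ (Fin.toℕ (proj₁ (logarithm x x#0))) i (F.trans (F.sym (proj₂ (logarithm x x#0))) e)
    ... | no ¬x#0 = contradiction (F.#0-resp (F.sym e) (F.^#0 i γ#0)) ¬x#0

    powerCharacter : MulChar
    powerCharacter = record
      { ⟦_⟧ = λ x → power ζ (F.#0? x)
      ; isMonoidHomomorphism = record
        { isMagmaHomomorphism = record
          { isRelHomomorphism = record { cong = cong }
          ; homo = homo
          }
        ; ε-homo = power-γ 0 F.refl
        }
      ; 0-homo = power-0 F.refl
      }
      where
      cong : ∀ {x y} → x F.≈ y → power ζ (F.#0? x) ≈ power ζ (F.#0? y)
      cong {x} {y} e with F.≈0⊎#0 x
      ... | inj₁ x≈0 = trans (power-0 x≈0) (sym (power-0 (F.trans (F.sym e) x≈0)))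
      ... | inj₂ x#0 with i , x≈ ← logarithm x x#0 =
        trans (power-γ (Fin.toℕ i) x≈) (sym (power-γ (Fin.toℕ i) (F.trans (F.sym e) x≈)))
      homo : ∀ x y → power ζ (F.#0? (x F.* y)) ≈ power ζ (F.#0? x) * power ζ (F.#0? y)
      homo x y with F.≈0⊎#0 x | F.≈0⊎#0 y
      ... | inj₁ x≈0 | _        = trans (power-0 (F.trans (F.*-congʳ x≈0) (F.zeroˡ y))) (sym (trans (*-congʳ (power-0 x≈0)) (zeroˡ _)))
      ... | inj₂ _   | inj₁ y≈0 = trans (power-0 (F.trans (F.*-congˡ y≈0) (F.zeroʳ x))) (sym (trans (*-congˡ (power-0 y≈0)) (zeroʳ _)))
      ... | inj₂ x#0 | inj₂ y#0 with i , x≈ ← logarithm x x#0 | j , y≈ ← logarithm y y#0 = begin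
        power ζ (F.#0? (x F.* y))             ≈⟨ power-γ (Fin.toℕ i ℕ.+ Fin.toℕ j) (F.trans (F.*-cong x≈ y≈) (F.sym (F.^-homo-* γ (Fin.toℕ i) (Fin.toℕ j)))) ⟩
        ζ ^ (Fin.toℕ i ℕ.+ Fin.toℕ j)         ≈⟨ ^-homo-* ζ (Fin.toℕ i) (Fin.toℕ j) ⟩
        ζ ^ Fin.toℕ i * ζ ^ Fin.toℕ j         ≈⟨ *-cong (power-γ (Fin.toℕ i) x≈) (power-γ (Fin.toℕ j) y≈) ⟨
        power ζ (F.#0? x) * power ζ (F.#0? y) ∎

  ^-root : ∀ n .{{_ : ℕ.NonZero n}} x → ∃[ y ] y ^ n ≈ x
  ^-root (suc n) x with y , e ← algebraicallyClosed (- x ∷ replicate n 0#) =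
    y , -≈0⇒≈ (trans (+-comm _ _) (trans (+-congˡ (*-congˡ (sym (monic-replicate n y)))) e))

  -- Here `monic (replicate n 1#)` is S = 1 + X + ... + Xⁿ, and the equation is xⁿ⁺¹ - 1 = (x - 1) S
  -- without subtraction.
  monic-ones-^ : ∀ n x → x ^ suc n + monic (replicate n 1#) x ≈ 1# + x * monic (replicate n 1#) x
  monic-ones-^ zero    x = +-comm (x * 1#) 1#
  monic-ones-^ (suc n) x = begin
    x * x ^ suc n + (1# + x * m)   ≈⟨ +-assoc _ _ _ ⟨
    (x * x ^ suc n + 1#) + x * m   ≈⟨ +-congʳ (+-comm _ _) ⟩
    (1# + x * x ^ suc n) + x * m   ≈⟨ +-assoc _ _ _ ⟩
    1# + (x * x ^ suc n + x * m)   ≈⟨ +-congˡ (distribˡ x _ _) ⟨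
    1# + x * (x ^ suc n + m)       ≈⟨ +-congˡ (*-congˡ (monic-ones-^ n x)) ⟩
    1# + x * (1# + x * m)          ∎
    where
    m : Carrier
    m = monic (replicate n 1#) x

  monic-ones-1 : ∀ n {x} → x ≈ 1# → monic (replicate n 1#) x ≈ suc n · 1#
  monic-ones-1 zero    e = sym (+-identityʳ 1#)
  monic-ones-1 (suc n) e = +-congˡ (trans (*-cong e (monic-ones-1 n e)) (*-identityˡ _))

  nontrivial-root-of-unity : ∀ n → ∃[ ω ] (ω ^ suc (suc n) ≈ 1# × ¬ (ω ≈ 1#))
  nontrivial-root-of-unity n with ω , e ← algebraicallyClosed (replicate (suc n) 1#) =
    ω , ωⁿ , λ ω≈1 → #⇒≉ (characteristicZero (suc n)) (trans (sym (monic-ones-1 (suc n) ω≈1)) e)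
    where
    ωⁿ : ω ^ suc (suc n) ≈ 1#
    ωⁿ = begin
      ω ^ suc (suc n)                                   ≈⟨ +-identityʳ _ ⟨
      ω ^ suc (suc n) + 0#                              ≈⟨ +-congˡ e ⟨
      ω ^ suc (suc n) + monic (replicate (suc n) 1#) ω  ≈⟨ monic-ones-^ (suc n) ω ⟩
      1# + ω * monic (replicate (suc n) 1#) ω           ≈⟨ +-congˡ (trans (*-congˡ e) (zeroʳ ω)) ⟩
      1# + 0#                                           ≈⟨ +-identityʳ 1# ⟩
      1#                                                ∎

  -- With d = gcd(n, i) for n the order of γ and x = γⁱ, take ω ≠ 1 with ω^(n/d) = 1 and
  -- ζ with ζᵈ = ω; then ζⁱ = ω^(i/d) ≠ 1, as i/d is coprime to n/d.
  separating-character : ∀ {x} → x F.# F.0# → ¬ (x F.≈ F.1#) → ∃[ χ ] ⟦ χ ⟧ x # 1#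
  separating-character {x} x#0 x≉1
    with i , x≈ ← logarithm x x#0
    with coprime-quotients order (Fin.toℕ i) {{order≢0}}
  ... | d , zero , i′ , n≡ , i≡ , _ = contradiction n≡ (ℕ.≢-nonZero⁻¹ order {{order≢0}})
  -- Here the order of γ divides i, so x = γⁱ would be 1.
  ... | d , 1 , i′ , n≡ , i≡ , _ = contradiction
    (F.trans x≈ (FO.^-∣ {γ} {order} (divides i′ (≡.trans i≡ (≡.cong (i′ ℕ.*_) (≡.sym (≡.trans n≡ (ℕ.*-identityˡ (suc d))))))) (proj₁ γ-order))) x≉1
  ... | d , n′@(suc (suc l)) , i′ , n≡ , i≡ , n′⊥i′
    with ω , ωⁿ , ω≉1 ← nontrivial-root-of-unity l
    with ζ , ζᵈ ← ^-root (suc d) ω = χ , χx#1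
    where
    ζ^ : ∀ {m} m′ → m ≡ m′ ℕ.* suc d → ζ ^ m ≈ ω ^ m′
    ζ^ {m} m′ eq = begin
      ζ ^ m               ≈⟨ ^-congʳ ζ (≡.trans eq (ℕ.*-comm m′ (suc d))) ⟩
      ζ ^ (suc d ℕ.* m′)  ≈⟨ ^-assocʳ ζ (suc d) m′ ⟨
      (ζ ^ suc d) ^ m′    ≈⟨ ^-congˡ m′ ζᵈ ⟩
      ω ^ m′              ∎
    ζⁿ : ζ ^ order ≈ 1#
    ζⁿ = trans (ζ^ n′ n≡) ωⁿ
    χ : MulChar
    χ = powerCharacter ζ ζⁿ
    χx≉1 : ¬ (⟦ χ ⟧ x ≈ 1#)
    χx≉1 e = ω≉1 (^-coprime n′⊥i′ ωⁿ (trans (sym (ζ^ i′ i≡)) (trans (sym (power-γ ζ ζⁿ (Fin.toℕ i) x≈)) e)))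
    χx#1 : ⟦ χ ⟧ x # 1#
    -- The negation improves to apartness because apartness from 1 is decidable for values of
    -- characters.
    χx#1 with character#1? χ x
    ... | yes p = p
    ... | no ¬p = contradiction (root-¬#1 ¬p) χx≉1

-- Lists without repetition, parity and ring identities.

module _ (S : Setoid c ℓ) where

  open Setoid S
  open AllPairs.AllPairs using (_∷_)

  unique-lookup : ∀ {xs} → Uniqueness.Unique S xs → ∀ i j → List.lookup xs i ≈ List.lookup xs j → i ≡ j
  unique-lookup (px ∷ u) Fin.zero    Fin.zero    e = ≡.refl
  unique-lookup (px ∷ u) Fin.zero    (Fin.suc j) e = contradiction e (All.lookup px (∈-lookup j))
  unique-lookup (px ∷ u) (Fin.suc i) Fin.zero    e = contradiction (sym e) (All.lookup px (∈-lookup i))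
  unique-lookup (px ∷ u) (Fin.suc i) (Fin.suc j) e = ≡.cong Fin.suc (unique-lookup u i j e)

even⊎odd : ∀ n → ∃[ k ] (n ≡ k ℕ.+ k ⊎ n ≡ suc (k ℕ.+ k))
even⊎odd zero = 0 , inj₁ ≡.refl
even⊎odd (suc n) with even⊎odd n
... | k , inj₁ e = k , inj₂ (≡.cong suc e)
... | k , inj₂ e = suc k , inj₁ (≡.trans (≡.cong suc e) (≡.cong suc (≡.sym (ℕ.+-suc k k))))

module RingFacts (𝓡 : CommutativeRing c ℓ) where

  open Ring 𝓡
  open SemiringSolver commutativeSemiring using (solve; _:=_; _:+_; _:*_)

  x²-y²≈[x-y][x+y] : ∀ x y → x * x - y * y ≈ (x - y) * (x + y)
  x²-y²≈[x-y][x+y] x y = +≈+⇒-≈-*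
    (solve 2 (λ x y → x :* x :+ y :* (x :+ y) := y :* y :+ x :* (x :+ y)) refl x y)

  [a+b]+[c+d]≈[a+c]+[b+d] : ∀ a b c d → (a + b) + (c + d) ≈ (a + c) + (b + d)
  [a+b]+[c+d]≈[a+c]+[b+d] = solve 4 (λ a b c d → (a :+ b) :+ (c :+ d) := (a :+ c) :+ (b :+ d)) refl

  -x*-x≈x*x : ∀ x → - x * - x ≈ x * x
  -x*-x≈x*x x = trans (sym (-‿distribˡ-* x (- x))) (trans (-‿cong (sym (-‿distribʳ-* x x))) (-‿involutive (x * x)))

-- Sums over all characters and orthogonality.

module CharacterSums (𝔽 : FiniteField c ℓ₁ ℓ₂) (ℂ : AlgebraicallyClosedField₀ k κ₁ κ₂) where

  open List.List using ([]; _∷_)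
  open Characters 𝔽 ℂ
  open AlgebraicallyClosedField₀ ℂ
  open K hiding (_≈_; _+_; _*_)
  open SetoidReasoning setoid
  open PowerCharacters 𝔽 ℂ
  open F using (q)

  sumOver-cong : ∀ χs {f g} → (∀ χ → f χ ≈ g χ) → sumOver χs f ≈ sumOver χs g
  sumOver-cong []       e = refl
  sumOver-cong (χ ∷ χs) e = +-cong (e χ) (sumOver-cong χs e)

  sumOver-*ˡ : ∀ χs a f → a * sumOver χs f ≈ sumOver χs (λ χ → a * f χ)
  sumOver-*ˡ []       a f = zeroʳ a
  sumOver-*ˡ (χ ∷ χs) a f = trans (distribˡ a _ _) (+-congˡ (sumOver-*ˡ χs a f))

  sumOver-zero : ∀ χs {f} → (∀ χ → f χ ≈ 0#) → sumOver χs f ≈ 0#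
  sumOver-zero χs e = trans (sumOver-cong χs λ χ → trans (e χ) (sym (zeroˡ 0#)))
    (trans (sym (sumOver-*ˡ χs 0# (λ _ → 0#))) (zeroˡ _))

  sumOver-+ : ∀ χs f h → sumOver χs (λ χ → f χ + h χ) ≈ sumOver χs f + sumOver χs h
  sumOver-+ []       f h = sym (+-identityʳ 0#)
  sumOver-+ (χ ∷ χs) f h = trans (+-congˡ (sumOver-+ χs f h)) (RingFacts.[a+b]+[c+d]≈[a+c]+[b+d] commutativeRing _ _ _ _)

  -- Turns a sum over a filtered list into one over all characters, whose summands can then be split
  -- one by one.
  select : ∀ {p} {P : Set p} → Dec P → Carrier → Carrier
  select (yes _) x = x
  select (no  _) x = 0#

  select-yes : ∀ {p} {P : Set p} (d : Dec P) {x} → P → select d x ≈ x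
  select-yes (yes _) _ = refl
  select-yes (no ¬p) p = contradiction p ¬p

  select-no : ∀ {p} {P : Set p} (d : Dec P) {x} → ¬ P → select d x ≈ 0#
  select-no (yes p) ¬p = contradiction p ¬p
  select-no (no _)  _  = refl

  sumOver-filter : ∀ {p} {P : Pred MulChar p} (P? : Unary.Decidable P) χs f →
                   sumOver (List.filter P? χs) f ≈ sumOver χs (λ χ → select (P? χ) (f χ))
  sumOver-filter P? []       f = refl
  sumOver-filter P? (χ ∷ χs) f with P? χ
  ... | yes _ = +-congˡ (sumOver-filter P? χs f)
  ... | no  _ = trans (sumOver-filter P? χs f) (sym (+-identityˡ _))

  sumOver-∑ᶠ : ∀ χs (f : MulChar → F.Carrier → Carrier) →
               sumOver χs (λ χ → ∑ᶠ (f χ)) ≈ ∑ᶠ (λ x → sumOver χs (λ χ → f χ x))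
  sumOver-∑ᶠ []       f = sym (∑ᶠ-zero λ _ → refl)
  sumOver-∑ᶠ (χ ∷ χs) f = trans (+-congˡ (sumOver-∑ᶠ χs f)) (sym (∑ᶠ-+ _ _))

  sumOver-lookup : ∀ χs f → sumOver χs f ≈ sum (λ i → f (List.lookup χs i))
  sumOver-lookup []       f = refl
  sumOver-lookup (χ ∷ χs) f = +-congˡ (sumOver-lookup χs f)

  Congruentᶜ : (MulChar → Carrier) → Set _
  Congruentᶜ f = ∀ {χ ψ} → χ ≈ᶜ ψ → f χ ≈ f ψ

  ∑ᶜ : (MulChar → Carrier) → Carrier
  ∑ᶜ = sumOver allCharacters

  enumerated : Fin (List.length allCharacters) → MulChar
  enumerated = List.lookup allCharacters

  position : MulChar → Fin (List.length allCharacters)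
  position χ = Any.index (proj₁ (proj₂ characters) χ)

  enumerated-position : ∀ χ → χ ≈ᶜ enumerated (position χ)
  enumerated-position χ = Any.lookup-index (proj₁ (proj₂ characters) χ)

  position-unique : ∀ {χ i} → χ ≈ᶜ enumerated i → position χ ≡ i
  position-unique {χ} {i} e = unique-lookup characterSetoid (proj₂ (proj₂ characters)) _ _
    λ x → trans (sym (enumerated-position χ x)) (e x)

  -- Multiplication by ψ permutes the positions in the enumeration, and multiplication by ψ⁻¹ is the
  -- inverse permutation. Since the list has no repetition up to `_≈ᶜ_`, a character determines its
  -- position.
  ∑ᶜ-shift : ∀ {f} → Congruentᶜ f → ∀ ψ → ∑ᶜ f ≈ ∑ᶜ (λ χ → f (ψ ∙ χ))
  ∑ᶜ-shift {f} f-cong ψ = begin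
    ∑ᶜ f                                             ≈⟨ sumOver-lookup allCharacters f ⟩
    sum (λ i → f (enumerated i))                     ≈⟨ sum-permute (λ i → f (enumerated i)) π ⟩
    sum (λ i → f (enumerated (shift ψ i)))           ≈⟨ sum-cong-≋ (λ i → f-cong (λ x → sym (enumerated-position (ψ ∙ enumerated i) x))) ⟩
    sum (λ i → f (ψ ∙ enumerated i))                 ≈⟨ sumOver-lookup allCharacters (λ χ → f (ψ ∙ χ)) ⟨
    ∑ᶜ (λ χ → f (ψ ∙ χ))                             ∎
    where
    shift : MulChar → Fin (List.length allCharacters) → Fin (List.length allCharacters)
    shift ω i = position (ω ∙ enumerated i)

    shift-inverse : ∀ ω ω′ → ω ∙ ω′ ≈ᶜ ε → ∀ i → shift ω (shift ω′ i) ≡ i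
    shift-inverse ω ω′ e i = position-unique λ x → begin
      ⟦ ω ⟧ x * ⟦ enumerated (shift ω′ i) ⟧ x     ≈⟨ *-congˡ (enumerated-position (ω′ ∙ enumerated i) x) ⟨
      ⟦ ω ⟧ x * (⟦ ω′ ⟧ x * ⟦ enumerated i ⟧ x)   ≈⟨ *-assoc _ _ _ ⟨
      ⟦ ω ⟧ x * ⟦ ω′ ⟧ x * ⟦ enumerated i ⟧ x     ≈⟨ *-congʳ (e x) ⟩
      ⟦ ε ⟧ x * ⟦ enumerated i ⟧ x                ≈⟨ ∙-identityˡ (enumerated i) x ⟩
      ⟦ enumerated i ⟧ x                          ∎

    π : Perm.Permutation (List.length allCharacters) (List.length allCharacters)
    π = Perm.permutation (shift ψ) (shift (ψ ⁻¹))
      (shift-inverse ψ (ψ ⁻¹) (∙-inverseʳ ψ))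
      (shift-inverse (ψ ⁻¹) ψ (λ x → trans (*-comm _ _) (∙-inverseʳ ψ x)))

  ∑ᶜ-single : ∀ {f} → Congruentᶜ f → ∀ ψ → (∀ χ → ¬ (χ ≈ᶜ ψ) → f χ ≈ 0#) → ∑ᶜ f ≈ f ψ
  ∑ᶜ-single {f} f-cong ψ e = begin
    ∑ᶜ f                              ≈⟨ sumOver-lookup allCharacters f ⟩
    sum (λ i → f (enumerated i))      ≈⟨ sum-single (λ i → f (enumerated i)) (position ψ) (λ i i≢ → e (enumerated i) λ χ≈ψ → i≢ (≡.sym (position-unique {ψ} {i} λ x → sym (χ≈ψ x)))) ⟩
    f (enumerated (position ψ))       ≈⟨ f-cong (λ x → sym (enumerated-position ψ x)) ⟩
    f ψ                               ∎

  ∑ᶜ-select : ∀ {f} → Congruentᶜ f → ∀ ψ → ∑ᶜ (λ χ → select (χ ≟ ψ) (f χ)) ≈ f ψ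
  ∑ᶜ-select {f} f-cong ψ = trans
    (∑ᶜ-single {λ χ → select (χ ≟ ψ) (f χ)} congruent ψ (λ χ χ≉ψ → select-no (χ ≟ ψ) χ≉ψ))
    (select-yes (ψ ≟ ψ) λ _ → refl)
    where
    congruent : Congruentᶜ (λ χ → select (χ ≟ ψ) (f χ))
    congruent {χ} {χ′} e with χ ≟ ψ
    ... | yes χ≈ψ = trans (f-cong {χ} {χ′} e) (sym (select-yes (χ′ ≟ ψ) λ x → trans (sym (e x)) (χ≈ψ x)))
    ... | no  χ≉ψ = sym (select-no (χ′ ≟ ψ) λ χ′≈ψ → χ≉ψ λ x → trans (e x) (χ′≈ψ x))

  total : MulChar → Carrier
  total χ = ∑ᶠ ⟦ χ ⟧

  total-cong : Congruentᶜ total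
  total-cong e = ∑ᶠ-cong e

  total-ε : total ε ≈ q · 1# - 1#
  total-ε = +≈⇒≈- (begin
    total ε + 1#                       ≈⟨ +-congʳ (∑ᶠ-cong λ x → *-identityʳ _) ⟨
    ∑ᶠ (λ x → ε⟦ x ⟧ * 1#) + 1#        ≈⟨ ∑ᶠ-ε (λ _ → refl) ⟩
    ∑ᶠ (λ x → 1#)                      ≈⟨ ∑ᶠ-one (λ _ → refl) ⟩
    q · 1#                             ∎)
    where
    +≈⇒≈- : ∀ {a b w} → a + b ≈ w → a ≈ w - b
    +≈⇒≈- {a} {b} e = trans (sym (+-identityʳ a)) (trans (+-congˡ (sym (-‿inverseʳ b))) (trans (sym (+-assoc _ _ _)) (+-congʳ e)))

  total-nontrivial : ∀ χ → ¬ (χ ≈ᶜ ε) → total χ ≈ 0#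
  total-nontrivial χ χ≉ε with trivial-or-witness χ
  ... | inj₁ χ≈ε              = contradiction χ≈ε χ≉ε
  ... | inj₂ (a , a#0 , χa#1) = ∑χ≈0 χ a#0 χa#1

  -- A character ψ with ψ(x) ≠ 1 multiplies the sum by ψ(x) but merely permutes its summands.
  orthogonality-≉1 : ∀ {x} → ¬ (x F.≈ F.1#) → ∑ᶜ (λ χ → ⟦ χ ⟧ x) ≈ 0#
  orthogonality-≉1 {x} x≉1 with F.≈0⊎#0 x
  ... | inj₁ x≈0 = sumOver-zero allCharacters λ χ → character-≈0 χ x≈0
  ... | inj₂ x#0 with ψ , ψx#1 ← separating-character x#0 x≉1 =
    *≈0⇒≈0 (#⇒-#0 ψx#1) (begin
      (⟦ ψ ⟧ x - 1#) * S                  ≈⟨ [y-z]x≈yx-zx _ _ _ ⟩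
      ⟦ ψ ⟧ x * S - 1# * S                ≈⟨ ≈⇒-≈0 (begin
        ⟦ ψ ⟧ x * S                         ≈⟨ sumOver-*ˡ allCharacters _ _ ⟩
        ∑ᶜ (λ χ → ⟦ ψ ∙ χ ⟧ x)              ≈⟨ ∑ᶜ-shift {λ χ → ⟦ χ ⟧ x} (λ e → e x) ψ ⟨
        S                                   ≈⟨ *-identityˡ S ⟨
        1# * S                              ∎) ⟩
      0#                                  ∎)
    where
    S : Carrier
    S = ∑ᶜ (λ χ → ⟦ χ ⟧ x)

  -- The number of characters, found by summing χ(x) over all χ and x in both orders.
  orthogonality-1 : ∑ᶜ (λ χ → ⟦ χ ⟧ F.1#) ≈ q · 1# - 1#
  orthogonality-1 = begin
    ∑ᶜ (λ χ → ⟦ χ ⟧ F.1#)             ≈⟨ ∑ᶠ-single (λ e → sumOver-cong allCharacters λ χ → MulChar.⟦⟧-cong χ e) F.1#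
                                            (λ x x#1 → orthogonality-≉1 (F.#⇒≉ x#1)) ⟨
    ∑ᶠ (λ x → ∑ᶜ (λ χ → ⟦ χ ⟧ x))     ≈⟨ sumOver-∑ᶠ allCharacters ⟦_⟧ ⟨
    ∑ᶜ total                          ≈⟨ ∑ᶜ-single {total} (λ {χ} {ψ} → total-cong {χ} {ψ}) ε total-nontrivial ⟩
    total ε                           ≈⟨ total-ε ⟩
    q · 1# - 1#                       ∎

  character-^ : ∀ χ x i → ⟦ χ ⟧ (x F.^ i) ≈ ⟦ χ ⟧ x ^ i
  character-^ χ x zero    = MulChar.1-homo χ
  character-^ χ x (suc i) = trans (MulChar.*-homo χ _ _) (*-congˡ (character-^ χ x i))

  character-extensionality : ∀ χ ψ → ⟦ χ ⟧ γ ≈ ⟦ ψ ⟧ γ → χ ≈ᶜ ψ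
  character-extensionality χ ψ e x with F.≈0⊎#0 x
  ... | inj₁ x≈0 = trans (character-≈0 χ x≈0) (sym (character-≈0 ψ x≈0))
  ... | inj₂ x#0 with i , x≈ ← logarithm x x#0 = begin
    ⟦ χ ⟧ x                    ≈⟨ MulChar.⟦⟧-cong χ x≈ ⟩
    ⟦ χ ⟧ (γ F.^ Fin.toℕ i)    ≈⟨ character-^ χ γ (Fin.toℕ i) ⟩
    ⟦ χ ⟧ γ ^ Fin.toℕ i        ≈⟨ ^-congˡ (Fin.toℕ i) e ⟩
    ⟦ ψ ⟧ γ ^ Fin.toℕ i        ≈⟨ character-^ ψ γ (Fin.toℕ i) ⟨
    ⟦ ψ ⟧ (γ F.^ Fin.toℕ i)    ≈⟨ MulChar.⟦⟧-cong ψ x≈ ⟨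
    ⟦ ψ ⟧ x                    ∎

  sq : MulChar → MulChar
  sq χ = χ ∙ χ

  ^2≈sq : ∀ χ → χ ^ᶜ 2 ≈ᶜ sq χ
  ^2≈sq χ x = *-congˡ (trans (*-comm _ _) (∙-identityˡ χ x))

  ^4≈sq-sq : ∀ χ → χ ^ᶜ 4 ≈ᶜ sq (sq χ)
  ^4≈sq-sq χ x = trans (*-congˡ (*-congˡ (^2≈sq χ x))) (sym (*-assoc _ _ _))

  -- From χ(γ)² = 1 only ±1 remain, and χ(γ) = 1 would make χ trivial as γ generates. Hence there is
  -- at most one character of order two.
  involutive-character : ∀ χ → sq χ ≈ᶜ ε → ¬ (χ ≈ᶜ ε) → ⟦ χ ⟧ γ ≈ - 1#
  involutive-character χ χ² χ≉ε with character#1? χ γ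
  ... | no ¬p = contradiction (character-extensionality χ ε (trans (root-¬#1 ¬p) (sym (ε-#0 γ#0)))) χ≉ε
  ... | yes χγ#1 = -≈0⇒≈ (trans (+-congˡ (-‿involutive 1#)) (*≈0⇒≈0 (#⇒-#0 χγ#1) (begin
    (⟦ χ ⟧ γ - 1#) * (⟦ χ ⟧ γ + 1#)   ≈⟨ RingFacts.x²-y²≈[x-y][x+y] commutativeRing _ _ ⟨
    ⟦ χ ⟧ γ * ⟦ χ ⟧ γ - 1# * 1#       ≈⟨ ≈⇒-≈0 (trans (χ² γ) (trans (ε-#0 γ#0) (sym (*-identityˡ 1#)))) ⟩
    0#                                ∎)))

  ≉⇒# : ∀ {x y} → ¬ (x F.≈ y) → x F.# y
  ≉⇒# {x} {y} x≉y with F.≈0⊎#0 (x F.- y)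
  ... | inj₁ e = contradiction (F.-≈0⇒≈ e) x≉y
  ... | inj₂ d = F.-#0⇒# d

  ≈⊎# : ∀ x y → x F.≈ y ⊎ x F.# y
  ≈⊎# x y with F.≈0⊎#0 (x F.- y)
  ... | inj₁ e = inj₁ (F.-≈0⇒≈ e)
  ... | inj₂ d = inj₂ (F.-#0⇒# d)

  -- Kronecker's delta, written through the trivial character so that it inherits congruence from
  -- `ε-cong`.
  δ : F.Carrier → F.Carrier → Carrier
  δ y x = 1# - ε⟦ x F.- y ⟧

  δ-cong : ∀ {x x′ y y′} → y F.≈ y′ → x F.≈ x′ → δ y x ≈ δ y′ x′
  δ-cong ey ex = +-congˡ (-‿cong (ε-cong (F.+-cong ex (F.-‿cong ey))))

  δ-≈ : ∀ {x y} → x F.≈ y → δ y x ≈ 1#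
  δ-≈ e = trans (+-congˡ (-‿cong (ε-≈0 (F.≈⇒-≈0 e)))) (x-0≈x 1#)

  δ-# : ∀ {x y} → x F.# y → δ y x ≈ 0#
  δ-# d = ≈⇒-≈0 (sym (ε-#0 (F.#⇒-#0 d)))

  ∑ᶠ-δ : ∀ {f} → Congruent f → ∀ y → ∑ᶠ (λ x → δ y x * f x) ≈ f y
  ∑ᶠ-δ f-cong y = trans
    (∑ᶠ-single (λ e → *-cong (δ-cong F.refl e) (f-cong e)) y (λ x x#y → trans (*-congʳ (δ-# x#y)) (zeroˡ _)))
    (trans (*-congʳ (δ-≈ F.refl)) (*-identityˡ _))

  ∑ᶠ-δ-1 : ∀ y → ∑ᶠ (δ y) ≈ 1#
  ∑ᶠ-δ-1 y = trans (∑ᶠ-cong λ x → sym (*-identityʳ _)) (∑ᶠ-δ (λ _ → refl) y)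

  -- The quadratic character and square roots.

  module Quadratic (φ : MulChar) (φ-order-two : HasOrderTwo φ) where

    φ² : sq φ ≈ᶜ ε
    φ² x = trans (sym (^2≈sq φ x)) (proj₁ φ-order-two x)

    φ≉ε : ¬ (φ ≈ᶜ ε)
    φ≉ε = proj₂ φ-order-two

    φγ≈-1 : ⟦ φ ⟧ γ ≈ - 1#
    φγ≈-1 = involutive-character φ φ² φ≉ε

    sq≈ε⇒≈ε⊎≈φ : ∀ χ → sq χ ≈ᶜ ε → χ ≈ᶜ ε ⊎ χ ≈ᶜ φ
    sq≈ε⇒≈ε⊎≈φ χ χ² with χ ≟ ε
    ... | yes χ≈ε = inj₁ χ≈ε
    ... | no  χ≉ε = inj₂ (character-extensionality χ φ (trans (involutive-character χ χ² χ≉ε) (sym φγ≈-1)))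

    φ-square : ∀ {x} → x F.# F.0# → ⟦ φ ⟧ (x F.* x) ≈ 1#
    φ-square {x} x#0 = trans (MulChar.*-homo φ x x) (trans (φ² x) (ε-#0 x#0))

    -1≉1 : ¬ (- 1# ≈ 1#)
    -1≉1 e = #⇒≉ (characteristicZero 1) (begin
      1# + (1# + 0#) ≈⟨ +-congˡ (+-identityʳ 1#) ⟩
      1# + 1#        ≈⟨ +-congˡ e ⟨
      1# - 1#        ≈⟨ -‿inverseʳ 1# ⟩
      0#             ∎)

    φ-γ-odd : ∀ {n} k → n ≡ suc (k ℕ.+ k) → ⟦ φ ⟧ (γ F.^ n) ≈ - 1#
    φ-γ-odd k ≡.refl = begin
      ⟦ φ ⟧ (γ F.* γ F.^ (k ℕ.+ k))                ≈⟨ MulChar.*-homo φ _ _ ⟩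
      ⟦ φ ⟧ γ * ⟦ φ ⟧ (γ F.^ (k ℕ.+ k))            ≈⟨ *-cong φγ≈-1 (MulChar.⟦⟧-cong φ (F.^-homo-* γ k k)) ⟩
      - 1# * ⟦ φ ⟧ (γ F.^ k F.* γ F.^ k)           ≈⟨ *-congˡ (φ-square (F.^#0 k γ#0)) ⟩
      - 1# * 1#                                    ≈⟨ *-identityʳ (- 1#) ⟩
      - 1#                                         ∎

    -- The order of γ is even, as φ(γ) = -1; hence its half power is a square root of 1
    -- other than 1.
    ∃-nontrivial-root : ∃[ w ] (w F.* w F.≈ F.1# × w F.# F.1#)
    ∃-nontrivial-root with even⊎odd order
    ... | k , inj₂ odd = contradiction (begin
      - 1#                 ≈⟨ φ-γ-odd k odd ⟨
      ⟦ φ ⟧ (γ F.^ order)  ≈⟨ MulChar.⟦⟧-cong φ (proj₁ γ-order) ⟩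
      ⟦ φ ⟧ F.1#           ≈⟨ MulChar.1-homo φ ⟩
      1#                   ∎) -1≉1
    ... | zero , inj₁ even = contradiction even (ℕ.≢-nonZero⁻¹ order {{order≢0}})
    ... | k@(suc l) , inj₁ even = γ F.^ k ,
      F.trans (F.sym (F.^-homo-* γ k k)) (F.trans (F.^-congʳ γ (≡.sym even)) (proj₁ γ-order)) ,
      ≉⇒# λ e → G.order-distinct γ-order {{order≢0}} {0} {k} ℕ.z<s
        (≡.subst (k ℕ.<_) (≡.sym even) (ℕ.m<m+n k ℕ.z<s)) (F.sym e)
      where module G = FiniteFieldGenerator 𝔽

    -- From w² = 1 and w apart from 1 it follows that w = -1, so -1 inherits the apartness from 1.
    -1#1 : (F.- F.1#) F.# F.1#
    -1#1 with w , w² , w#1 ← ∃-nontrivial-root = F.#-congʳ (F.-≈0⇒≈ (F.trans (F.+-congˡ (F.-‿involutive F.1#))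
      (F.*≈0⇒≈0 (F.#⇒-#0 w#1) (F.trans (F.sym (RingFacts.x²-y²≈[x-y][x+y] F.commutativeRing w F.1#))
        (F.≈⇒-≈0 (F.trans w² (F.sym (F.*-identityˡ F.1#)))))))) w#1

    2#0 : (F.1# F.+ F.1#) F.# F.0#
    2#0 = F.#0-resp (F.+-congˡ (F.-‿involutive F.1#)) (F.#⇒-#0 (F.#-sym -1#1))

    #⇒square# : ∀ {u w} → u F.# w → u F.# (F.- w) → (u F.* u) F.# (w F.* w)
    #⇒square# {u} {w} u#w u#-w = F.-#0⇒# (F.#0-resp (F.sym (RingFacts.x²-y²≈[x-y][x+y] F.commutativeRing u w))
      (F.x#0y#0→xy#0 (F.#⇒-#0 u#w) (F.#0-resp (F.+-congˡ (F.-‿involutive w)) (F.#⇒-#0 u#-w))))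

    #0⇒#- : ∀ {w} → w F.# F.0# → w F.# (F.- w)
    #0⇒#- {w} w#0 = F.-#0⇒# (F.#0-resp (F.trans (F.distribʳ w F.1# F.1#)
      (F.+-cong (F.*-identityˡ w) (F.trans (F.*-identityˡ w) (F.sym (F.-‿involutive w))))) (F.x#0y#0→xy#0 2#0 w#0))

    -- The roots w and -w of v are apart because 2 and w are nonzero, so at most one delta on the
    -- right is 1.
    δ-square : ∀ {v w} → w F.# F.0# → v F.≈ w F.* w → ∀ u → δ (u F.* u) v ≈ δ w u + δ (F.- w) u
    δ-square {v} {w} w#0 v≈ u with ≈⊎# u w | ≈⊎# u (F.- w)
    ... | inj₁ u≈w | _ = trans (δ-≈ (F.trans v≈ (F.*-cong (F.sym u≈w) (F.sym u≈w))))
      (sym (trans (+-cong (δ-≈ u≈w) (δ-# (F.#-congʳ (F.sym u≈w) (#0⇒#- w#0)))) (+-identityʳ 1#)))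
    ... | inj₂ u#w | inj₁ u≈-w = trans (δ-≈ (F.trans v≈ (F.trans (F.sym (RingFacts.-x*-x≈x*x F.commutativeRing w)) (F.*-cong (F.sym u≈-w) (F.sym u≈-w)))))
      (sym (trans (+-cong (δ-# u#w) (δ-≈ u≈-w)) (+-identityˡ 1#)))
    ... | inj₂ u#w | inj₂ u#-w = trans (δ-# (F.#-congʳ (F.sym v≈) (F.#-sym (#⇒square# u#w u#-w))))
      (sym (trans (+-cong (δ-# u#w) (δ-# u#-w)) (+-identityʳ 0#)))

    -- For v ≠ 0 the parity of the logarithm decides. An even power of γ has two roots ±w and φ(v) =
    -- 1; an odd one has φ(v) = -1, whereas φ is 1 on nonzero squares.
    square-root-count : ∀ v → ∑ᶠ (λ u → δ (u F.* u) v) ≈ 1# + ⟦ φ ⟧ v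
    square-root-count v with F.≈0⊎#0 v
    ... | inj₁ v≈0 = begin
      ∑ᶠ (λ u → δ (u F.* u) v)   ≈⟨ ∑ᶠ-single (λ e → δ-cong (F.*-cong e e) F.refl) F.0#
                                       (λ u u#0 → δ-# (F.#-congʳ (F.sym v≈0) (F.#-sym (F.x#0y#0→xy#0 u#0 u#0)))) ⟩
      δ (F.0# F.* F.0#) v        ≈⟨ δ-≈ (F.trans v≈0 (F.sym (F.zeroˡ F.0#))) ⟩
      1#                         ≈⟨ +-identityʳ 1# ⟨
      1# + 0#                    ≈⟨ +-congˡ (character-≈0 φ v≈0) ⟨
      1# + ⟦ φ ⟧ v               ∎
    ... | inj₂ v#0 with i , v≈ ← logarithm v v#0 with even⊎odd (Fin.toℕ i)
    ...   | k , inj₁ even = begin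
      ∑ᶠ (λ u → δ (u F.* u) v)             ≈⟨ ∑ᶠ-cong (δ-square w#0 v≈w²) ⟩
      ∑ᶠ (λ u → δ w u + δ (F.- w) u)       ≈⟨ ∑ᶠ-+ _ _ ⟩
      ∑ᶠ (δ w) + ∑ᶠ (δ (F.- w))            ≈⟨ +-cong (∑ᶠ-δ-1 w) (∑ᶠ-δ-1 (F.- w)) ⟩
      1# + 1#                              ≈⟨ +-congˡ (trans (MulChar.⟦⟧-cong φ v≈w²) (φ-square w#0)) ⟨
      1# + ⟦ φ ⟧ v                         ∎
      where
      w : F.Carrier
      w = γ F.^ k
      w#0 : w F.# F.0#
      w#0 = F.^#0 k γ#0
      v≈w² : v F.≈ w F.* w
      v≈w² = F.trans v≈ (F.trans (F.^-congʳ γ even) (F.^-homo-* γ k k))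
    ...   | k , inj₂ odd = begin
      ∑ᶠ (λ u → δ (u F.* u) v)             ≈⟨ ∑ᶠ-zero (λ u → δ-# (v#u² u)) ⟩
      0#                                   ≈⟨ -‿inverseʳ 1# ⟨
      1# - 1#                              ≈⟨ +-congˡ φv≈-1 ⟨
      1# + ⟦ φ ⟧ v                         ∎
      where
      φv≈-1 : ⟦ φ ⟧ v ≈ - 1#
      φv≈-1 = trans (MulChar.⟦⟧-cong φ v≈) (φ-γ-odd k odd)
      v#u² : ∀ u → v F.# (u F.* u)
      v#u² u with F.≈0⊎#0 u
      ... | inj₁ u≈0 = F.#-congˡ (F.sym (F.trans (F.*-congʳ u≈0) (F.zeroˡ u))) v#0
      ... | inj₂ u#0 = ≉⇒# λ e → -1≉1 (trans (sym φv≈-1) (trans (MulChar.⟦⟧-cong φ e) (φ-square u#0)))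

    -- Sorts the elements u by their square v. This is how φ enters the sums over 𝔽.
    ∑ᶠ-square : ∀ {f} → Congruent f → ∑ᶠ (λ u → f (u F.* u)) ≈ ∑ᶠ (λ v → (1# + ⟦ φ ⟧ v) * f v)
    ∑ᶠ-square {f} f-cong = begin
      ∑ᶠ (λ u → f (u F.* u))                            ≈⟨ ∑ᶠ-cong (λ u → ∑ᶠ-δ f-cong (u F.* u)) ⟨
      ∑ᶠ (λ u → ∑ᶠ (λ v → δ (u F.* u) v * f v))         ≈⟨ ∑ᶠ-comm _ ⟩
      ∑ᶠ (λ v → ∑ᶠ (λ u → δ (u F.* u) v * f v))         ≈⟨ ∑ᶠ-cong (λ v → trans (sym (∑ᶠ-*ʳ (f v) _)) (*-congʳ (square-root-count v))) ⟩
      ∑ᶠ (λ v → (1# + ⟦ φ ⟧ v) * f v)                   ∎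

    ∙⁻¹∙-cancel : ∀ χ ψ → χ ∙ ψ ⁻¹ ∙ ψ ≈ᶜ χ
    ∙⁻¹∙-cancel χ ψ x = trans (*-assoc _ _ _) (trans (*-congˡ (trans (*-comm _ _) (∙-inverseʳ ψ x))) (trans (*-comm _ _) (∙-identityˡ χ x)))

    -- The character χA⁻¹ has trivial square and so is ε or φ.
    square-roots : ∀ χ A → sq χ ≈ᶜ sq A → χ ≈ᶜ A ⊎ χ ≈ᶜ φ ∙ A
    square-roots χ A e with sq≈ε⇒≈ε⊎≈φ (χ ∙ A ⁻¹)
      (λ x → trans ([ab][cd]≈[ac][bd] _ _ _ _) (trans (*-congʳ (e x)) (∙-inverseʳ (sq A) x)))
    ... | inj₁ χA⁻¹≈ε = inj₁ λ x → trans (sym (∙⁻¹∙-cancel χ A x)) (trans (*-congʳ (χA⁻¹≈ε x)) (∙-identityˡ A x))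
    ... | inj₂ χA⁻¹≈φ = inj₂ λ x → trans (sym (∙⁻¹∙-cancel χ A x)) (*-congʳ (χA⁻¹≈φ x))

    sq-φ∙ : ∀ A → sq (φ ∙ A) ≈ᶜ sq A
    sq-φ∙ A x = trans ([ab][cd]≈[ac][bd] _ _ _ _) (trans (*-congʳ (φ² x)) (∙-identityˡ (sq A) x))

    φ∙A≉A : ∀ A → ¬ (φ ∙ A ≈ᶜ A)
    φ∙A≉A A e = φ≉ε λ x → trans (sym (trans (*-congˡ (∙-inverseʳ A x)) (trans (*-comm _ _) (∙-identityˡ φ x))))
      (trans (sym (*-assoc _ _ _)) (trans (*-congʳ (e x)) (∙-inverseʳ A x)))

    sumOver-squareRoots : ∀ {f} → Congruentᶜ f → ∀ A → sumOver (squareRoots (A ^ᶜ 2)) f ≈ f A + f (φ ∙ A)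
    sumOver-squareRoots {f} f-cong A = begin
      sumOver (squareRoots (A ^ᶜ 2)) f
        ≈⟨ sumOver-filter (λ R → R ^ᶜ 2 ≟ A ^ᶜ 2) allCharacters f ⟩
      ∑ᶜ (λ χ → select (χ ^ᶜ 2 ≟ A ^ᶜ 2) (f χ))
        ≈⟨ sumOver-cong allCharacters split ⟩
      ∑ᶜ (λ χ → select (χ ≟ A) (f χ) + select (χ ≟ φ ∙ A) (f χ))
        ≈⟨ sumOver-+ allCharacters _ _ ⟩
      ∑ᶜ (λ χ → select (χ ≟ A) (f χ)) + ∑ᶜ (λ χ → select (χ ≟ φ ∙ A) (f χ))
        ≈⟨ +-cong (∑ᶜ-select {f} f-cong A) (∑ᶜ-select {f} f-cong (φ ∙ A)) ⟩
      f A + f (φ ∙ A) ∎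
      where
      square : ∀ χ → sq χ ≈ᶜ sq A → χ ^ᶜ 2 ≈ᶜ A ^ᶜ 2
      square χ e x = trans (^2≈sq χ x) (trans (e x) (sym (^2≈sq A x)))

      split : ∀ χ → select (χ ^ᶜ 2 ≟ A ^ᶜ 2) (f χ) ≈ select (χ ≟ A) (f χ) + select (χ ≟ φ ∙ A) (f χ)
      split χ with χ ≟ A | χ ≟ φ ∙ A
      ... | yes χ≈A | yes χ≈φA = contradiction (λ x → trans (sym (χ≈φA x)) (χ≈A x)) (φ∙A≉A A)
      ... | yes χ≈A | no  _    = trans (select-yes (χ ^ᶜ 2 ≟ A ^ᶜ 2) (square χ λ x → *-cong (χ≈A x) (χ≈A x))) (sym (+-identityʳ _))
      ... | no  _   | yes χ≈φA = trans (select-yes (χ ^ᶜ 2 ≟ A ^ᶜ 2) (square χ λ x → trans (*-cong (χ≈φA x) (χ≈φA x)) (sq-φ∙ A x))) (sym (+-identityˡ _))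
      ... | no  χ≉A | no  χ≉φA = trans (select-no (χ ^ᶜ 2 ≟ A ^ᶜ 2) λ e → neither
          (square-roots χ A λ x → trans (sym (^2≈sq χ x)) (trans (e x) (^2≈sq A x)))) (sym (+-identityʳ 0#))
        where
        neither : ¬ (χ ≈ᶜ A ⊎ χ ≈ᶜ φ ∙ A)
        neither (inj₁ e) = χ≉A e
        neither (inj₂ e) = χ≉φA e

-- Identities in the finite field.

module FieldFacts (𝔽 : FiniteField c ℓ₁ ℓ₂) where

  open FiniteFieldTheory 𝔽

  inv-involutive : ∀ x → inv (inv x) ≈ x
  inv-involutive x with ≈0⊎#0 x
  ... | inj₁ x≈0 = trans (inv-≈0 (inv-≈0 x≈0)) (sym x≈0)
  ... | inj₂ x#0 = sym (inv-unique (inv-#0 x#0) (trans (*-comm _ _) (inv-inverseʳ x#0)))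

  x-[x-y]≈y : ∀ x y → x - (x - y) ≈ y
  x-[x-y]≈y x y = trans (+-congˡ (trans (sym (-‿+-comm x (- y))) (+-congˡ (-‿involutive y))))
    (trans (sym (+-assoc _ _ _)) (trans (+-congʳ (-‿inverseʳ x)) (+-identityˡ y)))

  x+y≈z⇒x≈z-y : ∀ {x y z} → x + y ≈ z → x ≈ z - y
  x+y≈z⇒x≈z-y {x} {y} e = trans (sym (+-identityʳ x)) (trans (+-congˡ (sym (-‿inverseʳ y)))
    (trans (sym (+-assoc x y (- y))) (+-congʳ e)))

  [x+y]+[x-y]≈x+x : ∀ x y → (x + y) + (x - y) ≈ x + x
  [x+y]+[x-y]≈x+x x y = trans (+-assoc x y _) (+-congˡ (trans (+-congˡ (+-comm x (- y)))
    (trans (sym (+-assoc y (- y) x)) (trans (+-congʳ (-‿inverseʳ y)) (+-identityˡ x)))))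

-- Twisted Gauss sums and Jacobi sums.

module GaussSums (𝔽 : FiniteField c ℓ₁ ℓ₂) (ℂ : AlgebraicallyClosedField₀ k κ₁ κ₂)
                 (θ : Characters.NontrivialAddChar 𝔽 ℂ) where

  open Characters 𝔽 ℂ
  open AlgebraicallyClosedField₀ ℂ
  open K hiding (_≈_; _+_; _*_)
  open SetoidReasoning setoid
  open CharacterSums 𝔽 ℂ
  open FieldFacts 𝔽
  open F using (q)
  open SemiringSolver commutativeSemiring using (solve; _:=_; _:+_; _:*_)
  private module θ = NontrivialAddChar θ

  g : MulChar → Carrier
  g = gauss θ

  -- The T(χ, s) of the overview.
  twisted : MulChar → F.Carrier → Carrier
  twisted χ s = ∑ᶠ (λ x → ⟦ χ ⟧ x * ⟨ θ ⟩ (x F.* s))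

  twisted-cong : ∀ {χ ψ s t} → χ ≈ᶜ ψ → s F.≈ t → twisted χ s ≈ twisted ψ t
  twisted-cong e s≈t = ∑ᶠ-cong λ x → *-cong (e x) (θ.⟦⟧-cong (F.*-congˡ s≈t))

  twisted-0 : ∀ χ {s} → s F.≈ F.0# → twisted χ s ≈ total χ
  twisted-0 χ s≈0 = ∑ᶠ-cong λ x → trans
    (*-congˡ (trans (θ.⟦⟧-cong (F.trans (F.*-congˡ s≈0) (F.zeroʳ x))) θ.0-homo)) (*-identityʳ _)

  twisted-1 : ∀ χ → twisted χ F.1# ≈ g χ
  twisted-1 χ = ∑ᶠ-cong λ x → *-congˡ (θ.⟦⟧-cong (F.*-identityʳ x))

  twisted-scale : ∀ χ {s} → s F.# F.0# → ∀ t → ⟦ χ ⟧ s * twisted χ (s F.* t) ≈ twisted χ t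
  twisted-scale χ {s} s#0 t = begin
    ⟦ χ ⟧ s * twisted χ (s F.* t)                                ≈⟨ ∑ᶠ-*ˡ _ _ ⟩
    ∑ᶠ (λ x → ⟦ χ ⟧ s * (⟦ χ ⟧ x * ⟨ θ ⟩ (x F.* (s F.* t))))      ≈⟨ ∑ᶠ-cong (λ x → trans (sym (*-assoc _ _ _)) (*-cong
                                                                      (sym (MulChar.*-homo χ s x))
                                                                      (θ.⟦⟧-cong (F.trans (F.sym (F.*-assoc x s t)) (F.*-congʳ (F.*-comm x s)))))) ⟩
    ∑ᶠ (λ x → ⟦ χ ⟧ (s F.* x) * ⟨ θ ⟩ (s F.* x F.* t))           ≈⟨ ∑ᶠ-bijection (λ e → *-cong (MulChar.⟦⟧-cong χ e) (θ.⟦⟧-cong (F.*-congʳ e))) (scaling s#0) ⟨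
    twisted χ t                                                  ∎

  -- At s = 0 the additive character disappears and the sum is `total χ`, while χ̄(0) = 0. The
  -- correction is kept for the case χ = ε, where `total χ` is q - 1.
  twisted-gauss : ∀ χ s → twisted χ s ≈ ⟦ χ ⁻¹ ⟧ s * g χ + δ F.0# s * total χ
  twisted-gauss χ s with F.≈0⊎#0 s
  ... | inj₁ s≈0 = trans (twisted-0 χ s≈0) (sym (trans (+-cong
    (trans (*-congʳ (character-≈0 (χ ⁻¹) s≈0)) (zeroˡ _)) (trans (*-congʳ (δ-≈ s≈0)) (*-identityˡ _))) (+-identityˡ _)))
  ... | inj₂ s#0 = begin
    twisted χ s                                          ≈⟨ *-identityˡ _ ⟨
    1# * twisted χ s                                     ≈⟨ *-congʳ (trans (*-comm _ _) (character-inv χ s#0)) ⟨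
    (⟦ χ ⁻¹ ⟧ s * ⟦ χ ⟧ s) * twisted χ s                 ≈⟨ *-assoc _ _ _ ⟩
    ⟦ χ ⁻¹ ⟧ s * (⟦ χ ⟧ s * twisted χ s)                 ≈⟨ *-congˡ (*-congˡ (twisted-cong {χ} {χ} (λ _ → refl) (F.*-identityʳ s))) ⟨
    ⟦ χ ⁻¹ ⟧ s * (⟦ χ ⟧ s * twisted χ (s F.* F.1#))      ≈⟨ *-congˡ (trans (twisted-scale χ s#0 F.1#) (twisted-1 χ)) ⟩
    ⟦ χ ⁻¹ ⟧ s * g χ                                     ≈⟨ +-identityʳ _ ⟨
    ⟦ χ ⁻¹ ⟧ s * g χ + 0#                                ≈⟨ +-congˡ (trans (*-congʳ (δ-# s#0)) (zeroˡ _)) ⟨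
    ⟦ χ ⁻¹ ⟧ s * g χ + δ F.0# s * total χ                ∎

  twisted-nontrivial : ∀ χ → ¬ (χ ≈ᶜ ε) → ∀ s → twisted χ s ≈ ⟦ χ ⁻¹ ⟧ s * g χ
  twisted-nontrivial χ χ≉ε s = trans (twisted-gauss χ s)
    (trans (+-congˡ (trans (*-congˡ (total-nontrivial χ χ≉ε)) (zeroʳ _))) (+-identityʳ _))

  -- For fixed y ≠ 0 the variable of g(χ) is replaced by ty; then θ(ty) θ(y) = θ(y(t + 1)), and the
  -- sum over y becomes a twisted sum. The product character is a parameter ω, so that it can be
  -- named in its simplest form.
  gauss-*-gauss : ∀ {χ ψ ω} → χ ∙ ψ ≈ᶜ ω → g χ * g ψ ≈ ∑ᶠ (λ t → ⟦ χ ⟧ t * twisted ω (t F.+ F.1#))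
  gauss-*-gauss {χ} {ψ} {ω} χψ≈ω = begin
    g χ * g ψ                                                                 ≈⟨ ∑ᶠ-*ˡ _ _ ⟩
    ∑ᶠ (λ y → g χ * (⟦ ψ ⟧ y * ⟨ θ ⟩ y))                                      ≈⟨ ∑ᶠ-cong summand ⟩
    ∑ᶠ (λ y → ∑ᶠ (λ t → ⟦ χ ⟧ t * (⟦ ω ⟧ y * ⟨ θ ⟩ (y F.* (t F.+ F.1#)))))    ≈⟨ ∑ᶠ-comm _ ⟩
    ∑ᶠ (λ t → ∑ᶠ (λ y → ⟦ χ ⟧ t * (⟦ ω ⟧ y * ⟨ θ ⟩ (y F.* (t F.+ F.1#)))))    ≈⟨ ∑ᶠ-cong (λ t → ∑ᶠ-*ˡ _ _) ⟨
    ∑ᶠ (λ t → ⟦ χ ⟧ t * twisted ω (t F.+ F.1#))                               ∎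
    where
    summand : ∀ y → g χ * (⟦ ψ ⟧ y * ⟨ θ ⟩ y) ≈ ∑ᶠ (λ t → ⟦ χ ⟧ t * (⟦ ω ⟧ y * ⟨ θ ⟩ (y F.* (t F.+ F.1#))))
    summand y with F.≈0⊎#0 y
    ... | inj₁ y≈0 = trans
      (trans (*-congˡ (trans (*-congʳ (character-≈0 ψ y≈0)) (zeroˡ _))) (zeroʳ _))
      (sym (∑ᶠ-zero λ t → trans (*-congˡ (trans (*-congʳ (character-≈0 ω y≈0)) (zeroˡ _))) (zeroʳ _)))
    ... | inj₂ y#0 = begin
      g χ * (⟦ ψ ⟧ y * ⟨ θ ⟩ y)                                              ≈⟨ *-congʳ (trans (twisted-scale χ y#0 F.1#) (twisted-1 χ)) ⟨
      ⟦ χ ⟧ y * twisted χ (y F.* F.1#) * (⟦ ψ ⟧ y * ⟨ θ ⟩ y)                 ≈⟨ *-congʳ (*-congˡ (twisted-cong {χ} {χ} (λ _ → refl) (F.*-identityʳ y))) ⟩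
      ⟦ χ ⟧ y * twisted χ y * (⟦ ψ ⟧ y * ⟨ θ ⟩ y)                            ≈⟨ solve 4 (λ a b c d → a :* b :* (c :* d) := b :* (a :* c :* d)) refl _ _ _ _ ⟩
      twisted χ y * (⟦ χ ⟧ y * ⟦ ψ ⟧ y * ⟨ θ ⟩ y)                            ≈⟨ *-congˡ (*-congʳ (χψ≈ω y)) ⟩
      twisted χ y * (⟦ ω ⟧ y * ⟨ θ ⟩ y)                                      ≈⟨ ∑ᶠ-*ʳ _ _ ⟩
      ∑ᶠ (λ t → ⟦ χ ⟧ t * ⟨ θ ⟩ (t F.* y) * (⟦ ω ⟧ y * ⟨ θ ⟩ y))             ≈⟨ ∑ᶠ-cong (λ t → trans
                                                                                  (solve 4 (λ a b c d → a :* b :* (c :* d) := a :* (c :* (b :* d))) refl _ _ _ _)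
                                                                                  (*-congˡ (*-congˡ (trans (sym (θ.+-homo _ _)) (θ.⟦⟧-cong (combine t)))))) ⟩
      ∑ᶠ (λ t → ⟦ χ ⟧ t * (⟦ ω ⟧ y * ⟨ θ ⟩ (y F.* (t F.+ F.1#))))            ∎
      where
      combine : ∀ t → t F.* y F.+ y F.≈ y F.* (t F.+ F.1#)
      combine t = F.trans (F.+-cong (F.*-comm t y) (F.sym (F.*-identityʳ y))) (F.sym (F.distribˡ y t F.1#))

  jacobi : MulChar → MulChar → Carrier
  jacobi χ ψ = ∑ᶠ (λ x → ⟦ χ ⟧ x * ⟦ ψ ⟧ (F.1# F.- x))

  -- For s ≠ 0 replace x by sx. For s = 0 the summand is ψ(-1) (χψ)(x), which gives the correction.
  jacobi-convolution : ∀ χ ψ s → ∑ᶠ (λ x → ⟦ χ ⟧ x * ⟦ ψ ⟧ (s F.- x)) ≈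
                       ⟦ χ ∙ ψ ⟧ s * jacobi χ ψ + δ F.0# s * (⟦ ψ ⟧ (F.- F.1#) * total (χ ∙ ψ))
  jacobi-convolution χ ψ s with F.≈0⊎#0 s
  ... | inj₁ s≈0 = begin
    ∑ᶠ (λ x → ⟦ χ ⟧ x * ⟦ ψ ⟧ (s F.- x))                    ≈⟨ ∑ᶠ-cong (λ x → trans (*-congˡ (ψ-neg x))
                                                                  (solve 3 (λ a b c → a :* (b :* c) := b :* (a :* c)) refl _ _ _)) ⟩
    ∑ᶠ (λ x → ⟦ ψ ⟧ (F.- F.1#) * ⟦ χ ∙ ψ ⟧ x)               ≈⟨ ∑ᶠ-*ˡ _ _ ⟨
    ⟦ ψ ⟧ (F.- F.1#) * total (χ ∙ ψ)                        ≈⟨ trans (*-congʳ (δ-≈ s≈0)) (*-identityˡ _) ⟨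
    δ F.0# s * (⟦ ψ ⟧ (F.- F.1#) * total (χ ∙ ψ))           ≈⟨ trans (+-congʳ (trans (*-congʳ (character-≈0 (χ ∙ ψ) s≈0)) (zeroˡ _))) (+-identityˡ _) ⟨
    ⟦ χ ∙ ψ ⟧ s * jacobi χ ψ + δ F.0# s * (⟦ ψ ⟧ (F.- F.1#) * total (χ ∙ ψ)) ∎
    where
    ψ-neg : ∀ x → ⟦ ψ ⟧ (s F.- x) ≈ ⟦ ψ ⟧ (F.- F.1#) * ⟦ ψ ⟧ x
    ψ-neg x = trans (MulChar.⟦⟧-cong ψ (F.trans (F.+-congʳ s≈0) (F.trans (F.+-identityˡ _) (F.sym (F.-1*x≈-x x))))) (MulChar.*-homo ψ _ x)
  ... | inj₂ s#0 = begin
    ∑ᶠ (λ x → ⟦ χ ⟧ x * ⟦ ψ ⟧ (s F.- x))                    ≈⟨ ∑ᶠ-bijection (λ e → *-cong (MulChar.⟦⟧-cong χ e) (MulChar.⟦⟧-cong ψ (F.+-congˡ (F.-‿cong e)))) (scaling s#0) ⟩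
    ∑ᶠ (λ x → ⟦ χ ⟧ (s F.* x) * ⟦ ψ ⟧ (s F.- s F.* x))      ≈⟨ ∑ᶠ-cong (λ x → trans
                                                                  (*-cong (MulChar.*-homo χ s x) (trans (MulChar.⟦⟧-cong ψ (factor x)) (MulChar.*-homo ψ s _)))
                                                                  ([ab][cd]≈[ac][bd] _ _ _ _)) ⟩
    ∑ᶠ (λ x → ⟦ χ ∙ ψ ⟧ s * (⟦ χ ⟧ x * ⟦ ψ ⟧ (F.1# F.- x))) ≈⟨ ∑ᶠ-*ˡ _ _ ⟨
    ⟦ χ ∙ ψ ⟧ s * jacobi χ ψ                                ≈⟨ trans (+-congˡ (trans (*-congʳ (δ-# s#0)) (zeroˡ _))) (+-identityʳ _) ⟨
    ⟦ χ ∙ ψ ⟧ s * jacobi χ ψ + δ F.0# s * (⟦ ψ ⟧ (F.- F.1#) * total (χ ∙ ψ)) ∎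
    where
    factor : ∀ x → s F.- s F.* x F.≈ s F.* (F.1# F.- x)
    factor x = F.sym (F.trans (F.distribˡ s F.1# (F.- x)) (F.+-cong (F.*-identityʳ s) (F.sym (F.-‿distribʳ-* s x))))

  -- Sorts the double sum by s = x + y. The fibre over s = 0 contributes the last term, which
  -- survives only for χψ = ε; Kummer's sum meets this case when ĀB² is ε or φ.
  gauss-*-gauss-jacobi : ∀ χ ψ → g χ * g ψ ≈ jacobi χ ψ * g (χ ∙ ψ) + ⟦ ψ ⟧ (F.- F.1#) * total (χ ∙ ψ)
  gauss-*-gauss-jacobi χ ψ = begin
    g χ * g ψ                                                                    ≈⟨ ∑ᶠ-*ʳ _ _ ⟩
    ∑ᶠ (λ x → ⟦ χ ⟧ x * ⟨ θ ⟩ x * g ψ)                                           ≈⟨ ∑ᶠ-cong inner ⟩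
    ∑ᶠ (λ x → ∑ᶠ (λ s → ⟦ χ ⟧ x * ⟦ ψ ⟧ (s F.- x) * ⟨ θ ⟩ s))                    ≈⟨ ∑ᶠ-comm _ ⟩
    ∑ᶠ (λ s → ∑ᶠ (λ x → ⟦ χ ⟧ x * ⟦ ψ ⟧ (s F.- x) * ⟨ θ ⟩ s))                    ≈⟨ ∑ᶠ-cong (λ s → trans (sym (∑ᶠ-*ʳ _ _)) (trans (*-congʳ (jacobi-convolution χ ψ s))
                                                                                      (solve 5 (λ a b c d e → (a :* b :+ c :* d) :* e := b :* (a :* e) :+ c :* (d :* e)) refl _ _ _ _ _))) ⟩
    ∑ᶠ (λ s → J * (⟦ χ ∙ ψ ⟧ s * ⟨ θ ⟩ s) + δ F.0# s * (D * ⟨ θ ⟩ s))            ≈⟨ ∑ᶠ-+ _ _ ⟩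
    ∑ᶠ (λ s → J * (⟦ χ ∙ ψ ⟧ s * ⟨ θ ⟩ s)) + ∑ᶠ (λ s → δ F.0# s * (D * ⟨ θ ⟩ s)) ≈⟨ +-cong (sym (∑ᶠ-*ˡ _ _)) (∑ᶠ-δ (λ e → *-congˡ (θ.⟦⟧-cong e)) F.0#) ⟩
    J * g (χ ∙ ψ) + D * ⟨ θ ⟩ F.0#                                               ≈⟨ +-congˡ (trans (*-congˡ θ.0-homo) (*-identityʳ D)) ⟩
    J * g (χ ∙ ψ) + D                                                            ∎
    where
    J D : Carrier
    J = jacobi χ ψ
    D = ⟦ ψ ⟧ (F.- F.1#) * total (χ ∙ ψ)
    inner : ∀ x → ⟦ χ ⟧ x * ⟨ θ ⟩ x * g ψ ≈ ∑ᶠ (λ s → ⟦ χ ⟧ x * ⟦ ψ ⟧ (s F.- x) * ⟨ θ ⟩ s)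
    inner x = begin
      ⟦ χ ⟧ x * ⟨ θ ⟩ x * g ψ                                                         ≈⟨ *-congˡ (∑ᶠ-bijection (λ e → *-cong (MulChar.⟦⟧-cong ψ e) (θ.⟦⟧-cong e)) (translation (F.- x))) ⟩
      ⟦ χ ⟧ x * ⟨ θ ⟩ x * ∑ᶠ (λ s → ⟦ ψ ⟧ (F.- x F.+ s) * ⟨ θ ⟩ (F.- x F.+ s))        ≈⟨ ∑ᶠ-*ˡ _ _ ⟩
      ∑ᶠ (λ s → ⟦ χ ⟧ x * ⟨ θ ⟩ x * (⟦ ψ ⟧ (F.- x F.+ s) * ⟨ θ ⟩ (F.- x F.+ s)))      ≈⟨ ∑ᶠ-cong (λ s → trans ([ab][cd]≈[ac][bd] _ _ _ _)
                                                                                             (*-cong (*-congˡ (MulChar.⟦⟧-cong ψ (F.+-comm _ _))) (trans (sym (θ.+-homo _ _)) (θ.⟦⟧-cong (cancel x s))))) ⟩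
      ∑ᶠ (λ s → ⟦ χ ⟧ x * ⟦ ψ ⟧ (s F.- x) * ⟨ θ ⟩ s)                                  ∎
      where
      cancel : ∀ x s → x F.+ (F.- x F.+ s) F.≈ s
      cancel x s = F.trans (F.sym (F.+-assoc _ _ _)) (F.trans (F.+-congʳ (F.-‿inverseʳ x)) (F.+-identityˡ s))

  gauss-*-gauss-nontrivial : ∀ χ ψ → ¬ (χ ∙ ψ ≈ᶜ ε) → g χ * g ψ ≈ jacobi χ ψ * g (χ ∙ ψ)
  gauss-*-gauss-nontrivial χ ψ χψ≉ε = trans (gauss-*-gauss-jacobi χ ψ)
    (trans (+-congˡ (trans (*-congˡ (total-nontrivial (χ ∙ ψ) χψ≉ε)) (zeroʳ _))) (+-identityʳ _))

open import Data.Vec.Functional using (_∷_; [])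

-- The Hasse-Davenport formula for the quadratic character.

module QuadraticGaussSums
  (𝔽 : FiniteField c ℓ₁ ℓ₂) (ℂ : AlgebraicallyClosedField₀ k κ₁ κ₂) (θ : Characters.NontrivialAddChar 𝔽 ℂ)
  (φ : Characters.MulChar 𝔽 ℂ) (φ-order-two : Characters.HasOrderTwo 𝔽 ℂ φ) where

  open Characters 𝔽 ℂ
  open AlgebraicallyClosedField₀ ℂ
  open K hiding (_≈_; _+_; _*_)
  open SetoidReasoning setoid
  open CharacterSums 𝔽 ℂ
  open Quadratic φ φ-order-two
  open GaussSums 𝔽 ℂ θ
  open FieldFacts 𝔽
  open F using (q)
  open SemiringSolver commutativeSemiring using (solve; _:=_; _:+_; _:*_)

  half : F.Carrier
  half = F.inv (F.1# F.+ F.1#)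

  half#0 : half F.# F.0#
  half#0 = F.inv-#0 2#0

  half+half : ∀ x → half F.* x F.+ half F.* x F.≈ x
  half+half x = F.trans (F.sym (F.distribˡ half x x)) (F.trans (F.*-congˡ (F.sym (F.trans (F.distribʳ x F.1# F.1#) (F.+-cong (F.*-identityˡ x) (F.*-identityˡ x)))))
    (F.trans (F.sym (F.*-assoc _ _ _)) (F.trans (F.*-congʳ (F.trans (F.*-comm _ _) (F.inv-inverseʳ 2#0))) (F.*-identityˡ x))))

  -- χ̄(4)
  κ : MulChar → Carrier
  κ χ = ⟦ χ ⟧ half * ⟦ χ ⟧ half

  inversion : Bijection
  inversion = record
    { σ = F.inv ; τ = F.inv ; σ-cong = F.inv-cong ; τ-cong = F.inv-cong
    ; σ∘τ = inv-involutive ; τ∘σ = inv-involutive }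

  reflection : Bijection
  reflection = record
    { σ = λ x → F.1# F.- x ; τ = λ x → F.1# F.- x ; σ-cong = λ e → F.+-congˡ (F.-‿cong e) ; τ-cong = λ e → F.+-congˡ (F.-‿cong e)
    ; σ∘τ = x-[x-y]≈y F.1# ; τ∘σ = x-[x-y]≈y F.1# }

  infixr 9 _∘ᵇ_
  _∘ᵇ_ : Bijection → Bijection → Bijection
  β ∘ᵇ β′ = record
    { σ = λ x → β.σ (β′.σ x) ; τ = λ x → β′.τ (β.τ x)
    ; σ-cong = λ e → β.σ-cong (β′.σ-cong e) ; τ-cong = λ e → β′.τ-cong (β.τ-cong e)
    ; σ∘τ = λ x → F.trans (β.σ-cong (β′.σ∘τ _)) (β.σ∘τ x)
    ; τ∘σ = λ x → F.trans (β′.τ-cong (β.τ∘σ _)) (β′.τ∘σ x) }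
    where
    module β = Bijection β
    module β′ = Bijection β′

  [1+u]/2≈1-[1-u]/2 : ∀ u → half F.* (F.1# F.+ u) F.≈ F.1# F.- half F.* (F.1# F.- u)
  [1+u]/2≈1-[1-u]/2 u = x+y≈z⇒x≈z-y (F.trans (F.sym (F.distribˡ half _ _)) (F.trans
    (F.*-congˡ ([x+y]+[x-y]≈x+x F.1# u)) (F.trans (F.distribˡ half F.1# F.1#) (half+half F.1#))))

  -- The substitution t = (1 + u)/(1 - u), that is u = (t - 1)/(t + 1), extended to a
  -- bijection by u = 1 for t = -1.
  abstract

    möbius : Bijection
    möbius = translation (F.- F.1#) ∘ᵇ inversion ∘ᵇ scaling half#0 ∘ᵇ reflection

    möbius-σ : ∀ u → Bijection.σ möbius u F.+ F.1# F.≈ F.inv (half F.* (F.1# F.- u))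
    möbius-σ u = F.trans (F.+-congʳ (F.+-comm _ _)) (F.trans (F.+-assoc _ _ _)
      (F.trans (F.+-congˡ (F.-‿inverseˡ F.1#)) (F.+-identityʳ _)))

  -- With r = 1/(t + 1) = (1 - u)/2 one has tr² = r(1 - r) = (1 - u²)/4 and (t - 1)r = 1 - 2r = u;
  -- the denominator 4 is the source of κ. At u = 1, where r = 0 and t = -1, both sides vanish.
  möbius-summand : ∀ χ {h} → Congruent h → ∀ t r u → t F.+ F.1# F.≈ F.inv r → r F.≈ half F.* (F.1# F.- u) →
    ⟦ χ ⟧ t * ⟦ sq χ ⁻¹ ⟧ (t F.+ F.1#) * h ((t F.- F.1#) F.* F.inv (t F.+ F.1#)) ≈
    κ χ * (⟦ χ ⟧ (F.1# F.- u F.* u) * h u)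
  möbius-summand χ {h} h-cong t r u t+1≈ r≈ = trans
    (*-cong (*-congˡ (*-cong (χ.⟦⟧-cong inv[t+1]≈r) (χ.⟦⟧-cong inv[t+1]≈r))) (h-cong (F.*-congˡ inv[t+1]≈r)))
    (trans main (sym rhs))
    where
    module χ = MulChar χ

    inv[t+1]≈r : F.inv (t F.+ F.1#) F.≈ r
    inv[t+1]≈r = F.trans (F.inv-cong t+1≈) (inv-involutive r)

    rhs : κ χ * (⟦ χ ⟧ (F.1# F.- u F.* u) * h u) ≈ ⟦ χ ⟧ r * ⟦ χ ⟧ (F.1# F.- r) * h u
    rhs = begin
      κ χ * (⟦ χ ⟧ (F.1# F.- u F.* u) * h u)
        ≈⟨ *-congˡ (*-congʳ (trans (χ.⟦⟧-cong (F.trans (F.+-congʳ (F.sym (F.*-identityˡ F.1#))) (RingFacts.x²-y²≈[x-y][x+y] F.commutativeRing F.1# u))) (χ.*-homo _ _))) ⟩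
      κ χ * (⟦ χ ⟧ (F.1# F.- u) * ⟦ χ ⟧ (F.1# F.+ u) * h u)
        ≈⟨ solve 4 (λ a b c d → a :* a :* (b :* c :* d) := a :* b :* (a :* c) :* d) refl _ _ _ _ ⟩
      ⟦ χ ⟧ half * ⟦ χ ⟧ (F.1# F.- u) * (⟦ χ ⟧ half * ⟦ χ ⟧ (F.1# F.+ u)) * h u
        ≈⟨ *-congʳ (*-cong (trans (χ.⟦⟧-cong r≈) (χ.*-homo _ _))
             (trans (χ.⟦⟧-cong (F.trans (F.+-congˡ (F.-‿cong r≈)) (F.sym ([1+u]/2≈1-[1-u]/2 u)))) (χ.*-homo _ _))) ⟨
      ⟦ χ ⟧ r * ⟦ χ ⟧ (F.1# F.- r) * h u ∎

    main : ⟦ χ ⟧ t * (⟦ χ ⟧ r * ⟦ χ ⟧ r) * h ((t F.- F.1#) F.* r) ≈ ⟦ χ ⟧ r * ⟦ χ ⟧ (F.1# F.- r) * h u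
    main with F.≈0⊎#0 r
    ... | inj₁ r≈0 = trans
      (trans (*-congʳ (trans (*-congˡ (trans (*-congʳ (character-≈0 χ r≈0)) (zeroˡ _))) (zeroʳ _))) (zeroˡ _))
      (sym (trans (*-congʳ (trans (*-congʳ (character-≈0 χ r≈0)) (zeroˡ _))) (zeroˡ _)))
    ... | inj₂ r#0 = begin
      ⟦ χ ⟧ t * (⟦ χ ⟧ r * ⟦ χ ⟧ r) * h ((t F.- F.1#) F.* r)  ≈⟨ *-congˡ (h-cong [t-1]r≈u) ⟩
      ⟦ χ ⟧ t * (⟦ χ ⟧ r * ⟦ χ ⟧ r) * h u                     ≈⟨ solve 3 (λ a b c → a :* (b :* b) :* c := b :* (a :* b) :* c) refl _ _ _ ⟩
      ⟦ χ ⟧ r * (⟦ χ ⟧ t * ⟦ χ ⟧ r) * h u                     ≈⟨ *-congʳ (*-congˡ (trans (sym (χ.*-homo _ _)) (χ.⟦⟧-cong tr≈1-r))) ⟩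
      ⟦ χ ⟧ r * ⟦ χ ⟧ (F.1# F.- r) * h u                      ∎
      where
      tr≈1-r : t F.* r F.≈ F.1# F.- r
      tr≈1-r = x+y≈z⇒x≈z-y (F.trans (F.+-congˡ (F.sym (F.*-identityˡ r))) (F.trans (F.sym (F.distribʳ r t F.1#))
        (F.trans (F.*-congʳ t+1≈) (F.trans (F.*-comm _ _) (F.inv-inverseʳ r#0)))))
      [t-1]r≈u : (t F.- F.1#) F.* r F.≈ u
      [t-1]r≈u = F.trans (F.distribʳ r t _) (F.trans (F.+-cong tr≈1-r (F.-1*x≈-x r)) (F.trans (F.+-assoc _ _ _) (F.trans
        (F.+-congˡ (F.trans (F.-‿+-comm r r) (F.-‿cong (F.trans (F.+-cong r≈ r≈) (half+half (F.1# F.- u)))))) (x-[x-y]≈y F.1# u))))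

  ∑ᶠ-möbius : ∀ χ {h} → Congruent h →
    ∑ᶠ (λ t → ⟦ χ ⟧ t * ⟦ sq χ ⁻¹ ⟧ (t F.+ F.1#) * h ((t F.- F.1#) F.* F.inv (t F.+ F.1#))) ≈
    κ χ * ∑ᶠ (λ u → ⟦ χ ⟧ (F.1# F.- u F.* u) * h u)
  ∑ᶠ-möbius χ {h} h-cong = begin
    ∑ᶠ f                                                        ≈⟨ ∑ᶠ-bijection f-cong möbius ⟩
    ∑ᶠ (λ u → f (Bijection.σ möbius u))                         ≈⟨ ∑ᶠ-cong (λ u → möbius-summand χ h-cong _ _ u (möbius-σ u) F.refl) ⟩
    ∑ᶠ (λ u → κ χ * (⟦ χ ⟧ (F.1# F.- u F.* u) * h u))           ≈⟨ ∑ᶠ-*ˡ _ _ ⟨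
    κ χ * ∑ᶠ (λ u → ⟦ χ ⟧ (F.1# F.- u F.* u) * h u)             ∎
    where
    f : F.Carrier → Carrier
    f t = ⟦ χ ⟧ t * ⟦ sq χ ⁻¹ ⟧ (t F.+ F.1#) * h ((t F.- F.1#) F.* F.inv (t F.+ F.1#))
    f-cong : Congruent f
    f-cong e = *-cong (*-cong (MulChar.⟦⟧-cong χ e) (MulChar.⟦⟧-cong (sq χ ⁻¹) (F.+-congʳ e)))
      (h-cong (F.*-cong (F.+-congʳ e) (F.inv-cong (F.+-congʳ e))))

  -- Used twice: with f = 1 for Hasse-Davenport and with f = Ā for Kummer's sum.
  ∑ᶠ-möbius-square : ∀ χ {f} → Congruent f →
    ∑ᶠ (λ t → ⟦ χ ⟧ t * ⟦ sq χ ⁻¹ ⟧ (t F.+ F.1#) *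
              f (((t F.- F.1#) F.* F.inv (t F.+ F.1#)) F.* ((t F.- F.1#) F.* F.inv (t F.+ F.1#)))) ≈
    κ χ * ∑ᶠ (λ v → (1# + ⟦ φ ⟧ v) * (⟦ χ ⟧ (F.1# F.- v) * f v))
  ∑ᶠ-möbius-square χ {f} f-cong = trans
    (∑ᶠ-möbius χ {λ u → f (u F.* u)} (λ e → f-cong (F.*-cong e e)))
    (*-congˡ (∑ᶠ-square {λ v → ⟦ χ ⟧ (F.1# F.- v) * f v}
      (λ e → *-cong (MulChar.⟦⟧-cong χ (F.+-congˡ (F.-‿cong e))) (f-cong e))))

  total-reflect : ∀ χ → ∑ᶠ (λ v → ⟦ χ ⟧ (F.1# F.- v)) ≈ total χ
  total-reflect χ = sym (∑ᶠ-bijection (MulChar.⟦⟧-cong χ) reflection)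

  φ∙φ∙ : ∀ χ → φ ∙ (φ ∙ χ) ≈ᶜ χ
  φ∙φ∙ χ x = trans (sym (*-assoc _ _ _)) (trans (*-congʳ (φ² x)) (∙-identityˡ χ x))

  -- For χ² ≠ ε the Jacobi sum J(φ, χ) is eliminated between two formulas: g(χ)² = κ(χ) J(φ, χ)
  -- g(χ²), from the substitution u = (t - 1)/(t + 1), and g(φ) g(χ) = J(φ, χ) g(φχ). For χ² = ε the
  -- character is ε or φ, κ(χ) = 1, and both sides have the same two factors.
  hasse-davenport : ∀ χ → g χ * g (φ ∙ χ) ≈ κ χ * (g φ * g (sq χ))
  hasse-davenport χ with sq χ ≟ ε
  ... | yes χ² with sq≈ε⇒≈ε⊎≈φ χ χ²
  ...   | inj₁ χ≈ε = begin
    g χ * g (φ ∙ χ)            ≈⟨ *-cong (gauss-cong θ {χ} {sq χ} (λ x → trans (χ≈ε x) (sym (χ² x))))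
                                         (gauss-cong θ {φ ∙ χ} {φ} (λ x → trans (*-congˡ (χ≈ε x)) (trans (*-comm _ _) (∙-identityˡ φ x)))) ⟩
    g (sq χ) * g φ             ≈⟨ *-comm _ _ ⟩
    g φ * g (sq χ)             ≈⟨ *-identityˡ _ ⟨
    1# * (g φ * g (sq χ))      ≈⟨ *-congʳ (trans (χ² half) (ε-#0 half#0)) ⟨
    κ χ * (g φ * g (sq χ))     ∎
  ...   | inj₂ χ≈φ = begin
    g χ * g (φ ∙ χ)            ≈⟨ *-cong (gauss-cong θ {χ} {φ} χ≈φ) (gauss-cong θ {φ ∙ χ} {sq χ} (λ x → *-congʳ (sym (χ≈φ x)))) ⟩
    g φ * g (sq χ)             ≈⟨ *-identityˡ _ ⟨
    1# * (g φ * g (sq χ))      ≈⟨ *-congʳ (trans (χ² half) (ε-#0 half#0)) ⟨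
    κ χ * (g φ * g (sq χ))     ∎
  hasse-davenport χ | no χ²≉ε = *-cancelˡ-#0 (gauss#0 θ χ) (begin
    g χ * (g χ * g (φ ∙ χ))                ≈⟨ *-assoc _ _ _ ⟨
    (g χ * g χ) * g (φ ∙ χ)                ≈⟨ *-congʳ gχ² ⟩
    κ χ * jacobi φ χ * g (sq χ) * g (φ ∙ χ) ≈⟨ solve 4 (λ a b c d → a :* b :* c :* d := a :* c :* (b :* d)) refl _ _ _ _ ⟩
    κ χ * g (sq χ) * (jacobi φ χ * g (φ ∙ χ)) ≈⟨ *-congˡ (gauss-*-gauss-nontrivial φ χ φχ≉ε) ⟨
    κ χ * g (sq χ) * (g φ * g χ)           ≈⟨ solve 4 (λ a b c d → a :* b :* (c :* d) := d :* (a :* (c :* b))) refl _ _ _ _ ⟩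
    g χ * (κ χ * (g φ * g (sq χ)))         ∎)
    where
    χ≉ε : ¬ (χ ≈ᶜ ε)
    χ≉ε e = χ²≉ε λ x → trans (*-cong (e x) (e x)) (∙-identityˡ ε x)
    φχ≉ε : ¬ (φ ∙ χ ≈ᶜ ε)
    φχ≉ε e = χ²≉ε λ x → trans ([φχ]² x) (trans (*-cong (e x) (e x)) (∙-identityˡ ε x))
      where
      [φχ]² : sq χ ≈ᶜ sq (φ ∙ χ)
      [φχ]² x = trans (sym (∙-identityˡ (sq χ) x)) (trans (*-congʳ (sym (φ² x))) ([ab][cd]≈[ac][bd] _ _ _ _))
    gχ² : g χ * g χ ≈ κ χ * jacobi φ χ * g (sq χ)
    gχ² = begin
      g χ * g χ
        ≈⟨ gauss-*-gauss {χ} {χ} {sq χ} (λ _ → refl) ⟩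
      ∑ᶠ (λ t → ⟦ χ ⟧ t * twisted (sq χ) (t F.+ F.1#))
        ≈⟨ ∑ᶠ-cong (λ t → trans (*-congˡ (twisted-nontrivial (sq χ) χ²≉ε _)) (sym (*-assoc _ _ _))) ⟩
      ∑ᶠ (λ t → ⟦ χ ⟧ t * ⟦ sq χ ⁻¹ ⟧ (t F.+ F.1#) * g (sq χ))
        ≈⟨ ∑ᶠ-*ʳ _ _ ⟨
      ∑ᶠ (λ t → ⟦ χ ⟧ t * ⟦ sq χ ⁻¹ ⟧ (t F.+ F.1#)) * g (sq χ)
        ≈⟨ *-congʳ (trans (∑ᶠ-cong λ t → sym (*-identityʳ _)) (∑ᶠ-möbius-square χ {λ _ → 1#} (λ _ → refl))) ⟩
      κ χ * ∑ᶠ (λ v → (1# + ⟦ φ ⟧ v) * (⟦ χ ⟧ (F.1# F.- v) * 1#)) * g (sq χ)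
        ≈⟨ *-congʳ (*-congˡ (trans (∑ᶠ-cong λ v → trans (*-congˡ (*-identityʳ _)) (trans (distribʳ _ _ _) (+-congʳ (*-identityˡ _)))) (∑ᶠ-+ _ _))) ⟩
      κ χ * (∑ᶠ (λ v → ⟦ χ ⟧ (F.1# F.- v)) + jacobi φ χ) * g (sq χ)
        ≈⟨ *-congʳ (*-congˡ (trans (+-congʳ (trans (total-reflect χ) (total-nontrivial χ χ≉ε))) (+-identityˡ _))) ⟩
      κ χ * jacobi φ χ * g (sq χ) ∎

  -- Orthogonality applied to products of four Gauss sums.

  orthogonality-square : ∀ u → ∑ᶜ (λ χ → ⟦ χ ⟧ (u F.* u)) ≈ (q · 1# - 1#) * (δ F.1# u + δ (F.- F.1#) u)
  orthogonality-square u = trans (at (u F.* u)) (*-congˡ (δ-square F.1#0 (F.sym (F.*-identityˡ F.1#)) u))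
    where
    at : ∀ v → ∑ᶜ (λ χ → ⟦ χ ⟧ v) ≈ (q · 1# - 1#) * δ v F.1#
    at v with ≈⊎# F.1# v
    ... | inj₁ 1≈v = trans (sumOver-cong allCharacters λ χ → MulChar.⟦⟧-cong χ (F.sym 1≈v))
      (trans orthogonality-1 (sym (trans (*-congˡ (δ-≈ 1≈v)) (*-identityʳ _))))
    ... | inj₂ 1#v = trans (orthogonality-≉1 λ v≈1 → F.#⇒≉ 1#v (F.sym v≈1))
      (sym (trans (*-congˡ (δ-# 1#v)) (zeroʳ _)))

  module FourGaussSums (a b c ω : MulChar) (bc≈ω : b ∙ c ≈ᶜ ω) where

    fourGauss : MulChar → Carrier
    fourGauss χ = g (a ∙ sq χ) * g (sq χ ⁻¹) * (g (b ∙ sq χ) * g (c ∙ sq χ ⁻¹))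

    cancel-sq : ∀ ψ χ → (ψ ∙ sq χ) ∙ sq χ ⁻¹ ≈ᶜ ψ
    cancel-sq ψ χ x = trans (*-assoc _ _ _) (trans (*-congˡ (∙-inverseʳ (sq χ) x)) (trans (*-comm _ _) (∙-identityˡ ψ x)))

    -- The summands of g(aχ²) g(χ̄²) and of g(bχ²) g(cχ̄²) in the expansion by `gauss-*-gauss`.
    first second : MulChar → F.Carrier → Carrier
    first  χ s = ⟦ a ∙ sq χ ⟧ s * twisted a (s F.+ F.1#)
    second χ t = ⟦ b ∙ sq χ ⟧ t * twisted ω (t F.+ F.1#)

    first-cong : ∀ χ → Congruent (first χ)
    first-cong χ e = *-cong (MulChar.⟦⟧-cong (a ∙ sq χ) e) (twisted-cong {a} {a} (λ _ → refl) (F.+-congʳ e))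

    fourGauss-expansion : ∀ χ → fourGauss χ ≈ ∑ᶠ (λ t → ∑ᶠ (first χ) * second χ t)
    fourGauss-expansion χ = trans
      (*-cong (gauss-*-gauss {a ∙ sq χ} {sq χ ⁻¹} {a} (cancel-sq a χ))
              (gauss-*-gauss {b ∙ sq χ} {c ∙ sq χ ⁻¹} {ω} λ x → trans
                (solve 4 (λ b s c s′ → b :* s :* (c :* s′) := b :* c :* s :* s′) refl _ _ _ _)
                (trans (cancel-sq (b ∙ c) χ x) (bc≈ω x))))
      (∑ᶠ-*ˡ _ _)

    kernel : F.Carrier → F.Carrier → Carrier
    kernel t u = ⟦ a ⟧ u * twisted a (u F.+ t)

    -- With s = τu and τ = 1/t, the product χ²(s) χ²(t) is χ(u²), the form to which orthogonality
    -- applies. The factor a(τ) is absorbed by rescaling the argument of T, so `kernel` is free of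
    -- χ.
    first-scaled : ∀ χ {τ t} → τ F.# F.0# → τ F.* t F.≈ F.1# → ∀ u →
                   first χ (τ F.* u) * ⟦ sq χ ⟧ t ≈ kernel t u * ⟦ χ ⟧ (u F.* u)
    first-scaled χ {τ} {t} τ#0 τt u = begin
      ⟦ a ⟧ (τ F.* u) * ⟦ sq χ ⟧ (τ F.* u) * twisted a (τ F.* u F.+ F.1#) * ⟦ sq χ ⟧ t
        ≈⟨ *-congʳ (*-cong (*-cong (MulChar.*-homo a τ u) (MulChar.*-homo (sq χ) τ u)) (twisted-cong {a} {a} (λ _ → refl) (F.trans (F.+-congˡ (F.sym τt)) (F.sym (F.distribˡ τ u t))))) ⟩
      ⟦ a ⟧ τ * ⟦ a ⟧ u * (⟦ sq χ ⟧ τ * ⟦ sq χ ⟧ u) * twisted a (τ F.* (u F.+ t)) * ⟦ sq χ ⟧ t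
        ≈⟨ solve 6 (λ aτ au sτ su T st → aτ :* au :* (sτ :* su) :* T :* st := au :* (aτ :* T) :* (su :* (sτ :* st))) refl _ _ _ _ _ _ ⟩
      ⟦ a ⟧ u * (⟦ a ⟧ τ * twisted a (τ F.* (u F.+ t))) * (⟦ sq χ ⟧ u * (⟦ sq χ ⟧ τ * ⟦ sq χ ⟧ t))
        ≈⟨ *-cong (*-congˡ (twisted-scale a τ#0 (u F.+ t))) (*-cong (sym (MulChar.*-homo χ u u))
             (trans (sym (MulChar.*-homo (sq χ) τ t)) (trans (MulChar.⟦⟧-cong (sq χ) τt) (MulChar.1-homo (sq χ))))) ⟩
      kernel t u * (⟦ χ ⟧ (u F.* u) * 1#)
        ≈⟨ *-congˡ (*-identityʳ _) ⟩
      kernel t u * ⟦ χ ⟧ (u F.* u) ∎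

    first-second : ∀ χ {t} → t F.# F.0# → ∑ᶠ (first χ) * second χ t ≈
                   ⟦ b ⟧ t * twisted ω (t F.+ F.1#) * ∑ᶠ (λ u → kernel t u * ⟦ χ ⟧ (u F.* u))
    first-second χ {t} t#0 = begin
      ∑ᶠ (first χ) * (⟦ b ⟧ t * ⟦ sq χ ⟧ t * twisted ω (t F.+ F.1#))
        ≈⟨ solve 4 (λ f b s T → f :* (b :* s :* T) := b :* T :* (f :* s)) refl _ _ _ _ ⟩
      ⟦ b ⟧ t * twisted ω (t F.+ F.1#) * (∑ᶠ (first χ) * ⟦ sq χ ⟧ t)
        ≈⟨ *-congˡ (trans (*-congʳ (∑ᶠ-bijection (first-cong χ) (scaling (F.inv-#0 t#0)))) (∑ᶠ-*ʳ _ _)) ⟩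
      ⟦ b ⟧ t * twisted ω (t F.+ F.1#) * ∑ᶠ (λ u → first χ (F.inv t F.* u) * ⟦ sq χ ⟧ t)
        ≈⟨ *-congˡ (∑ᶠ-cong (first-scaled χ (F.inv-#0 t#0) (F.trans (F.*-comm _ _) (F.inv-inverseʳ t#0)))) ⟩
      ⟦ b ⟧ t * twisted ω (t F.+ F.1#) * ∑ᶠ (λ u → kernel t u * ⟦ χ ⟧ (u F.* u)) ∎

    kernel-cong : ∀ t → Congruent (kernel t)
    kernel-cong t e = *-cong (MulChar.⟦⟧-cong a e) (twisted-cong {a} {a} (λ _ → refl) (F.+-congʳ e))

    kernel-sum : ∀ t → ∑ᶜ (λ χ → ∑ᶠ (λ u → kernel t u * ⟦ χ ⟧ (u F.* u))) ≈
                 (q · 1# - 1#) * (kernel t F.1# + kernel t (F.- F.1#))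
    kernel-sum t = begin
      ∑ᶜ (λ χ → ∑ᶠ (λ u → kernel t u * ⟦ χ ⟧ (u F.* u)))
        ≈⟨ sumOver-∑ᶠ allCharacters (λ χ u → kernel t u * ⟦ χ ⟧ (u F.* u)) ⟩
      ∑ᶠ (λ u → ∑ᶜ (λ χ → kernel t u * ⟦ χ ⟧ (u F.* u)))
        ≈⟨ ∑ᶠ-cong (λ u → trans (sym (sumOver-*ˡ allCharacters _ _)) (trans (*-congˡ (orthogonality-square u))
             (solve 4 (λ k n d e → k :* (n :* (d :+ e)) := n :* (d :* k :+ e :* k)) refl _ _ _ _))) ⟩
      ∑ᶠ (λ u → (q · 1# - 1#) * (δ F.1# u * kernel t u + δ (F.- F.1#) u * kernel t u))
        ≈⟨ ∑ᶠ-*ˡ _ _ ⟨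
      (q · 1# - 1#) * ∑ᶠ (λ u → δ F.1# u * kernel t u + δ (F.- F.1#) u * kernel t u)
        ≈⟨ *-congˡ (trans (∑ᶠ-+ _ _) (+-cong (∑ᶠ-δ (kernel-cong t) F.1#) (∑ᶠ-δ (kernel-cong t) (F.- F.1#)))) ⟩
      (q · 1# - 1#) * (kernel t F.1# + kernel t (F.- F.1#)) ∎

    ∑ᶜ-first-second : ∀ t → ∑ᶜ (λ χ → ∑ᶠ (first χ) * second χ t) ≈
      (q · 1# - 1#) * (⟦ b ⟧ t * (twisted ω (t F.+ F.1#) * (kernel t F.1# + kernel t (F.- F.1#))))
    ∑ᶜ-first-second t with F.≈0⊎#0 t
    ... | inj₁ t≈0 = trans
      (sumOver-zero allCharacters λ χ → trans (*-congˡ (trans (*-congʳ (character-≈0 (b ∙ sq χ) t≈0)) (zeroˡ _))) (zeroʳ _))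
      (sym (trans (*-congˡ (trans (*-congʳ (character-≈0 b t≈0)) (zeroˡ _))) (zeroʳ _)))
    ... | inj₂ t#0 = begin
      ∑ᶜ (λ χ → ∑ᶠ (first χ) * second χ t)
        ≈⟨ sumOver-cong allCharacters (λ χ → first-second χ t#0) ⟩
      ∑ᶜ (λ χ → ⟦ b ⟧ t * twisted ω (t F.+ F.1#) * ∑ᶠ (λ u → kernel t u * ⟦ χ ⟧ (u F.* u)))
        ≈⟨ sumOver-*ˡ allCharacters _ _ ⟨
      ⟦ b ⟧ t * twisted ω (t F.+ F.1#) * ∑ᶜ (λ χ → ∑ᶠ (λ u → kernel t u * ⟦ χ ⟧ (u F.* u)))
        ≈⟨ *-congˡ (kernel-sum t) ⟩
      ⟦ b ⟧ t * twisted ω (t F.+ F.1#) * ((q · 1# - 1#) * (kernel t F.1# + kernel t (F.- F.1#)))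
        ≈⟨ solve 4 (λ b T n k → b :* T :* (n :* k) := n :* (b :* (T :* k))) refl _ _ _ _ ⟩
      (q · 1# - 1#) * (⟦ b ⟧ t * (twisted ω (t F.+ F.1#) * (kernel t F.1# + kernel t (F.- F.1#)))) ∎

    gaussSum kummerSum : Carrier
    gaussSum  = ∑ᶠ (λ t → ⟦ b ⟧ t * (twisted ω (t F.+ F.1#) * twisted a (t F.+ F.1#)))
    kummerSum = ∑ᶠ (λ t → ⟦ b ⟧ t * (twisted ω (t F.+ F.1#) * twisted a (t F.- F.1#)))

    ∑ᶜ-fourGauss : ∑ᶜ fourGauss ≈ (q · 1# - 1#) * (gaussSum + ⟦ a ⟧ (F.- F.1#) * kummerSum)
    ∑ᶜ-fourGauss = begin
      ∑ᶜ fourGauss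
        ≈⟨ sumOver-cong allCharacters fourGauss-expansion ⟩
      ∑ᶜ (λ χ → ∑ᶠ (λ t → ∑ᶠ (first χ) * second χ t))
        ≈⟨ sumOver-∑ᶠ allCharacters (λ χ t → ∑ᶠ (first χ) * second χ t) ⟩
      ∑ᶠ (λ t → ∑ᶜ (λ χ → ∑ᶠ (first χ) * second χ t))
        ≈⟨ ∑ᶠ-cong ∑ᶜ-first-second ⟩
      ∑ᶠ (λ t → (q · 1# - 1#) * (⟦ b ⟧ t * (twisted ω (t F.+ F.1#) * (kernel t F.1# + kernel t (F.- F.1#)))))
        ≈⟨ ∑ᶠ-*ˡ _ _ ⟨
      (q · 1# - 1#) * ∑ᶠ (λ t → ⟦ b ⟧ t * (twisted ω (t F.+ F.1#) * (kernel t F.1# + kernel t (F.- F.1#))))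
        ≈⟨ *-congˡ (∑ᶠ-cong λ t → trans
             (*-congˡ (*-congˡ (+-cong (trans (*-cong (MulChar.1-homo a) (twisted-cong {a} {a} (λ _ → refl) (F.+-comm _ _))) (*-identityˡ _))
                                       (*-congˡ (twisted-cong {a} {a} (λ _ → refl) (F.+-comm _ _))))))
             (solve 5 (λ b T S n R → b :* (T :* (S :+ n :* R)) := b :* (T :* S) :+ n :* (b :* (T :* R))) refl _ _ _ _ _)) ⟩
      (q · 1# - 1#) * ∑ᶠ (λ t → ⟦ b ⟧ t * (twisted ω (t F.+ F.1#) * twisted a (t F.+ F.1#)) +
                                 ⟦ a ⟧ (F.- F.1#) * (⟦ b ⟧ t * (twisted ω (t F.+ F.1#) * twisted a (t F.- F.1#))))
        ≈⟨ *-congˡ (trans (∑ᶠ-+ _ _) (+-congˡ (sym (∑ᶠ-*ˡ _ _)))) ⟩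
      (q · 1# - 1#) * (gaussSum + ⟦ a ⟧ (F.- F.1#) * kummerSum) ∎

    -- The analogue of Gauss's theorem.

    module _ (a≉ε : ¬ (a ≈ᶜ ε)) (ωa≈b² : ω ∙ a ≈ᶜ sq b) where

      -- Since b² ≠ ε, multiplication by g(b²) turns b̄²(t + 1) back into T(b², t + 1), and the sum
      -- becomes the expansion of g(b)². No Jacobi sum has to be evaluated.
      gaussSum-evaluation : ¬ (sq b ≈ᶜ ε) → gaussSum * g (sq b) ≈ g a * g ω * (g b * g b)
      gaussSum-evaluation b²≉ε = begin
        gaussSum * g (sq b)
          ≈⟨ ∑ᶠ-*ʳ _ _ ⟩
        ∑ᶠ (λ t → ⟦ b ⟧ t * (twisted ω (t F.+ F.1#) * twisted a (t F.+ F.1#)) * g (sq b))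
          ≈⟨ ∑ᶠ-cong (λ t → trans (*-congʳ (*-congˡ (twisted-*-twisted (t F.+ F.1#))))
               (trans (solve 5 (λ b s n m k → b :* (s :* (n :* m)) :* k := m :* n :* (b :* (s :* k))) refl _ _ _ _ _)
                      (*-congˡ (*-congˡ (sym (twisted-nontrivial (sq b) b²≉ε (t F.+ F.1#))))))) ⟩
        ∑ᶠ (λ t → g a * g ω * (⟦ b ⟧ t * twisted (sq b) (t F.+ F.1#)))
          ≈⟨ ∑ᶠ-*ˡ _ _ ⟨
        g a * g ω * ∑ᶠ (λ t → ⟦ b ⟧ t * twisted (sq b) (t F.+ F.1#))
          ≈⟨ *-congˡ (gauss-*-gauss {b} {b} {sq b} (λ _ → refl)) ⟨
        g a * g ω * (g b * g b) ∎
        where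
        twisted-*-twisted : ∀ s → twisted ω s * twisted a s ≈ ⟦ sq b ⁻¹ ⟧ s * (g ω * g a)
        twisted-*-twisted s with F.≈0⊎#0 s
        -- If ω = ε then T(ω, 0) is not 0, but the other factor T(a, 0) is, as a ≠ ε.
        ... | inj₁ s≈0 = trans (trans (*-congˡ (trans (twisted-0 a s≈0) (total-nontrivial a a≉ε))) (zeroʳ _))
          (sym (trans (*-congʳ (character-≈0 (sq b ⁻¹) s≈0)) (zeroˡ _)))
        ... | inj₂ s#0 = trans
          (*-cong (trans (twisted-gauss ω s) (trans (+-congˡ (trans (*-congʳ (δ-# s#0)) (zeroˡ _))) (+-identityʳ _)))
                  (twisted-nontrivial a a≉ε s))
          (trans ([ab][cd]≈[ac][bd] _ _ _ _) (*-congʳ (ωa≈b² (F.inv s))))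

  -- The analogue of Kummer's theorem.

  κ-inverse : ∀ χ → κ χ * κ (χ ⁻¹) ≈ 1#
  κ-inverse χ = trans ([ab][cd]≈[ac][bd] _ _ _ _)
    (trans (*-cong (character-inv χ half#0) (character-inv χ half#0)) (*-identityˡ 1#))

  κ-∙ : ∀ χ ψ → κ (χ ∙ ψ) ≈ κ χ * κ ψ
  κ-∙ χ ψ = [ab][cd]≈[ac][bd] _ _ _ _

  κ#0 : ∀ χ → κ χ # 0#
  κ#0 χ = x#0y#0→xy#0 (character-#0 χ half#0) (character-#0 χ half#0)

  sq-1 : ∀ χ → ⟦ sq χ ⟧ (F.- F.1#) ≈ 1#
  sq-1 χ = trans (sym (MulChar.*-homo χ _ _)) (trans (MulChar.⟦⟧-cong χ
    (F.trans (RingFacts.-x*-x≈x*x F.commutativeRing F.1#) (F.*-identityˡ F.1#))) (MulChar.1-homo χ))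

  -- Splits the correction for ω = Y² into the corrections that belong to Y and φY.
  total-sq : ∀ χ → total (sq χ) ≈ total χ + total (φ ∙ χ)
  total-sq χ = begin
    total (sq χ)                               ≈⟨ ∑ᶠ-cong (λ x → MulChar.*-homo χ x x) ⟨
    ∑ᶠ (λ x → ⟦ χ ⟧ (x F.* x))                 ≈⟨ ∑ᶠ-square (MulChar.⟦⟧-cong χ) ⟩
    ∑ᶠ (λ v → (1# + ⟦ φ ⟧ v) * ⟦ χ ⟧ v)        ≈⟨ ∑ᶠ-cong (λ v → trans (distribʳ _ _ _) (+-congʳ (*-identityˡ _))) ⟩
    ∑ᶠ (λ v → ⟦ χ ⟧ v + ⟦ φ ∙ χ ⟧ v)           ≈⟨ ∑ᶠ-+ _ _ ⟩
    total χ + total (φ ∙ χ)                    ∎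

  -- Both sides vanish unless χ = ε, and then φχ = φ.
  g-φ-total : ∀ χ → g φ * total χ ≈ g (φ ∙ χ) * total χ
  g-φ-total χ with χ ≟ ε
  ... | yes χ≈ε = *-congʳ (gauss-cong θ {φ} {φ ∙ χ} λ x → sym (trans (*-congˡ (χ≈ε x)) (trans (*-comm _ _) (∙-identityˡ φ x))))
  ... | no  χ≉ε = trans (*-congˡ (total-nontrivial χ χ≉ε)) (trans (zeroʳ _) (sym (trans (*-congˡ (total-nontrivial χ χ≉ε)) (zeroʳ _))))

  -- The argument -2 is t - 1 at t = -1, where the correction of Kummer's sum is located.
  sq⁻¹[-2] : ∀ χ → ⟦ sq χ ⁻¹ ⟧ (F.- F.1# F.- F.1#) ≈ κ χ
  sq⁻¹[-2] χ = begin
    ⟦ χ ⟧ (F.inv m) * ⟦ χ ⟧ (F.inv m)    ≈⟨ MulChar.*-homo χ _ _ ⟨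
    ⟦ χ ⟧ (F.inv m F.* F.inv m)          ≈⟨ MulChar.⟦⟧-cong χ (F.trans (F.sym (F.inv-* m m)) (F.trans (F.inv-cong m²≈4) (F.inv-* (F.1# F.+ F.1#) (F.1# F.+ F.1#)))) ⟩
    ⟦ χ ⟧ (half F.* half)                ≈⟨ MulChar.*-homo χ _ _ ⟩
    κ χ                                  ∎
    where
    m : F.Carrier
    m = F.- F.1# F.- F.1#
    m²≈4 : m F.* m F.≈ (F.1# F.+ F.1#) F.* (F.1# F.+ F.1#)
    m²≈4 = F.trans (F.*-cong (F.-‿+-comm F.1# F.1#) (F.-‿+-comm F.1# F.1#)) (RingFacts.-x*-x≈x*x F.commutativeRing _)

  module KummerEvaluation (A b c ω : MulChar) (bc≈ω : b ∙ c ≈ᶜ ω) (a≉ε : ¬ (sq A ≈ᶜ ε)) (ωa≈b² : ω ∙ sq A ≈ᶜ sq b) where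

    open FourGaussSums (sq A) b c ω bc≈ω

    -- By ωa = b² the factor ω̄(s) is b̄²(s) a(s), and a(s) ā(v) = Ā((v/s)²) as a = A². With s = t +
    -- 1 and v = t - 1 this is the shape required by the substitution u = v/s.
    möbius-form : ∀ s v → ⟦ ω ⁻¹ ⟧ s * ⟦ sq A ⁻¹ ⟧ v ≈
                  ⟦ sq b ⁻¹ ⟧ s * ⟦ A ⁻¹ ⟧ ((v F.* F.inv s) F.* (v F.* F.inv s))
    möbius-form s v with F.≈0⊎#0 s
    ... | inj₁ s≈0 = trans (trans (*-congʳ (character-≈0 (ω ⁻¹) s≈0)) (zeroˡ _))
      (sym (trans (*-congʳ (character-≈0 (sq b ⁻¹) s≈0)) (zeroˡ _)))
    ... | inj₂ s#0 = sym (begin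
      ⟦ sq b ⁻¹ ⟧ s * ⟦ A ⁻¹ ⟧ ((v F.* i) F.* (v F.* i))
        ≈⟨ *-cong (sym (ωa≈b² i)) (trans (MulChar.*-homo (A ⁻¹) _ _) (MulChar.*-homo (sq A ⁻¹) v i)) ⟩
      ⟦ ω ⁻¹ ⟧ s * ⟦ sq A ⟧ i * (⟦ sq A ⁻¹ ⟧ v * ⟦ sq A ⁻¹ ⟧ i)
        ≈⟨ solve 4 (λ w x y z → w :* x :* (y :* z) := w :* y :* (x :* z)) refl _ _ _ _ ⟩
      ⟦ ω ⁻¹ ⟧ s * ⟦ sq A ⁻¹ ⟧ v * (⟦ sq A ⟧ i * ⟦ sq A ⁻¹ ⟧ i)
        ≈⟨ trans (*-congˡ (character-inv (sq A) (F.inv-#0 s#0))) (*-identityʳ _) ⟩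
      ⟦ ω ⁻¹ ⟧ s * ⟦ sq A ⁻¹ ⟧ v ∎)
      where
      i : F.Carrier
      i = F.inv s

    -- In this module `a` is the Gauss sum of A² and not the character; `D` is 0 unless ω = ε.
    a D : Carrier
    a = g (sq A)
    D = total ω

    -- At t = -1 the factor T(A², t - 1) is evaluated at -2 and does not vanish, so the correction
    -- of T(ω, 0) stays, in contrast to `gaussSum`.
    kummer-summand : ∀ t → ⟦ b ⟧ t * (twisted ω (t F.+ F.1#) * twisted (sq A) (t F.- F.1#)) ≈
      a * g ω * (⟦ b ⟧ t * ⟦ sq b ⁻¹ ⟧ (t F.+ F.1#) *
                 ⟦ A ⁻¹ ⟧ (((t F.- F.1#) F.* F.inv (t F.+ F.1#)) F.* ((t F.- F.1#) F.* F.inv (t F.+ F.1#)))) +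
      a * D * (δ (F.- F.1#) t * (⟦ b ⟧ t * ⟦ sq A ⁻¹ ⟧ (t F.- F.1#)))
    kummer-summand t = begin
      ⟦ b ⟧ t * (twisted ω s * twisted (sq A) v)
        ≈⟨ *-congˡ (*-cong (twisted-gauss ω s) (twisted-nontrivial (sq A) a≉ε v)) ⟩
      ⟦ b ⟧ t * ((⟦ ω ⁻¹ ⟧ s * g ω + δ F.0# s * D) * (⟦ sq A ⁻¹ ⟧ v * a))
        ≈⟨ solve 7 (λ b w gω d D A a → b :* ((w :* gω :+ d :* D) :* (A :* a)) := a :* gω :* (b :* (w :* A)) :+ a :* D :* (d :* (b :* A))) refl _ _ _ _ _ _ _ ⟩
      a * g ω * (⟦ b ⟧ t * (⟦ ω ⁻¹ ⟧ s * ⟦ sq A ⁻¹ ⟧ v)) + a * D * (δ F.0# s * (⟦ b ⟧ t * ⟦ sq A ⁻¹ ⟧ v))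
        ≈⟨ +-cong (*-congˡ (trans (*-congˡ (möbius-form s v)) (sym (*-assoc _ _ _))))
                  (*-congˡ (*-congʳ (+-congˡ (-‿cong (ε-cong (F.trans (F.x-0≈x s) (F.+-congˡ (F.sym (F.-‿involutive F.1#))))))))) ⟩
      a * g ω * (⟦ b ⟧ t * ⟦ sq b ⁻¹ ⟧ s * ⟦ A ⁻¹ ⟧ ((v F.* F.inv s) F.* (v F.* F.inv s))) +
      a * D * (δ (F.- F.1#) t * (⟦ b ⟧ t * ⟦ sq A ⁻¹ ⟧ v)) ∎
      where
      s v : F.Carrier
      s = t F.+ F.1#
      v = t F.- F.1#

    kummer-expansion : kummerSum ≈ a * g ω * (κ b * (jacobi (A ⁻¹) b + jacobi (φ ∙ A ⁻¹) b)) +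
                                   a * D * (⟦ b ⟧ (F.- F.1#) * κ A)
    kummer-expansion = begin
      kummerSum
        ≈⟨ trans (∑ᶠ-cong kummer-summand) (trans (∑ᶠ-+ _ _) (+-cong (sym (∑ᶠ-*ˡ _ _)) (sym (∑ᶠ-*ˡ _ _)))) ⟩
      a * g ω * ∑ᶠ (λ t → ⟦ b ⟧ t * ⟦ sq b ⁻¹ ⟧ (t F.+ F.1#) *
        ⟦ A ⁻¹ ⟧ (((t F.- F.1#) F.* F.inv (t F.+ F.1#)) F.* ((t F.- F.1#) F.* F.inv (t F.+ F.1#)))) +
      a * D * ∑ᶠ (λ t → δ (F.- F.1#) t * (⟦ b ⟧ t * ⟦ sq A ⁻¹ ⟧ (t F.- F.1#)))
        ≈⟨ +-cong (*-congˡ (∑ᶠ-möbius-square b {⟦ A ⁻¹ ⟧} (MulChar.⟦⟧-cong (A ⁻¹))))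
                  (*-congˡ (trans (∑ᶠ-δ (λ e → *-cong (MulChar.⟦⟧-cong b e) (MulChar.⟦⟧-cong (sq A ⁻¹) (F.+-congʳ e))) (F.- F.1#)) (*-congˡ (sq⁻¹[-2] A)))) ⟩
      a * g ω * (κ b * ∑ᶠ (λ v → (1# + ⟦ φ ⟧ v) * (⟦ b ⟧ (F.1# F.- v) * ⟦ A ⁻¹ ⟧ v))) + a * D * (⟦ b ⟧ (F.- F.1#) * κ A)
        ≈⟨ +-congʳ (*-congˡ (*-congˡ (trans (∑ᶠ-cong λ v → trans (distribʳ _ _ _) (+-cong (trans (*-identityˡ _) (*-comm _ _))
             (solve 3 (λ f b A → f :* (b :* A) := f :* A :* b) refl _ _ _))) (∑ᶠ-+ _ _)))) ⟩
      a * g ω * (κ b * (jacobi (A ⁻¹) b + jacobi (φ ∙ A ⁻¹) b)) + a * D * (⟦ b ⟧ (F.- F.1#) * κ A) ∎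

    -- The character R̄b for R = A; the root R = φA has φY. Since Y² = ω, Hasse-Davenport splits
    -- g(ω) into g(Y) and g(φY).
    Y : MulChar
    Y = A ⁻¹ ∙ b

    sqY≈ω : sq Y ≈ᶜ ω
    sqY≈ω x = begin
      ⟦ A ⁻¹ ⟧ x * ⟦ b ⟧ x * (⟦ A ⁻¹ ⟧ x * ⟦ b ⟧ x)     ≈⟨ [ab][cd]≈[ac][bd] _ _ _ _ ⟩
      ⟦ sq A ⁻¹ ⟧ x * ⟦ sq b ⟧ x                         ≈⟨ *-congˡ (ωa≈b² x) ⟨
      ⟦ sq A ⁻¹ ⟧ x * (⟦ ω ⟧ x * ⟦ sq A ⟧ x)             ≈⟨ solve 3 (λ i w a → i :* (w :* a) := a :* i :* w) refl _ _ _ ⟩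
      ⟦ sq A ⟧ x * ⟦ sq A ⁻¹ ⟧ x * ⟦ ω ⟧ x               ≈⟨ *-congʳ (∙-inverseʳ (sq A) x) ⟩
      ⟦ ε ⟧ x * ⟦ ω ⟧ x                                  ≈⟨ ∙-identityˡ ω x ⟩
      ⟦ ω ⟧ x                                            ∎

    κb≈ : κ b ≈ κ A * κ Y
    κb≈ = begin
      κ b                        ≈⟨ *-identityˡ _ ⟨
      1# * κ b                   ≈⟨ *-congʳ (κ-inverse A) ⟨
      κ A * κ (A ⁻¹) * κ b       ≈⟨ *-assoc _ _ _ ⟩
      κ A * (κ (A ⁻¹) * κ b)     ≈⟨ *-congˡ (κ-∙ (A ⁻¹) b) ⟨
      κ A * κ Y                  ∎

    jacobi-Y : g (A ⁻¹) * g b ≈ jacobi (A ⁻¹) b * g Y + ⟦ b ⟧ (F.- F.1#) * total Y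
    jacobi-Y = gauss-*-gauss-jacobi (A ⁻¹) b

    jacobi-φY : g (φ ∙ A ⁻¹) * g b ≈ jacobi (φ ∙ A ⁻¹) b * g (φ ∙ Y) + ⟦ b ⟧ (F.- F.1#) * total (φ ∙ Y)
    jacobi-φY = trans (gauss-*-gauss-jacobi (φ ∙ A ⁻¹) b) (+-cong
      (*-congˡ (gauss-cong θ {(φ ∙ A ⁻¹) ∙ b} {φ ∙ Y} λ x → *-assoc _ _ _))
      (*-congˡ (total-cong {(φ ∙ A ⁻¹) ∙ b} {φ ∙ Y} λ x → *-assoc _ _ _)))

    -- Hasse–Davenport for Y and the two Jacobi sums; the exceptional terms cancel.
    kummer-φ : g φ * kummerSum ≈ a * (κ A * (g b * (g (φ ∙ Y) * g (A ⁻¹) + g Y * g (φ ∙ A ⁻¹))))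
    kummer-φ = begin
      g φ * kummerSum
        ≈⟨ *-congˡ (trans kummer-expansion (+-congʳ (*-congˡ (*-congʳ κb≈)))) ⟩
      g φ * (a * g ω * (κ A * κ Y * (J₁ + J₂)) + a * D * (m * κ A))
        ≈⟨ solve 9 (λ f a w K L J J′ D m → f :* (a :* w :* (K :* L :* (J :+ J′)) :+ a :* D :* (m :* K)) :=
             a :* (K :* ((L :* (f :* w)) :* (J :+ J′) :+ m :* (f :* D)))) refl _ _ _ _ _ _ _ _ _ ⟩
      a * (κ A * (κ Y * (g φ * g ω) * (J₁ + J₂) + m * (g φ * D)))
        ≈⟨ *-congˡ (*-congˡ (+-cong (*-congʳ hd) (*-congˡ gφD))) ⟩
      a * (κ A * (g Y * g (φ ∙ Y) * (J₁ + J₂) + m * (g (φ ∙ Y) * total Y + g Y * total (φ ∙ Y))))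
        ≈⟨ *-congˡ (*-congˡ (solve 7 (λ y z J J′ m D D′ → y :* z :* (J :+ J′) :+ m :* (z :* D :+ y :* D′) :=
             z :* (J :* y :+ m :* D) :+ y :* (J′ :* z :+ m :* D′)) refl _ _ _ _ _ _ _)) ⟩
      a * (κ A * (g (φ ∙ Y) * (J₁ * g Y + m * total Y) + g Y * (J₂ * g (φ ∙ Y) + m * total (φ ∙ Y))))
        ≈⟨ *-congˡ (*-congˡ (+-cong (*-congˡ jacobi-Y) (*-congˡ jacobi-φY))) ⟨
      a * (κ A * (g (φ ∙ Y) * (g (A ⁻¹) * g b) + g Y * (g (φ ∙ A ⁻¹) * g b)))
        ≈⟨ *-congˡ (*-congˡ (solve 5 (λ z A b y B → z :* (A :* b) :+ y :* (B :* b) := b :* (z :* A :+ y :* B)) refl _ _ _ _ _)) ⟩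
      a * (κ A * (g b * (g (φ ∙ Y) * g (A ⁻¹) + g Y * g (φ ∙ A ⁻¹)))) ∎
      where
      J₁ J₂ m : Carrier
      J₁ = jacobi (A ⁻¹) b
      J₂ = jacobi (φ ∙ A ⁻¹) b
      m  = ⟦ b ⟧ (F.- F.1#)
      hd : κ Y * (g φ * g ω) ≈ g Y * g (φ ∙ Y)
      hd = sym (trans (hasse-davenport Y) (*-congˡ (*-congˡ (gauss-cong θ {sq Y} {ω} sqY≈ω))))
      gφD : g φ * D ≈ g (φ ∙ Y) * total Y + g Y * total (φ ∙ Y)
      gφD = begin
        g φ * D                                           ≈⟨ *-congˡ (trans (total-cong {ω} {sq Y} λ x → sym (sqY≈ω x)) (total-sq Y)) ⟩
        g φ * (total Y + total (φ ∙ Y))                   ≈⟨ distribˡ _ _ _ ⟩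
        g φ * total Y + g φ * total (φ ∙ Y)               ≈⟨ +-cong (g-φ-total Y) (trans (g-φ-total (φ ∙ Y)) (*-congʳ (gauss-cong θ {φ ∙ (φ ∙ Y)} {Y} (φ∙φ∙ Y)))) ⟩
        g (φ ∙ Y) * total Y + g Y * total (φ ∙ Y)         ∎

    -- Hasse-Davenport for Ā trades the auxiliary g(φ) of `kummer-φ` for g(Ā) g(φĀ) and brings κ(Ā),
    -- which cancels κ(A).
    kummerSum-evaluation : kummerSum * (g (A ⁻¹) * g (φ ∙ A ⁻¹)) ≈
                           a * g b * g (sq (A ⁻¹)) * (g (φ ∙ Y) * g (A ⁻¹) + g Y * g (φ ∙ A ⁻¹))
    kummerSum-evaluation = *-cancelˡ-#0 (gauss#0 θ φ) (begin
      g φ * (kummerSum * (g (A ⁻¹) * g (φ ∙ A ⁻¹)))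
        ≈⟨ *-assoc _ _ _ ⟨
      g φ * kummerSum * (g (A ⁻¹) * g (φ ∙ A ⁻¹))
        ≈⟨ *-cong kummer-φ (hasse-davenport (A ⁻¹)) ⟩
      a * (κ A * (g b * S)) * (κ (A ⁻¹) * (g φ * g (sq (A ⁻¹))))
        ≈⟨ solve 7 (λ a K b S K′ f s → a :* (K :* (b :* S)) :* (K′ :* (f :* s)) := K :* K′ :* (f :* (a :* b :* s :* S))) refl _ _ _ _ _ _ _ ⟩
      κ A * κ (A ⁻¹) * (g φ * (a * g b * g (sq (A ⁻¹)) * S))
        ≈⟨ trans (*-congʳ (κ-inverse A)) (*-identityˡ _) ⟩
      g φ * (a * g b * g (sq (A ⁻¹)) * S) ∎)
      where
      S : Carrier
      S = g (φ ∙ Y) * g (A ⁻¹) + g Y * g (φ ∙ A ⁻¹)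

  -- Reduction of the ₄F₄ to four Gauss sums, and assembly.

  gˣ : MulChar → Nonzero
  gˣ = gaussˣ θ

  /-* : ∀ x y (y#0 : y # 0#) → x / (y , y#0) * y ≈ x
  /-* x y y#0 = trans (*-assoc _ _ _) (trans (*-congˡ (recip-inverseˡ y#0)) (*-identityʳ x))

  -- `recip` takes the proof of apartness as an argument, so congruence is obtained by cancelling
  -- the denominator.
  /-cong : ∀ {x x′ y y′} {y#0 : y # 0#} {y′#0 : y′ # 0#} → x ≈ x′ → y ≈ y′ → x / (y , y#0) ≈ x′ / (y′ , y′#0)
  /-cong {x} {x′} {y} {y′} {y#0} {y′#0} ex ey = *-cancelˡ-#0 y#0 (begin
    y * (x / (y , y#0))       ≈⟨ trans (*-comm _ _) (/-* x y y#0) ⟩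
    x                         ≈⟨ ex ⟩
    x′                        ≈⟨ trans (*-comm _ _) (/-* x′ y′ y′#0) ⟨
    y′ * (x′ / (y′ , y′#0))   ≈⟨ *-congʳ ey ⟨
    y * (x′ / (y′ , y′#0))    ∎)

  φ⁻¹≈φ : φ ⁻¹ ≈ᶜ φ
  φ⁻¹≈φ x with F.≈0⊎#0 x
  ... | inj₁ x≈0 = trans (character-≈0 (φ ⁻¹) x≈0) (sym (character-≈0 φ x≈0))
  ... | inj₂ x#0 = *-cancelˡ-#0 (character-#0 φ x#0) (trans (∙-inverseʳ φ x) (sym (φ² x)))

  ε⁻¹≈ε : ε ⁻¹ ≈ᶜ ε
  ε⁻¹≈ε = GroupProperties.ε⁻¹≈ε (AbelianGroup.group characterGroup)

  -- Here x and y stand for g(ψχ)/g(ψ) and g(φψχ)/g(φψ). Dividing Hasse-Davenport for ψχ by that for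
  -- ψ removes g(φ) and κ(ψ).
  hasse-davenport-ratio : ∀ ψ χ {x y} → x * g ψ ≈ g (ψ ∙ χ) → y * g (φ ∙ ψ) ≈ g (φ ∙ (ψ ∙ χ)) →
                          x * y * g (sq ψ) ≈ κ χ * g (sq ψ ∙ sq χ)
  hasse-davenport-ratio ψ χ {x} {y} ex ey = *-cancelˡ-#0 (x#0y#0→xy#0 (κ#0 ψ) (gauss#0 θ φ)) (begin
    κ ψ * g φ * (x * y * g (sq ψ))           ≈⟨ solve 5 (λ K f x y s → K :* f :* (x :* y :* s) := x :* y :* (K :* (f :* s))) refl _ _ _ _ _ ⟩
    x * y * (κ ψ * (g φ * g (sq ψ)))         ≈⟨ *-congˡ (hasse-davenport ψ) ⟨
    x * y * (g ψ * g (φ ∙ ψ))                ≈⟨ [ab][cd]≈[ac][bd] _ _ _ _ ⟩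
    x * g ψ * (y * g (φ ∙ ψ))                ≈⟨ *-cong ex ey ⟩
    g (ψ ∙ χ) * g (φ ∙ (ψ ∙ χ))              ≈⟨ hasse-davenport (ψ ∙ χ) ⟩
    κ (ψ ∙ χ) * (g φ * g (sq (ψ ∙ χ)))       ≈⟨ *-cong (κ-∙ ψ χ) (*-congˡ (gauss-cong θ {sq (ψ ∙ χ)} {sq ψ ∙ sq χ} λ x → [ab][cd]≈[ac][bd] _ _ _ _)) ⟩
    κ ψ * κ χ * (g φ * g (sq ψ ∙ sq χ))      ≈⟨ [ab][cd]≈[ac][bd] _ _ _ _ ⟩
    κ ψ * g φ * (κ χ * g (sq ψ ∙ sq χ))      ∎)

  module Evaluation (A B : MulChar) (a≉ε : ¬ (sq A ≈ᶜ ε)) (b²≉ε : ¬ (sq (sq B) ≈ᶜ ε)) where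

    -- The inverse of the lower parameter AB̄; its square `d` is the c of the overview.
    C : MulChar
    C = (A ∙ B ⁻¹) ⁻¹

    a b d ω : MulChar
    a = sq A
    b = sq B
    d = sq C
    ω = b ∙ d

    open FourGaussSums a b d ω (λ _ → refl)

    C≈ : C ≈ᶜ A ⁻¹ ∙ B
    C≈ x = *-congˡ (MulChar.⟦⟧-cong B (inv-involutive x))

    d≈ : d ≈ᶜ sq (A ⁻¹) ∙ sq B
    d≈ x = trans (*-cong (C≈ x) (C≈ x)) ([ab][cd]≈[ac][bd] _ _ _ _)

    ωa≈b² : ω ∙ a ≈ᶜ sq b
    ωa≈b² x = begin
      ⟦ b ⟧ x * ⟦ d ⟧ x * ⟦ a ⟧ x                          ≈⟨ *-congʳ (*-congˡ (d≈ x)) ⟩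
      ⟦ b ⟧ x * (⟦ sq A ⁻¹ ⟧ x * ⟦ b ⟧ x) * ⟦ a ⟧ x        ≈⟨ solve 3 (λ b i a → b :* (i :* b) :* a := a :* i :* (b :* b)) refl _ _ _ ⟩
      ⟦ a ⟧ x * ⟦ a ⁻¹ ⟧ x * ⟦ sq b ⟧ x                    ≈⟨ *-congʳ (∙-inverseʳ a x) ⟩
      ⟦ ε ⟧ x * ⟦ sq b ⟧ x                                 ≈⟨ ∙-identityˡ (sq b) x ⟩
      ⟦ sq b ⟧ x                                           ∎

    term : MulChar → Carrier
    term χ = product (λ i → (g (As i ∙ χ) / gˣ (As i)) * (g ((Bs i ∙ χ) ⁻¹) / gˣ (Bs i ⁻¹))) *
             ⟦ χ ⟧ (F.- F.1#) ^ 4 * ⟦ χ ⟧ F.1#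
      where
      As = A ∷ φ ∙ A ∷ B ∷ φ ∙ B ∷ []
      Bs = ε ∷ φ ∷ A ∙ B ⁻¹ ∷ φ ∙ A ∙ B ⁻¹ ∷ []

    -- The denominator that Hasse-Davenport leaves for the lower pair ε, φ. Its value g(ε) = -1
    -- matches the sign of -1/(q - 1).
    ge : Carrier
    ge = g (sq (ε ⁻¹))

    ge≈-1 : ge ≈ - 1#
    ge≈-1 = trans (gauss-cong θ {sq (ε ⁻¹)} {ε} λ x → trans (*-cong (ε⁻¹≈ε x) (ε⁻¹≈ε x)) (∙-identityˡ ε x))
      (+-inverseˡ-unique _ _ (gauss-ε θ))

    -- The parameters form four pairs ψ, φψ, each giving one Hasse-Davenport ratio. The upper pairs
    -- contribute κ(χ) twice and the lower ones κ(χ̄) twice, which cancel, and χ(-1)⁴ = 1.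
    term-fourGauss : ∀ χ → g a * ge * (g b * g d) * term χ ≈ fourGauss χ
    term-fourGauss χ = begin
      g a * ge * (g b * g d) * (x₀ * y₀ * (x₁ * y₁ * (x₂ * y₂ * (x₃ * y₃ * 1#))) * p ^ 4 * ⟦ χ ⟧ F.1#)
        ≈⟨ *-congˡ (trans (*-cong (trans (*-congˡ p⁴) (*-identityʳ _)) (MulChar.1-homo χ)) (*-identityʳ _)) ⟩
      g a * ge * (g b * g d) * (x₀ * y₀ * (x₁ * y₁ * (x₂ * y₂ * (x₃ * y₃ * 1#))))
        ≈⟨ *-congˡ (trans (*-congˡ (*-congˡ (*-congˡ (*-identityʳ _)))) (trans (sym (*-assoc _ _ _)) (*-cong ([ab][cd]≈[ac][bd] _ _ _ _) ([ab][cd]≈[ac][bd] _ _ _ _)))) ⟩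
      g a * ge * (g b * g d) * (x₀ * x₁ * (y₀ * y₁) * (x₂ * x₃ * (y₂ * y₃)))
        ≈⟨ trans ([ab][cd]≈[ac][bd] _ _ _ _) (*-cong ([ab][cd]≈[ac][bd] _ _ _ _) ([ab][cd]≈[ac][bd] _ _ _ _)) ⟩
      g a * (x₀ * x₁) * (ge * (y₀ * y₁)) * (g b * (x₂ * x₃) * (g d * (y₂ * y₃)))
        ≈⟨ *-cong (*-cong (trans (*-comm _ _) ratio-A) (trans (*-comm _ _) ratio-ε)) (*-cong (trans (*-comm _ _) ratio-B) (trans (*-comm _ _) ratio-C)) ⟩
      κ χ * g (a ∙ sq χ) * (κ (χ ⁻¹) * g (sq (ε ⁻¹) ∙ sq (χ ⁻¹))) * (κ χ * g (b ∙ sq χ) * (κ (χ ⁻¹) * g (d ∙ sq χ ⁻¹)))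
        ≈⟨ *-cong ([ab][cd]≈[ac][bd] _ _ _ _) ([ab][cd]≈[ac][bd] _ _ _ _) ⟩
      κ χ * κ (χ ⁻¹) * (g (a ∙ sq χ) * g (sq (ε ⁻¹) ∙ sq (χ ⁻¹))) * (κ χ * κ (χ ⁻¹) * (g (b ∙ sq χ) * g (d ∙ sq χ ⁻¹)))
        ≈⟨ *-cong (trans (*-congʳ (κ-inverse χ)) (*-identityˡ _)) (trans (*-congʳ (κ-inverse χ)) (*-identityˡ _)) ⟩
      g (a ∙ sq χ) * g (sq (ε ⁻¹) ∙ sq (χ ⁻¹)) * (g (b ∙ sq χ) * g (d ∙ sq χ ⁻¹))
        ≈⟨ *-congʳ (*-congˡ (gauss-cong θ {sq (ε ⁻¹) ∙ sq (χ ⁻¹)} {sq χ ⁻¹} λ x →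
             trans (*-congʳ (trans (*-cong (ε⁻¹≈ε x) (ε⁻¹≈ε x)) (∙-identityˡ ε x))) (∙-identityˡ (sq χ ⁻¹) x))) ⟩
      fourGauss χ ∎
      where
      p x₀ x₁ x₂ x₃ y₀ y₁ y₂ y₃ : Carrier
      p = ⟦ χ ⟧ (F.- F.1#)
      x₀ = g (A ∙ χ) / gˣ A
      x₁ = g ((φ ∙ A) ∙ χ) / gˣ (φ ∙ A)
      x₂ = g (B ∙ χ) / gˣ B
      x₃ = g ((φ ∙ B) ∙ χ) / gˣ (φ ∙ B)
      y₀ = g ((ε ∙ χ) ⁻¹) / gˣ (ε ⁻¹)
      y₁ = g ((φ ∙ χ) ⁻¹) / gˣ (φ ⁻¹)
      y₂ = g ((A ∙ B ⁻¹ ∙ χ) ⁻¹) / gˣ ((A ∙ B ⁻¹) ⁻¹)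
      y₃ = g ((φ ∙ A ∙ B ⁻¹ ∙ χ) ⁻¹) / gˣ ((φ ∙ A ∙ B ⁻¹) ⁻¹)

      p⁴ : p ^ 4 ≈ 1#
      p⁴ = trans (sym (*-assoc _ _ _)) (trans (*-cong (sq-1 χ) (trans (*-congˡ (*-identityʳ p)) (sq-1 χ))) (*-identityˡ 1#))

      quotient-eq : ∀ {ψ ψ′ χ χ′} → ψ ≈ᶜ ψ′ → χ ≈ᶜ χ′ → g χ / gˣ ψ * g ψ′ ≈ g χ′
      quotient-eq {ψ} {ψ′} {χ} {χ′} eψ eχ = trans (*-congˡ (gauss-cong θ {ψ′} {ψ} λ x → sym (eψ x)))
        (trans (/-* (g χ) (g ψ) (gauss#0 θ ψ)) (gauss-cong θ {χ} {χ′} eχ))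

      ratio-A : x₀ * x₁ * g a ≈ κ χ * g (a ∙ sq χ)
      ratio-A = hasse-davenport-ratio A χ
        (quotient-eq {A} {A} {A ∙ χ} {A ∙ χ} (λ _ → refl) (λ _ → refl))
        (quotient-eq {φ ∙ A} {φ ∙ A} {(φ ∙ A) ∙ χ} {φ ∙ (A ∙ χ)} (λ _ → refl) (λ _ → *-assoc _ _ _))

      ratio-B : x₂ * x₃ * g b ≈ κ χ * g (b ∙ sq χ)
      ratio-B = hasse-davenport-ratio B χ
        (quotient-eq {B} {B} {B ∙ χ} {B ∙ χ} (λ _ → refl) (λ _ → refl))
        (quotient-eq {φ ∙ B} {φ ∙ B} {(φ ∙ B) ∙ χ} {φ ∙ (B ∙ χ)} (λ _ → refl) (λ _ → *-assoc _ _ _))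

      ratio-ε : y₀ * y₁ * ge ≈ κ (χ ⁻¹) * g (sq (ε ⁻¹) ∙ sq (χ ⁻¹))
      ratio-ε = hasse-davenport-ratio (ε ⁻¹) (χ ⁻¹)
        (quotient-eq {ε ⁻¹} {ε ⁻¹} {(ε ∙ χ) ⁻¹} {ε ⁻¹ ∙ χ ⁻¹} (λ _ → refl) (λ _ → refl))
        (quotient-eq {φ ⁻¹} {φ ∙ ε ⁻¹} {(φ ∙ χ) ⁻¹} {φ ∙ (ε ⁻¹ ∙ χ ⁻¹)}
          (λ x → trans (φ⁻¹≈φ x) (sym (trans (*-congˡ (ε⁻¹≈ε x)) (trans (*-comm _ _) (∙-identityˡ φ x)))))
          (λ x → *-cong (φ⁻¹≈φ x) (sym (trans (*-congʳ (ε⁻¹≈ε x)) (∙-identityˡ (χ ⁻¹) x)))))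

      ratio-C : y₂ * y₃ * g d ≈ κ (χ ⁻¹) * g (d ∙ sq χ ⁻¹)
      ratio-C = hasse-davenport-ratio C (χ ⁻¹)
        (quotient-eq {C} {C} {(A ∙ B ⁻¹ ∙ χ) ⁻¹} {C ∙ χ ⁻¹} (λ _ → refl) (λ _ → refl))
        (quotient-eq {(φ ∙ A ∙ B ⁻¹) ⁻¹} {φ ∙ C} {(φ ∙ A ∙ B ⁻¹ ∙ χ) ⁻¹} {φ ∙ (C ∙ χ ⁻¹)} φC
          (λ x → trans (*-congʳ (φC x)) (*-assoc _ _ _)))
        where
        φC : (φ ∙ A ∙ B ⁻¹) ⁻¹ ≈ᶜ φ ∙ C
        φC x = trans (*-assoc _ _ _) (*-congʳ (φ⁻¹≈φ x))

    H : Carrier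
    H = (- 1# / (q · 1# - 1# , q-1#0)) * ∑ᶜ term

    -- The factor q - 1 from orthogonality cancels the normalisation, `ge` accounts for its sign,
    -- and a(-1) = A(-1)² = 1.
    H-evaluation : g a * (g b * g d) * H ≈ gaussSum + kummerSum
    H-evaluation = *-cancelˡ-#0 -1#0′ (begin
      - 1# * (g a * (g b * g d) * H)
        ≈⟨ *-congʳ ge≈-1 ⟨
      ge * (g a * (g b * g d) * (r * ∑ᶜ term))
        ≈⟨ solve 6 (λ e a b c r s → e :* (a :* (b :* c) :* (r :* s)) := r :* (a :* e :* (b :* c) :* s)) refl _ _ _ _ _ _ ⟩
      r * (g a * ge * (g b * g d) * ∑ᶜ term)
        ≈⟨ *-congˡ (trans (sumOver-*ˡ allCharacters _ term) (trans (sumOver-cong allCharacters term-fourGauss) ∑ᶜ-fourGauss)) ⟩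
      r * ((q · 1# - 1#) * (gaussSum + ⟦ a ⟧ (F.- F.1#) * kummerSum))
        ≈⟨ sym (*-assoc _ _ _) ⟩
      r * (q · 1# - 1#) * (gaussSum + ⟦ a ⟧ (F.- F.1#) * kummerSum)
        ≈⟨ *-cong (/-* (- 1#) _ q-1#0) (+-congˡ (trans (*-congʳ (sq-1 A)) (*-identityˡ _))) ⟩
      - 1# * (gaussSum + kummerSum) ∎)
      where
      r : Carrier
      r = - 1# / (q · 1# - 1# , q-1#0)
      -1#0′ : - 1# # 0#
      -1#0′ = inverse⇒#0 {y = - 1#} (trans (-1*x≈-x (- 1#)) (-‿involutive 1#))

    A⁻²B² : MulChar
    A⁻²B² = A ⁻¹ ^ᶜ 2 ∙ B ^ᶜ 2

    gaussTerm : Carrier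
    gaussTerm = g (B ^ᶜ 2) * g (A ⁻¹ ^ᶜ 2 ∙ B ^ᶜ 4) / gˣ A⁻²B² / gˣ (B ^ᶜ 4)

    kummerTerm : MulChar → Carrier
    kummerTerm R = g (A ⁻¹ ^ᶜ 2) * g (R ⁻¹ ∙ B ^ᶜ 2) / gˣ (R ⁻¹) / gˣ A⁻²B²

    gd≈ : g d ≈ g A⁻²B²
    gd≈ = gauss-cong θ {d} {A⁻²B²} λ x → trans (d≈ x) (sym (*-cong (^2≈sq (A ⁻¹) x) (^2≈sq B x)))

    -- The factor g(B⁴) clears one denominator and is also the one by which `gaussSum-evaluation`
    -- multiplies; g(d) clears the other.
    gaussTerm-evaluation : g a * (g b * g d) * gaussTerm ≈ gaussSum
    gaussTerm-evaluation = *-cancelˡ-#0 (gauss#0 θ (sq b)) (begin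
      g (sq b) * (g a * (g b * g d) * gaussTerm)
        ≈⟨ *-cong (gauss-cong θ {sq b} {B ^ᶜ 4} λ x → sym (^4≈sq-sq B x)) (*-congʳ (*-congˡ (*-congˡ gd≈))) ⟩
      g (B ^ᶜ 4) * (g a * (g b * g A⁻²B²) * gaussTerm)
        ≈⟨ solve 5 (λ f a b c t → f :* (a :* (b :* c) :* t) := a :* b :* (t :* f :* c)) refl _ _ _ _ _ ⟩
      g a * g b * (gaussTerm * g (B ^ᶜ 4) * g A⁻²B²)
        ≈⟨ *-congˡ (trans (*-congʳ (/-* _ _ (gauss#0 θ (B ^ᶜ 4)))) (/-* _ _ (gauss#0 θ A⁻²B²))) ⟩
      g a * g b * (g (B ^ᶜ 2) * g (A ⁻¹ ^ᶜ 2 ∙ B ^ᶜ 4))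
        ≈⟨ *-congˡ (*-cong (gauss-cong θ {B ^ᶜ 2} {b} (^2≈sq B)) (gauss-cong θ {A ⁻¹ ^ᶜ 2 ∙ B ^ᶜ 4} {ω} ω≈)) ⟩
      g a * g b * (g b * g ω)
        ≈⟨ solve 3 (λ a b w → a :* b :* (b :* w) := a :* w :* (b :* b)) refl _ _ _ ⟩
      g a * g ω * (g b * g b)
        ≈⟨ gaussSum-evaluation a≉ε ωa≈b² b²≉ε ⟨
      gaussSum * g (sq b)
        ≈⟨ *-comm _ _ ⟩
      g (sq b) * gaussSum ∎)
      where
      ω≈ : A ⁻¹ ^ᶜ 2 ∙ B ^ᶜ 4 ≈ᶜ ω
      ω≈ x = trans (*-cong (^2≈sq (A ⁻¹) x) (^4≈sq-sq B x))
        (trans (solve 2 (λ i b → i :* (b :* b) := b :* (i :* b)) refl _ _) (*-congˡ (sym (d≈ x))))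

    kummerTerm-cong : Congruentᶜ kummerTerm
    kummerTerm-cong {R} {R′} e = /-cong (/-cong
      (*-congˡ (gauss-cong θ {R ⁻¹ ∙ B ^ᶜ 2} {R′ ⁻¹ ∙ B ^ᶜ 2} λ x → *-congʳ (e (F.inv x))))
      (gauss-cong θ {R ⁻¹} {R′ ⁻¹} λ x → e (F.inv x))) refl

    -- R′ and Z represent R̄ and R̄b in the form in which `kummerSum-evaluation` produces them.
    kummerTerm-* : ∀ {R R′ Z} → R ⁻¹ ≈ᶜ R′ → R′ ∙ b ≈ᶜ Z → kummerTerm R * g d * g R′ ≈ g (sq (A ⁻¹)) * g Z
    kummerTerm-* {R} {R′} {Z} e e′ = trans
      (*-cong (trans (*-congˡ gd≈) (/-* _ _ (gauss#0 θ A⁻²B²))) (gauss-cong θ {R′} {R ⁻¹} λ x → sym (e x)))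
      (trans (/-* _ _ (gauss#0 θ (R ⁻¹)))
        (*-cong (gauss-cong θ {A ⁻¹ ^ᶜ 2} {sq (A ⁻¹)} (^2≈sq (A ⁻¹)))
                (gauss-cong θ {R ⁻¹ ∙ B ^ᶜ 2} {Z} λ x → trans (*-cong (e x) (^2≈sq B x)) (e′ x))))

    -- The factors g(Ā) and g(φĀ) are the denominators g(R̄) of the two roots. Each summand consumes
    -- its own and keeps the other, which yields the crossed products of `kummerSum-evaluation`.
    kummerTerms-evaluation : g a * (g b * g d) * (kummerTerm A + kummerTerm (φ ∙ A)) ≈ kummerSum
    kummerTerms-evaluation = *-cancelˡ-#0 (x#0y#0→xy#0 (gauss#0 θ (A ⁻¹)) (gauss#0 θ (φ ∙ A ⁻¹))) (begin
      u * v * (g a * (g b * g d) * (kummerTerm A + kummerTerm (φ ∙ A)))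
        ≈⟨ solve 7 (λ u v a b c s t → u :* v :* (a :* (b :* c) :* (s :+ t)) := a :* b :* (t :* c :* v :* u :+ s :* c :* u :* v)) refl _ _ _ _ _ _ _ ⟩
      g a * g b * (kummerTerm (φ ∙ A) * g d * v * u + kummerTerm A * g d * u * v)
        ≈⟨ *-congˡ (+-cong
             (*-congʳ (kummerTerm-* {φ ∙ A} {φ ∙ A ⁻¹} {φ ∙ (A ⁻¹ ∙ b)} (λ x → *-congʳ (φ⁻¹≈φ x)) (λ x → *-assoc _ _ _)))
             (*-congʳ (kummerTerm-* {A} {A ⁻¹} {A ⁻¹ ∙ b} (λ _ → refl) (λ _ → refl)))) ⟩
      g a * g b * (g (sq (A ⁻¹)) * g (φ ∙ (A ⁻¹ ∙ b)) * u + g (sq (A ⁻¹)) * g (A ⁻¹ ∙ b) * v)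
        ≈⟨ solve 7 (λ a b s z y u v → a :* b :* (s :* z :* u :+ s :* y :* v) := a :* b :* s :* (z :* u :+ y :* v)) refl _ _ _ _ _ _ _ ⟩
      g a * g b * g (sq (A ⁻¹)) * (g (φ ∙ (A ⁻¹ ∙ b)) * u + g (A ⁻¹ ∙ b) * v)
        ≈⟨ KummerEvaluation.kummerSum-evaluation A b d ω (λ _ → refl) a≉ε ωa≈b² ⟨
      kummerSum * (u * v)
        ≈⟨ *-comm _ _ ⟩
      u * v * kummerSum ∎)
      where
      u v : Carrier
      u = g (A ⁻¹)
      v = g (φ ∙ A ⁻¹)

    evaluation : H ≈ gaussTerm + sumOver (squareRoots (A ^ᶜ 2)) kummerTerm
    evaluation = *-cancelˡ-#0 (x#0y#0→xy#0 (gauss#0 θ a) (x#0y#0→xy#0 (gauss#0 θ b) (gauss#0 θ d))) (begin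
      g a * (g b * g d) * H
        ≈⟨ H-evaluation ⟩
      gaussSum + kummerSum
        ≈⟨ +-cong gaussTerm-evaluation kummerTerms-evaluation ⟨
      g a * (g b * g d) * gaussTerm + g a * (g b * g d) * (kummerTerm A + kummerTerm (φ ∙ A))
        ≈⟨ distribˡ _ _ _ ⟨
      g a * (g b * g d) * (gaussTerm + (kummerTerm A + kummerTerm (φ ∙ A)))
        ≈⟨ *-congˡ (+-congˡ (sumOver-squareRoots {kummerTerm} (λ {R} {R′} → kummerTerm-cong {R} {R′}) A)) ⟨
      g a * (g b * g d) * (gaussTerm + sumOver (squareRoots (A ^ᶜ 2)) kummerTerm) ∎)

corollary5p1 :
    ∀ {c ℓ₁ ℓ₂ k κ₁ κ₂} (𝔽 : FiniteField c ℓ₁ ℓ₂) (ℂ : AlgebraicallyClosedField₀ k κ₁ κ₂) →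
    let open Characters 𝔽 ℂ in
    OddPrimePower F.q →
    (θ : NontrivialAddChar) (φ A B : MulChar) →
    HasOrderTwo φ →
    ¬ (A ^ᶜ 2 ≈ᶜ ε) →
    ¬ (B ^ᶜ 4 ≈ᶜ ε) →
    let g  = gauss θ
        gˣ = gaussˣ θ
    in
    hypergeometric θ (A ∷ φ ∙ A ∷ B ∷ φ ∙ B ∷ [])
                     (ε ∷ φ ∷ A ∙ B ⁻¹ ∷ φ ∙ A ∙ B ⁻¹ ∷ []) F.1#
    ≈ g (B ^ᶜ 2) * g (A ⁻¹ ^ᶜ 2 ∙ B ^ᶜ 4) / gˣ (A ⁻¹ ^ᶜ 2 ∙ B ^ᶜ 2) / gˣ (B ^ᶜ 4)
      + sumOver (squareRoots (A ^ᶜ 2)) (λ R →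
          g (A ⁻¹ ^ᶜ 2) * g (R ⁻¹ ∙ B ^ᶜ 2) / gˣ (R ⁻¹) / gˣ (A ⁻¹ ^ᶜ 2 ∙ B ^ᶜ 2))
corollary5p1 𝔽 ℂ _ θ φ A B φ-order-two A²≉ε B⁴≉ε =
  QuadraticGaussSums.Evaluation.evaluation 𝔽 ℂ θ φ φ-order-two A B
    (λ e → A²≉ε λ x → trans (^2≈sq A x) (e x))
    (λ e → B⁴≉ε λ x → trans (^4≈sq-sq B x) (e x))
  where
  open Characters.K 𝔽 ℂ using (trans)
  open CharacterSums 𝔽 ℂ using (^2≈sq; ^4≈sq-sq)
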